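{- Let $S$ be a finite alphabet and fix a system of relations $E$ over $S^{\pm}$. The following conditions are equivalent: (1) $E$ is testable. (2) There exist functions $k\colon\mathbb R_{>0}\to\mathbb N$, $P\colon\mathbb R_{>0}\to\mathrm{FinSubsets}(F_S)$ and $\delta\colon\mathbb R_{>0}\to\mathbb R_{>0}$ such that $\varepsilon\mapsto\mathrm{LSM}^{E}_{k(\varepsilon),P(\varepsilon),\delta(\varepsilon)}$ is a family of testers for $E$. (3) $E$ is statistically distinguishable.
   Context: Words and relations. $S=\{s_1,\dots,s_d\}$ is a finite alphabet, $S^{ - }$ its set of formal inverses, $S^{\pm}=S\cup S^{ - }$; $F_S$ is the set of reduced words over $S^{\pm}$ (the free group on $S$). $\mathrm{FinSubsets}(A)$ is the set of finite subsets of $A$. A system of relations $E=\{w_{i,1}=w_{i,2}\}_{i=1}^r$ over $S^{\pm}$ is a finite set of formal equations between words over $S^{\pm}$. $S$-graphs. An $S$-graph is a directed graph (self-loops and multiple edges allowed) with edges labelled by elements of $S$, such that for each $s\in S$ every vertex has exactly one outgoing and exactly one incoming edge labelled $s$. $s_Gx$ is the endpoint of the $s$-labelled edge leaving $x$, $s_G^{ -1}x$ the origin of the $s$-labelled edge entering $x$; for a word $w=w_t\cdots w_1$ ($w_i\in S^{\pm}$), $w_Gx=(w_t)_G(\cdots((w_1)_Gx))$. $\mathcal G_S(n)$ is the set of $S$-graphs with vertex set $[n]=\{1,\dots,n\}$. $\mathrm{GSol}_E(n)$ is the set of $G\in\mathcal G_S(n)$ with $(w_{i,1})_Gx=(w_{i,2})_Gx$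 for all $i$ and all $x\in[n]$. For $G,G'\in\mathcal G_S(n)$, $d^{\mathrm H}(G,G')=\sum_{s\in S}\frac1n|\{x\in[n]: s_Gx\ne s_{G'}x\}|$, and for $\varepsilon>0$, $\mathrm{GSol}_E^{\ge\varepsilon}(n)=\{G\in\mathcal G_S(n): d^{\mathrm H}(G,G')\ge\varepsilon\ \forall G'\in\mathrm{GSol}_E(n)\}$. Testability. A (randomized, adaptive) algorithm that takes $n\in\mathbb N$ and has query access to $G\in\mathcal G_S(n)$ is an $(\varepsilon,q)$-tester for $E$ if: it accepts with probability at least $0.99$ whenever $G\in\mathrm{GSol}_E(n)$; it rejects with probability at least $0.99$ whenever $G\in\mathrm{GSol}_E^{\ge\varepsilon}(n)$; and it makes at most $q$ queries, each of the form "what is $s_Gx$?" with $x\in[n]$, $s\in S^{\pm}$. Running time is not restricted. If for every $\varepsilon>0$ there are $q(\varepsilon)\in\mathbb N$ (independent of $n$) and an $(\varepsilon,q(\varepsilon))$-tester $\mathcal M_\varepsilon$, then $E$ is testable and $\varepsilon\mapsto\mathcal M_\varepsilon$ is a family of testers for $E$. Local statistics. $\mathrm{Stab}_G(x)=\{w\in F_S: w_Gx=x\}$. For finite $P\subset F_S$, $N_{G,P}$ is the distribution, over subsets of $P$, of $\mathrm{Stab}_G(x)\cap P$ when $x$ is a uniformly random vertex of $G$. $d_{\mathrm{TV}}(\theta_1,\theta_2)=\frac12\sum_{x\in\Omega}|\theta_1(x)-\theta_2(x)|$ for distributions on a finite set $\Omega$. $E$ is statistically distinguishable if for every $\varepsilon>0$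 there exist $P(\varepsilon)\in\mathrm{FinSubsets}(F_S)$ and $\delta(\varepsilon)>0$ such that $d_{\mathrm{TV}}(N_{G,P(\varepsilon)},N_{H,P(\varepsilon)})\ge\delta(\varepsilon)$ for every $n\in\mathbb N$, $G\in\mathrm{GSol}_E(n)$ and $H\in\mathrm{GSol}_E^{\ge\varepsilon}(n)$. Local Statistics Matcher $\mathrm{LSM}^E_{k,P,\delta}$ ($k\in\mathbb N$, $P\in\mathrm{FinSubsets}(F_S)$, $\delta>0$): on input $n$ and $G\in\mathcal G_S(n)$, sample $x_1,\dots,x_k$ uniformly and independently from $[n]$; compute $\mathrm{Stab}_G(x_j)\cap P$ for each $j$ by querying $G$ (at most $k\sum_{w\in P}|w|$ queries); let $N^{\mathrm{Emp}}_{G,P}$ be the distribution of $\mathrm{Stab}_G(x_j)\cap P$ for $j$ uniform in $\{1,\dots,k\}$; accept if $\min\{d_{\mathrm{TV}}(N^{\mathrm{Emp}}_{G,P},N_{H,P}): H\in\mathrm{GSol}_E(n)\}\le\delta$, otherwise reject. -}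

module Defs where

open import Data.Bool using (Bool; true; false; T; T?; if_then_else_)
open import Data.Bool.Properties using () renaming (_≟_ to _≟ᵇ_)
open import Data.Fin using (Fin; combine; remQuot)
open import Data.Fin.Properties using (_≟_; all?; any?; remQuot-combine)
open import Data.Fin.Subset using (Subset; inside; outside)
open import Data.Fin.Subset.Properties using (anySubset?)
open import Data.Integer using (+_)
open import Data.List as List using (List; []; _∷_; length; allFin; _++_)
open import Data.List.Relation.Unary.All as All using (All)
open import Data.List.Relation.Unary.Linked using (Linked)
open import Data.List.Relation.Unary.Unique.Propositional using (Unique)
open import Data.Nat as ℕ using (ℕ; zero; suc; NonZero)
open import Data.Product using (Σ; ∃; ∃!; _×_; _,_; proj₁; proj₂)
open import Data.Rational
  using (ℚ; 0ℚ; 1ℚ; ½; _/_; _+_; _-_; _*_; ∣_∣; _≤_; _<_)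
open import Data.Unit using (⊤)
open import Data.Empty using (⊥)
open import Data.Vec as Vec using (Vec; []; _∷_)
open import Data.Vec.Properties using (≡-dec; lookup∘tabulate; tabulate-cong)
open import Relation.Binary.PropositionalEquality
  using (_≡_; _≢_; refl; sym; trans; cong; cong₂; subst)
open import Relation.Nullary using (¬_; Dec; yes; no; does; ¬?; _×-dec_; _→-dec_)
open import Relation.Nullary.Decidable using (map′)

-- Real numbers as Dedekind cuts.  `below q` says whether q ≤ r, so the lower
-- set is closed: {q ∈ ℚ | q ≤ r}.  Read classically, these cuts are exactly the
-- real numbers; membership is Bool-valued because the matcher below has to
-- compare a rational with a real threshold.

record ℝ : Set where
  field
    below     : ℚ → Bool
    inhabited : ∃ λ q → T (below q)
    bounded   : ∃ λ q → ¬ T (below q)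
    downward  : ∀ {p q} → p ≤ q → T (below q) → T (below p)
    closed    : ∀ {q} → (∀ {p} → p < q → T (below p)) → T (below q)

open ℝ public using (below)

infix 4 _≤ℝ_ _ℝ≤_

_≤ℝ_ : ℚ → ℝ → Set
q ≤ℝ r = T (below r q)

_ℝ≤_ : ℝ → ℚ → Set
r ℝ≤ q = ∀ {p} → p ≤ℝ r → p ≤ q

ℝ>0 : Set
ℝ>0 = Σ ℝ λ r → ∃ λ q → 0ℚ < q × q ≤ℝ r

value : ℝ>0 → ℝ
value = proj₁

-- Words over S^± for S = Fin d.  The head of the list is the leftmost letter,
-- which acts last.

data Letter (d : ℕ) : Set where
  _⁺ _⁻ : Fin d → Letter d

inverse : ∀ {d} → Letter d → Letter d
inverse (s ⁺) = s ⁻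
inverse (s ⁻) = s ⁺

Word : ℕ → Set
Word d = List (Letter d)

Reduced : ∀ {d} → Word d → Set
Reduced = Linked λ a b → a ≢ inverse b

record FinSubset (d : ℕ) : Set where
  field
    words   : List (Word d)
    reduced : All Reduced words
    unique  : Unique words

  size : ℕ
  size = length words

open FinSubset public using (words; size)

System : ℕ → Set
System d = List (Word d × Word d)

-- Since an S-graph has at most one s-labelled edge from x to y, its edges form
-- a set of triples; `edge s x y` says that there is an edge x → y labelled s.

record SGraph (d n : ℕ) : Set where
  field
    edge     : Fin d → Fin n → Fin n → Bool
    outgoing : ∀ s x → ∃! _≡_ λ y → T (edge s x y)
    incoming : ∀ s y → ∃! _≡_ λ x → T (edge s x y)

open SGraph public

step : ∀ {d n} → SGraph d n → Letter d → Fin n → Fin n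
step G (s ⁺) x = proj₁ (outgoing G s x)
step G (s ⁻) x = proj₁ (incoming G s x)

act : ∀ {d n} → SGraph d n → Word d → Fin n → Fin n
act G []      x = x
act G (ℓ ∷ w) x = step G ℓ (act G w x)

GSol : ∀ {d n} → System d → SGraph d n → Set
GSol E G = All (λ (u , v) → ∀ x → act G u x ≡ act G v x) E

sumℚ : List ℚ → ℚ
sumℚ = List.foldr _+_ 0ℚ

dH : ∀ {d n} .{{_ : NonZero n}} → SGraph d n → SGraph d n → ℚ
dH {d} {n} G H = sumℚ (List.map
  (λ s → + Vec.count (λ x → ¬? (step G (s ⁺) x ≟ step H (s ⁺) x)) (Vec.allFin n) / n)
  (allFin d))

Far : ∀ {d n} .{{_ : NonZero n}} → System d → ℝ → SGraph d n → Set
Far E ε G = ∀ G′ → GSol E G′ → ε ℝ≤ dH G G′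

-- Randomized adaptive algorithms with query access to an S-graph on Fin n:
-- finite decision trees whose `sample m` nodes draw a fresh uniform element of
-- Fin m.  Real-weighted coins would give no more testers: for fixed n and q, being
-- a tester is a system of rational linear inequalities on the probabilities of
-- the finitely many deterministic trees.

data Algorithm (d n : ℕ) (A : Set) : Set where
  return : A → Algorithm d n A
  query  : Letter d → Fin n → (Fin n → Algorithm d n A) → Algorithm d n A
  sample : (m : ℕ) .{{_ : NonZero m}} → (Fin m → Algorithm d n A) → Algorithm d n A

infixl 1 _>>=_

_>>=_ : ∀ {d n} {A B : Set} → Algorithm d n A → (A → Algorithm d n B) → Algorithm d n B
return a    >>= f = f a
query ℓ x κ >>= f = query ℓ x λ y → κ y >>= f
sample m κ  >>= f = sample m λ i → κ i >>= f

-- Probability that the output is b (true = accept, false = reject).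

Pr : ∀ {d n} → SGraph d n → Bool → Algorithm d n Bool → ℚ
Pr G b (return a)    = if does (a ≟ᵇ b) then 1ℚ else 0ℚ
Pr G b (query ℓ x κ) = Pr G b (κ (step G ℓ x))
Pr G b (sample m κ)  = + 1 / m * sumℚ (List.map (λ i → Pr G b (κ i)) (allFin m))

AtMostQueries : ∀ {d n} {A : Set} → SGraph d n → ℕ → Algorithm d n A → Set
AtMostQueries G q       (return _)    = ⊤
AtMostQueries G zero    (query _ _ _) = ⊥
AtMostQueries G (suc q) (query ℓ x κ) = AtMostQueries G q (κ (step G ℓ x))
AtMostQueries G q       (sample m κ)  = ∀ i → AtMostQueries G q (κ i)

-- The input n ranges over the positive integers.

Procedure : ℕ → Set
Procedure d = (n : ℕ) .{{_ : NonZero n}} → Algorithm d n Bool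

IsTester : ∀ {d} → System d → ℝ → ℕ → Procedure d → Set
IsTester {d} E ε q M = ∀ n .{{_ : NonZero n}} (G : SGraph d n) →
    (GSol E G → + 99 / 100 ≤ Pr G true (M n))
  × (Far E ε G → + 99 / 100 ≤ Pr G false (M n))
  × AtMostQueries G q (M n)

IsFamilyOfTesters : ∀ {d} → System d → (ℝ>0 → Procedure d) → Set
IsFamilyOfTesters E M = ∃ λ (q : ℝ>0 → ℕ) → ∀ ε → IsTester E (value ε) (q ε) (M ε)

Testable : ∀ {d} → System d → Set
Testable {d} E = ∃ λ (M : ℝ>0 → Procedure d) → IsFamilyOfTesters E M

-- Distributions on the subsets of a p-element set.

subsets : ∀ p → List (Subset p)
subsets zero    = [] ∷ []
subsets (suc p) = List.map (inside ∷_) (subsets p) ++ List.map (outside ∷_) (subsets p)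

Distribution : ℕ → Set
Distribution p = Subset p → ℚ

-- The distribution of the j-th entry for uniformly random j.

uniformEntry : ∀ {p m} .{{_ : NonZero m}} → Vec (Subset p) m → Distribution p
uniformEntry {m = m} ωs ω = + Vec.count (λ ω′ → ≡-dec _≟ᵇ_ ω′ ω) ωs / m

dTV : ∀ {p} → Distribution p → Distribution p → ℚ
dTV {p} θ₁ θ₂ = ½ * sumℚ (List.map (λ ω → ∣ θ₁ ω - θ₂ ω ∣) (subsets p))

Stab : ∀ {d n} → SGraph d n → Fin n → Word d → Set
Stab G x w = act G w x ≡ x

Stab? : ∀ {d n} (G : SGraph d n) x w → Dec (Stab G x w)
Stab? G x w = act G w x ≟ x

-- Stab_G(x) ∩ P as a subset of (the positions in the list of elements of) P.

Stab∩ : ∀ {d n} → SGraph d n → Fin n → (P : FinSubset d) → Subset (size P)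
Stab∩ G x P = Vec.map (λ w → does (Stab? G x w)) (Vec.fromList (words P))

N : ∀ {d n} .{{_ : NonZero n}} → SGraph d n → (P : FinSubset d) → Distribution (size P)
N G P = uniformEntry (Vec.tabulate λ x → Stab∩ G x P)

StatisticallyDistinguishable : ∀ {d} → System d → Set
StatisticallyDistinguishable {d} E =
  ∀ (ε : ℝ>0) → ∃ λ (P : FinSubset d) → ∃ λ (δ : ℝ>0) →
  ∀ n .{{_ : NonZero n}} (G H : SGraph d n) →
  GSol E G → Far E (value ε) H → value δ ℝ≤ dTV (N G P) (N H P)

-- There are finitely many S-graphs on Fin n, so one can search for an S-graph
-- with a decidable property that depends only on the edges.

module _ {d n : ℕ} where

  infix 4 _≈_

  _≈_ : SGraph d n → SGraph d n → Set
  G ≈ H = ∀ s x y → edge G s x y ≡ edge H s x y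

  step-cong : ∀ {G H} → G ≈ H → ∀ ℓ x → step G ℓ x ≡ step H ℓ x
  step-cong {G} {H} eq (s ⁺) x with outgoing G s x | outgoing H s x
  ... | y , e , _ | _ , _ , uniq = sym (uniq (subst T (eq s x y) e))
  step-cong {G} {H} eq (s ⁻) x with incoming G s x | incoming H s x
  ... | y , e , _ | _ , _ , uniq = sym (uniq (subst T (eq s y x) e))

  act-cong : ∀ {G H} → G ≈ H → ∀ w x → act G w x ≡ act H w x
  act-cong eq []      x = refl
  act-cong {G} {H} eq (ℓ ∷ w) x =
    trans (cong (step G ℓ) (act-cong eq w x)) (step-cong eq ℓ (act H w x))

  GSol-cong : ∀ {E G H} → G ≈ H → GSol E G → GSol E H
  GSol-cong eq = All.map λ {(u , v)} sol x →
    trans (sym (act-cong eq u x)) (trans (sol x) (act-cong eq v x))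

  Stab∩-cong : ∀ {G H} → G ≈ H → ∀ x P → Stab∩ G x P ≡ Stab∩ H x P
  Stab∩-cong {G} {H} eq x P = go (words P)
    where
    go : ∀ ws → Vec.map (λ w → does (Stab? G x w)) (Vec.fromList ws)
              ≡ Vec.map (λ w → does (Stab? H x w)) (Vec.fromList ws)
    go []       = refl
    go (w ∷ ws) = cong₂ _∷_ (cong (λ y → does (y ≟ x)) (act-cong eq w x)) (go ws)

  N-cong : ∀ .{{_ : NonZero n}} {G H} → G ≈ H → ∀ P → N G P ≡ N H P
  N-cong eq P = cong uniformEntry (tabulate-cong λ x → Stab∩-cong eq x P)

  GSol? : ∀ E (G : SGraph d n) → Dec (GSol E G)
  GSol? E G = All.all? (λ (u , v) → all? λ x → act G u x ≟ act G v x) E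

  private
    ∃!? : (b : Fin n → Bool) → Dec (∃! _≡_ λ y → T (b y))
    ∃!? b = map′ (λ (y , e , u) → y , e , λ {z} → u z) (λ (y , e , u) → y , e , λ z → u {z})
      (any? λ y → T? (b y) ×-dec all? λ z → T? (b z) →-dec (y ≟ z))

    decode : Subset (d ℕ.* (n ℕ.* n)) → Fin d → Fin n → Fin n → Bool
    decode v s x y = Vec.lookup v (combine s (combine x y))

    at : (Fin d → Fin n → Fin n → Bool) → Fin d → Fin n × Fin n → Bool
    at e s (x , y) = e s x y

    atCode : (Fin d → Fin n → Fin n → Bool) → Fin d × Fin (n ℕ.* n) → Bool
    atCode e (s , j) = at e s (remQuot n j)

    encode : (Fin d → Fin n → Fin n → Bool) → Subset (d ℕ.* (n ℕ.* n))
    encode e = Vec.tabulate λ i → atCode e (remQuot (n ℕ.* n) i)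

    decode-encode : ∀ e s x y → decode (encode e) s x y ≡ e s x y
    decode-encode e s x y =
      trans (lookup∘tabulate (λ i → atCode e (remQuot (n ℕ.* n) i)) (combine s (combine x y)))
      (trans (cong (atCode e) (remQuot-combine s (combine x y)))
             (cong (at e s) (remQuot-combine x y)))

  ∃SGraph? : {Q : SGraph d n → Set} → (∀ {G H} → G ≈ H → Q G → Q H) →
             (∀ G → Dec (Q G)) → Dec (∃ Q)
  ∃SGraph? {Q} resp Q? = map′
    (λ (_ , G , _ , q) → G , q)
    (λ (G , q) → encode (edge G) , G , (λ s x y → sym (decode-encode (edge G) s x y)) , q)
    (anySubset? coded?)
    where
    coded? : ∀ v → Dec (∃ λ G → (∀ s x y → edge G s x y ≡ decode v s x y) × Q G)
    coded? v with all? (λ s → all? λ x → ∃!? (decode v s x))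
                | all? (λ s → all? λ y → ∃!? (λ x → decode v s x y))
    ... | yes o | yes i = map′ (λ q → G₀ , (λ _ _ _ → refl) , q) (λ (_ , eq , q) → resp eq q) (Q? G₀)
      where
      G₀ : SGraph d n
      G₀ = record { edge = decode v ; outgoing = o ; incoming = i }
    ... | no ¬o | _ = no λ (G , eq , _) → ¬o λ s x →
      let y , e , u = outgoing G s x in
      y , subst T (eq s x y) e , λ {z} e′ → u (subst T (sym (eq s x z)) e′)
    ... | _ | no ¬i = no λ (G , eq , _) → ¬i λ s y →
      let x , e , u = incoming G s y in
      x , subst T (eq s x y) e , λ {z} e′ → u (subst T (sym (eq s z y)) e′)

-- min { dTV θ N_{H,P} : H ∈ GSol_E(n) } ≤ δ; the minimum is over a finite set.

Matches : ∀ {d} → System d → (n : ℕ) .{{_ : NonZero n}} →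
          (P : FinSubset d) → ℝ → Distribution (size P) → Set
Matches {d} E n P δ θ = ∃ λ (H : SGraph d n) → GSol E H × dTV θ (N H P) ≤ℝ δ

matches? : ∀ {d} (E : System d) n .{{_ : NonZero n}} P δ θ → Dec (Matches {d} E n P δ θ)
matches? E n P δ θ = ∃SGraph?
  (λ {_ _} eq (sol , le) →
     GSol-cong eq sol , subst (λ (ν : Distribution (size P)) → dTV θ ν ≤ℝ δ) (N-cong eq P) le)
  (λ H → GSol? E H ×-dec T? (below δ (dTV θ (N H P))))

-- Local Statistics Matcher.

sampleVertices : ∀ {d n} .{{_ : NonZero n}} k → Algorithm d n (Vec (Fin n) k)
sampleVertices         zero    = return []
sampleVertices {n = n} (suc k) =
  sample n return >>= λ x → sampleVertices k >>= λ xs → return (x ∷ xs)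

walk : ∀ {d n} → Word d → Fin n → Algorithm d n (Fin n)
walk []      x = return x
walk (ℓ ∷ w) x = walk w x >>= λ y → query ℓ y return

mapA : ∀ {d n k} {A B : Set} → (A → Algorithm d n B) → Vec A k → Algorithm d n (Vec B k)
mapA f []       = return []
mapA f (a ∷ as) = f a >>= λ b → mapA f as >>= λ bs → return (b ∷ bs)

computeStab∩ : ∀ {d n} (P : FinSubset d) → Fin n → Algorithm d n (Subset (size P))
computeStab∩ P x =
  mapA (λ w → walk w x >>= λ y → return (does (y ≟ x))) (Vec.fromList (words P))

LSM : ∀ {d} → System d → (k : ℕ) .{{_ : NonZero k}} → FinSubset d → ℝ → Procedure d
LSM E k P δ n =
  sampleVertices k         >>= λ xs →
  mapA (computeStab∩ P) xs >>= λ ωs →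
  return (does (matches? E n P δ (uniformEntry ωs)))

{-# OPTIONS --safe #-}
module Submission where

-- (1) ⇒ (3).  A tester may be run on a uniformly random relabelling of its input, so it only sees
-- what q lazily sampled vertices and their neighbourhoods look like.  If the local statistics of
-- G and H on a ball of words are close, then greedily match the vertices of G and H of equal type.
-- Outside a few leftover vertices, and vertices close to previously seen ones, a vertex of G and
-- its partner in H continue the run in the same way; so the acceptance probabilities of G and H
-- differ by at most 1/2 if n is large.  If n is small, then closeness forces the matching to be
-- perfect, and since the ball contains the relators, H is a solution whenever G is one.
-- (3) ⇒ (2).  By Chebyshev's inequality the empirical distribution of enough samples is close to
-- the true one, and the triangle inequality separates solutions from far graphs.

open import Defs
open import Data.Bool using (Bool; true; false; T; if_then_else_)
open import Data.Bool.Properties using () renaming (_≟_ to _≟ᵇ_)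
open import Data.Empty using (⊥-elim)
open import Data.Fin using (Fin; zero; suc)
open import Data.Fin.Permutation as Perm using (Permutation′; _⟨$⟩ʳ_; _⟨$⟩ˡ_)
import Data.Fin.Permutation.Components as PC
open import Data.Fin.Properties as Finₚ using (_≟_; all?; any?)
open import Data.Fin.Subset using (Subset; inside; outside)
import Data.Integer as ℤ
import Data.Integer.Properties as ℤₚ
open import Data.List as List using (List; []; _∷_; length; allFin; _++_; concatMap)
import Data.List.Properties as Listₚ
open import Data.List.Membership.Propositional using (_∈_; _∉_; lose; find)
import Data.List.Membership.Propositional.Properties as ∈ₚ
open import Data.List.Relation.Unary.All as All using (All; []; _∷_)
import Data.List.Relation.Unary.All.Properties as Allₚ
open import Data.List.Relation.Unary.Unique.DecPropositional.Properties using (deduplicate-!)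
open import Data.List.Relation.Unary.Any as Any using (Any; here; there)
open import Data.List.Relation.Unary.Linked as Linked using (Linked; []; [-]; _∷_)
open import Data.List.Relation.Binary.Permutation.Propositional using (_↭_; ↭⇒↭ₛ; ↭-sym; ↭-trans; ↭-refl; prep)
import Data.List.Relation.Binary.Permutation.Propositional.Properties as ↭ₚ
import Data.List.Relation.Binary.Permutation.Setoid.Properties as ↭ₛₚ
open import Data.Maybe using (Maybe; just; nothing)
open import Data.Nat as ℕ using (ℕ; zero; suc; NonZero)
import Data.Nat.Properties as ℕₚ
open import Data.Product using (∃; _×_; _,_; proj₁; proj₂)
open import Data.Rational
  using (ℚ; mkℚ; 0ℚ; 1ℚ; ½; _/_; _+_; _-_; _*_; -_; ∣_∣; _≤_; _<_; toℚᵘ; nonNegative; positive)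
import Data.Rational.Properties as ℚₚ
open import Data.Rational.Unnormalised as ℚᵘ using (mkℚᵘ; *≡*; *≤*)
import Data.Rational.Unnormalised.Properties as ℚᵘₚ
open import Data.Sum using (inj₁; inj₂)
open import Data.Unit using (tt)
open import Data.Vec as Vec using (Vec; []; _∷_)
import Data.Vec.Properties as Vecₚ
open import Function using (_∘_; id; mk⇔)
open import Function.Bundles using (_⇔_)
open import Relation.Binary.PropositionalEquality
  using (setoid; _≡_; _≢_; _≗_; refl; sym; trans; cong; cong₂; subst; subst₂; module ≡-Reasoning)
open import Relation.Nullary using (¬_; Dec; yes; no; does; ¬?; _×-dec_; _→-dec_; contradiction)
open import Relation.Nullary.Decidable using (from-no; dec-true; dec-false)
open import Tactic.RingSolver using (solve-∀)
import Tactic.RingSolver.Core.AlmostCommutativeRing as ACR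

-- Sums of rationals

-- A tester may exploit the names of vertices, which local statistics ignore. Averaging over
-- relabellings removes the names, and both promises survive because `GSol` and `Far` are invariant
-- under relabelling. Probabilities conditional on a partial relabelling are kept as unnormalised
-- sums over permutations, so an inconsistent partial relabelling simply has weight zero. Only one
-- inequality is proved: `G` is accepted not much more often than `H`. A query at a vertex already
-- named costs nothing in this comparison and a fresh name costs at most `η = 1/(2q+1)`, so `q`
-- queries cost less than one half. A query reveals at most two vertices and shortens the radius of
-- comparison by two, hence the recurring `twice q`. In a small graph a fresh vertex cannot be
-- expected to lie far from the known ones. There arithmetic takes over: the number of unmatched
-- vertices is at most `2n` times the total variation distance, so if `n < n₀` and the distance is
-- below `1/(2 n₀)`, there is none.

ℚ-ring : ACR.AlmostCommutativeRing _ _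
ℚ-ring = ACR.fromCommutativeRing ℚₚ.+-*-commutativeRing is-zero
  where
  is-zero : ∀ p → Maybe (0ℚ ≡ p)
  is-zero p with p ℚₚ.≟ 0ℚ
  ... | yes eq = just (sym eq)
  ... | no _   = nothing

toℚᵘ-/ : ∀ i n .{{_ : NonZero n}} → toℚᵘ (i / n) ℚᵘ.≃ (i ℚᵘ./ n)
toℚᵘ-/ i (suc n) = ℚₚ.toℚᵘ-fromℚᵘ (mkℚᵘ i n)

opaque

  -- Kept opaque so that fractions are not unfolded to their gcd-normalised form; outside this block
  -- only the laws proved in it are available.
  fromℕ : ℕ → ℚ
  fromℕ m = ℤ.+ m / 1

  fromℕ-+ : ∀ a b → fromℕ (a ℕ.+ b) ≡ fromℕ a + fromℕ b
  fromℕ-+ a b = ℚₚ.toℚᵘ-injective (begin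
    toℚᵘ (fromℕ (a ℕ.+ b))              ≈⟨ toℚᵘ-/ (ℤ.+ (a ℕ.+ b)) 1 ⟩
    mkℚᵘ (ℤ.+ (a ℕ.+ b)) 0              ≈⟨ *≡* (cong (ℤ._* (ℤ.+ 1)) (trans (ℤₚ.pos-+ a b)
                                               (sym (cong₂ ℤ._+_ (ℤₚ.*-identityʳ (ℤ.+ a)) (ℤₚ.*-identityʳ (ℤ.+ b)))))) ⟩
    mkℚᵘ (ℤ.+ a) 0 ℚᵘ.+ mkℚᵘ (ℤ.+ b) 0  ≈⟨ ℚᵘₚ.+-cong (toℚᵘ-/ (ℤ.+ a) 1) (toℚᵘ-/ (ℤ.+ b) 1) ⟨
    toℚᵘ (fromℕ a) ℚᵘ.+ toℚᵘ (fromℕ b)  ≈⟨ ℚₚ.toℚᵘ-homo-+ (fromℕ a) (fromℕ b) ⟨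
    toℚᵘ (fromℕ a + fromℕ b)            ∎)
    where open ℚᵘₚ.≃-Reasoning

  fromℕ-0 : fromℕ 0 ≡ 0ℚ
  fromℕ-0 = refl

  fromℕ-1 : fromℕ 1 ≡ 1ℚ
  fromℕ-1 = refl

  fromℕ-* : ∀ a b → fromℕ (a ℕ.* b) ≡ fromℕ a * fromℕ b
  fromℕ-* zero    b = sym (ℚₚ.*-zeroˡ (fromℕ b))
  fromℕ-* (suc a) b = begin
    fromℕ (b ℕ.+ a ℕ.* b)        ≡⟨ fromℕ-+ b (a ℕ.* b) ⟩
    fromℕ b + fromℕ (a ℕ.* b)    ≡⟨ cong (fromℕ b +_) (fromℕ-* a b) ⟩
    fromℕ b + fromℕ a * fromℕ b  ≡⟨ lemma (fromℕ a) (fromℕ b) ⟩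
    (1ℚ + fromℕ a) * fromℕ b     ≡⟨ cong (_* fromℕ b) (fromℕ-+ 1 a) ⟨
    fromℕ (suc a) * fromℕ b      ∎
    where
    open ≡-Reasoning
    lemma : ∀ x y → y + x * y ≡ (1ℚ + x) * y
    lemma = solve-∀ ℚ-ring

  0≤fromℕ : ∀ m → 0ℚ ≤ fromℕ m
  0≤fromℕ m = ℚₚ.nonNegative⁻¹ (fromℕ m) {{ℚₚ.normalize-nonNeg m 1}}

  fromℕ-mono-≤ : ∀ {a b} → a ℕ.≤ b → fromℕ a ≤ fromℕ b
  fromℕ-mono-≤ {a} {b} a≤b = begin
    fromℕ a                    ≡⟨ ℚₚ.+-identityʳ (fromℕ a) ⟨
    fromℕ a + 0ℚ               ≤⟨ ℚₚ.+-monoʳ-≤ (fromℕ a) (0≤fromℕ (b ℕ.∸ a)) ⟩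
    fromℕ a + fromℕ (b ℕ.∸ a)  ≡⟨ fromℕ-+ a (b ℕ.∸ a) ⟨
    fromℕ (a ℕ.+ (b ℕ.∸ a))    ≡⟨ cong fromℕ (ℕₚ.m+[n∸m]≡n a≤b) ⟩
    fromℕ b                    ∎
    where open ℚₚ.≤-Reasoning

  0<fromℕ : ∀ m .{{_ : NonZero m}} → 0ℚ < fromℕ m
  0<fromℕ m = ℚₚ.positive⁻¹ (fromℕ m) {{ℚₚ.normalize-pos m 1}}

  /-as-* : ∀ c n .{{_ : NonZero n}} → ℤ.+ c / n ≡ fromℕ c * (ℤ.+ 1 / n)
  /-as-* c (suc n) = ℚₚ.toℚᵘ-injective (begin
    toℚᵘ (ℤ.+ c / suc n)                      ≈⟨ toℚᵘ-/ (ℤ.+ c) (suc n) ⟩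
    mkℚᵘ (ℤ.+ c) n                            ≈⟨ *≡* (cong₂ ℤ._*_ (sym (ℤₚ.*-identityʳ (ℤ.+ c)))
                                                     (cong (λ k → ℤ.+ suc k) (ℕₚ.+-identityʳ n))) ⟩
    mkℚᵘ (ℤ.+ c) 0 ℚᵘ.* mkℚᵘ (ℤ.+ 1) n        ≈⟨ ℚᵘₚ.*-cong (toℚᵘ-/ (ℤ.+ c) 1) (toℚᵘ-/ (ℤ.+ 1) (suc n)) ⟨
    toℚᵘ (fromℕ c) ℚᵘ.* toℚᵘ (ℤ.+ 1 / suc n)  ≈⟨ ℚₚ.toℚᵘ-homo-* (fromℕ c) (ℤ.+ 1 / suc n) ⟨
    toℚᵘ (fromℕ c * (ℤ.+ 1 / suc n))          ∎)
    where open ℚᵘₚ.≃-Reasoning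

fromℕ-suc : ∀ a → fromℕ (suc a) ≡ 1ℚ + fromℕ a
fromℕ-suc a = trans (fromℕ-+ 1 a) (cong (_+ fromℕ a) fromℕ-1)

0≤1ℚ : 0ℚ ≤ 1ℚ
0≤1ℚ = ℚₚ.nonNegative⁻¹ 1ℚ

n*1/n≡1 : ∀ n .{{_ : NonZero n}} → fromℕ n * (ℤ.+ 1 / n) ≡ 1ℚ
n*1/n≡1 n@(suc k) = ℚₚ.toℚᵘ-injective (begin
  toℚᵘ (fromℕ n * (ℤ.+ 1 / n))  ≡⟨ cong toℚᵘ (/-as-* n n) ⟨
  toℚᵘ (ℤ.+ n / n)              ≈⟨ toℚᵘ-/ (ℤ.+ n) n ⟩
  mkℚᵘ (ℤ.+ n) k                ≈⟨ *≡* (ℤₚ.*-comm (ℤ.+ n) (ℤ.+ 1)) ⟩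
  toℚᵘ 1ℚ                       ∎)
  where open ℚᵘₚ.≃-Reasoning

/-*-cancel : ∀ c n .{{_ : NonZero n}} → (ℤ.+ c / n) * fromℕ n ≡ fromℕ c
/-*-cancel c n = begin
  (ℤ.+ c / n) * fromℕ n              ≡⟨ cong (_* fromℕ n) (/-as-* c n) ⟩
  fromℕ c * (ℤ.+ 1 / n) * fromℕ n    ≡⟨ lemma (fromℕ c) (ℤ.+ 1 / n) (fromℕ n) ⟩
  fromℕ c * (fromℕ n * (ℤ.+ 1 / n))  ≡⟨ cong (fromℕ c *_) (n*1/n≡1 n) ⟩
  fromℕ c * 1ℚ                       ≡⟨ ℚₚ.*-identityʳ (fromℕ c) ⟩
  fromℕ c                            ∎
  where
  open ≡-Reasoning
  lemma : ∀ x y z → x * y * z ≡ x * (z * y)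
  lemma = solve-∀ ℚ-ring

0≤1/n : ∀ n .{{_ : NonZero n}} → 0ℚ ≤ ℤ.+ 1 / n
0≤1/n n = ℚₚ.nonNegative⁻¹ (ℤ.+ 1 / n) {{ℚₚ.normalize-nonNeg 1 n}}

0<1/n : ∀ n .{{_ : NonZero n}} → 0ℚ < ℤ.+ 1 / n
0<1/n n = ℚₚ.positive⁻¹ (ℤ.+ 1 / n) {{ℚₚ.normalize-pos 1 n}}

*-monoˡ : ∀ {r p q} → 0ℚ ≤ r → p ≤ q → r * p ≤ r * q
*-monoˡ {r} 0≤r = ℚₚ.*-monoˡ-≤-nonNeg r {{nonNegative 0≤r}}

*-monoʳ : ∀ {r p q} → 0ℚ ≤ r → p ≤ q → p * r ≤ q * r
*-monoʳ {r} 0≤r = ℚₚ.*-monoʳ-≤-nonNeg r {{nonNegative 0≤r}}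

0≤* : ∀ {p q} → 0ℚ ≤ p → 0ℚ ≤ q → 0ℚ ≤ p * q
0≤* {p} {q} 0≤p 0≤q = subst (_≤ p * q) (ℚₚ.*-zeroʳ p) (*-monoˡ 0≤p 0≤q)

0≤+ : ∀ {p q} → 0ℚ ≤ p → 0ℚ ≤ q → 0ℚ ≤ p + q
0≤+ = ℚₚ.+-mono-≤

p≤p+q : ∀ {p q} → 0ℚ ≤ q → p ≤ p + q
p≤p+q {p} {q} 0≤q = subst (_≤ p + q) (ℚₚ.+-identityʳ p) (ℚₚ.+-monoʳ-≤ p 0≤q)

-- The equation says `y - x ≡ b - a`. Linear inequalities are derived through this form: beyond a
-- known inequality `a ≤ b`, only a ring identity remains to be checked.
≤-from : ∀ {a b x y} → a ≤ b → x + b ≡ y + a → x ≤ y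
≤-from {a} {b} {x} {y} a≤b eq = begin
  x          ≡⟨ insert x b ⟩
  x + b - b  ≡⟨ cong (_- b) eq ⟩
  y + a - b  ≤⟨ ℚₚ.+-monoˡ-≤ (- b) (ℚₚ.+-monoʳ-≤ y a≤b) ⟩
  y + b - b  ≡⟨ insert y b ⟨
  y          ∎
  where
  open ℚₚ.≤-Reasoning
  insert : ∀ p q → p ≡ p + q - q
  insert = solve-∀ ℚ-ring

0≤p² : ∀ p → 0ℚ ≤ p * p
0≤p² p with ℚₚ.≤-total 0ℚ p
... | inj₁ 0≤p = 0≤* 0≤p 0≤p
... | inj₂ p≤0 = subst (0ℚ ≤_) (lemma p) (0≤* 0≤-p 0≤-p)
  where
  0≤-p : 0ℚ ≤ - p
  0≤-p = ℚₚ.neg-antimono-≤ p≤0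
  lemma : ∀ x → - x * - x ≡ x * x
  lemma = solve-∀ ℚ-ring

∑ : {A : Set} → List A → (A → ℚ) → ℚ
∑ xs f = sumℚ (List.map f xs)

module _ {A : Set} where

  ∑-cong-∈ : ∀ {f g : A → ℚ} xs → (∀ {x} → x ∈ xs → f x ≡ g x) → ∑ xs f ≡ ∑ xs g
  ∑-cong-∈ []       eq = refl
  ∑-cong-∈ (x ∷ xs) eq = cong₂ _+_ (eq (here refl)) (∑-cong-∈ xs (eq ∘ there))

  ∑-cong : ∀ {f g : A → ℚ} xs → f ≗ g → ∑ xs f ≡ ∑ xs g
  ∑-cong xs eq = ∑-cong-∈ xs λ {x} _ → eq x

  ∑-mono-∈ : ∀ {f g : A → ℚ} xs → (∀ {x} → x ∈ xs → f x ≤ g x) → ∑ xs f ≤ ∑ xs g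
  ∑-mono-∈ []       le = ℚₚ.≤-refl
  ∑-mono-∈ (x ∷ xs) le = ℚₚ.+-mono-≤ (le (here refl)) (∑-mono-∈ xs (le ∘ there))

  ∑-mono : ∀ {f g : A → ℚ} xs → (∀ x → f x ≤ g x) → ∑ xs f ≤ ∑ xs g
  ∑-mono xs le = ∑-mono-∈ xs λ {x} _ → le x

  ∑-0 : ∀ (xs : List A) → ∑ xs (λ _ → 0ℚ) ≡ 0ℚ
  ∑-0 []       = refl
  ∑-0 (x ∷ xs) = trans (ℚₚ.+-identityˡ _) (∑-0 xs)

  ∑-nonneg : ∀ {f : A → ℚ} xs → (∀ x → 0ℚ ≤ f x) → 0ℚ ≤ ∑ xs f
  ∑-nonneg {f} xs le = subst (_≤ ∑ xs f) (∑-0 xs) (∑-mono xs le)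

  ∑-+ : ∀ (f g : A → ℚ) xs → ∑ xs (λ x → f x + g x) ≡ ∑ xs f + ∑ xs g
  ∑-+ f g []       = refl
  ∑-+ f g (x ∷ xs) = trans (cong (f x + g x +_) (∑-+ f g xs)) (lemma (f x) (g x) (∑ xs f) (∑ xs g))
    where
    lemma : ∀ a b c d → a + b + (c + d) ≡ a + c + (b + d)
    lemma = solve-∀ ℚ-ring

  ∑-*ˡ : ∀ c (f : A → ℚ) xs → ∑ xs (λ x → c * f x) ≡ c * ∑ xs f
  ∑-*ˡ c f []       = sym (ℚₚ.*-zeroʳ c)
  ∑-*ˡ c f (x ∷ xs) = trans (cong (c * f x +_) (∑-*ˡ c f xs)) (sym (ℚₚ.*-distribˡ-+ c (f x) (∑ xs f)))

  ∑-*ʳ : ∀ c (f : A → ℚ) xs → ∑ xs (λ x → f x * c) ≡ ∑ xs f * c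
  ∑-*ʳ c f xs = trans (∑-cong xs λ x → ℚₚ.*-comm (f x) c) (trans (∑-*ˡ c f xs) (ℚₚ.*-comm c (∑ xs f)))

  ∑-const : ∀ c (xs : List A) → ∑ xs (λ _ → c) ≡ fromℕ (length xs) * c
  ∑-const c []       = sym (trans (cong (_* c) fromℕ-0) (ℚₚ.*-zeroˡ c))
  ∑-const c (x ∷ xs) = begin
    c + ∑ xs (λ _ → c)            ≡⟨ cong (c +_) (∑-const c xs) ⟩
    c + fromℕ (length xs) * c     ≡⟨ lemma c (fromℕ (length xs)) ⟩
    (1ℚ + fromℕ (length xs)) * c  ≡⟨ cong (_* c) (fromℕ-suc (length xs)) ⟨
    fromℕ (length (x ∷ xs)) * c   ∎
    where
    open ≡-Reasoning
    lemma : ∀ c x → c + x * c ≡ (1ℚ + x) * c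
    lemma = solve-∀ ℚ-ring

  ∑-++ : ∀ (f : A → ℚ) xs ys → ∑ (xs ++ ys) f ≡ ∑ xs f + ∑ ys f
  ∑-++ f []       ys = sym (ℚₚ.+-identityˡ _)
  ∑-++ f (x ∷ xs) ys = trans (cong (f x +_) (∑-++ f xs ys)) (sym (ℚₚ.+-assoc (f x) (∑ xs f) (∑ ys f)))

  ∑-↭ : ∀ (f : A → ℚ) {xs ys} → xs ↭ ys → ∑ xs f ≡ ∑ ys f
  ∑-↭ f p = ↭ₛₚ.foldr-commMonoid (setoid ℚ) ℚₚ.+-0-isCommutativeMonoid (↭⇒↭ₛ (↭ₚ.map⁺ f p))

  ∑-member : ∀ {f : A → ℚ} {xs x} → (∀ y → 0ℚ ≤ f y) → x ∈ xs → f x ≤ ∑ xs f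
  ∑-member {f} {y ∷ xs} 0≤f (here refl) = p≤p+q (∑-nonneg xs 0≤f)
  ∑-member {f} {y ∷ xs} 0≤f (there x∈) = ℚₚ.≤-trans (∑-member 0≤f x∈)
    (subst (∑ xs f ≤_) (ℚₚ.+-comm (∑ xs f) (f y)) (p≤p+q (0≤f y)))

∑-map : ∀ {A B : Set} (g : A → B) (f : B → ℚ) xs → ∑ (List.map g xs) f ≡ ∑ xs (f ∘ g)
∑-map g f xs = cong sumℚ (sym (Listₚ.map-∘ xs))

∑-swap : ∀ {A B : Set} (f : A → B → ℚ) xs ys →
         ∑ xs (λ x → ∑ ys (f x)) ≡ ∑ ys (λ y → ∑ xs (λ x → f x y))
∑-swap f []       ys = sym (∑-0 ys)
∑-swap f (x ∷ xs) ys = trans (cong (∑ ys (f x) +_) (∑-swap f xs ys)) (sym (∑-+ (f x) _ ys))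

∑-concatMap : ∀ {A B : Set} (g : A → List B) (f : B → ℚ) xs →
              ∑ (concatMap g xs) f ≡ ∑ xs (λ x → ∑ (g x) f)
∑-concatMap g f []       = refl
∑-concatMap g f (x ∷ xs) = trans (∑-++ f (g x) (concatMap g xs)) (cong (∑ (g x) f +_) (∑-concatMap g f xs))

𝟙 : {P : Set} → Dec P → ℚ
𝟙 d = if does d then 1ℚ else 0ℚ

0≤𝟙 : ∀ {P : Set} (d : Dec P) → 0ℚ ≤ 𝟙 d
0≤𝟙 (yes _) = 0≤1ℚ
0≤𝟙 (no _)  = ℚₚ.≤-refl

𝟙≤1 : ∀ {P : Set} (d : Dec P) → 𝟙 d ≤ 1ℚ
𝟙≤1 (yes _) = ℚₚ.≤-refl
𝟙≤1 (no _)  = 0≤1ℚ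

𝟙-yes : ∀ {P : Set} (d : Dec P) → P → 𝟙 d ≡ 1ℚ
𝟙-yes (yes _) _ = refl
𝟙-yes (no ¬p) p = contradiction p ¬p

𝟙-no : ∀ {P : Set} (d : Dec P) → ¬ P → 𝟙 d ≡ 0ℚ
𝟙-no (yes p) ¬p = contradiction p ¬p
𝟙-no (no _)  _  = refl

𝟙-mono : ∀ {P Q : Set} (d : Dec P) (e : Dec Q) → (P → Q) → 𝟙 d ≤ 𝟙 e
𝟙-mono (yes p) e f = ℚₚ.≤-reflexive (sym (𝟙-yes e (f p)))
𝟙-mono (no _)  e f = 0≤𝟙 e

𝟙-⇔ : ∀ {P Q : Set} (d : Dec P) (e : Dec Q) → (P → Q) → (Q → P) → 𝟙 d ≡ 𝟙 e
𝟙-⇔ d e f g = ℚₚ.≤-antisym (𝟙-mono d e f) (𝟙-mono e d g)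

∑-allFin-suc : ∀ m (g : Fin (suc m) → ℚ) → ∑ (allFin (suc m)) g ≡ g zero + ∑ (allFin m) (g ∘ suc)
∑-allFin-suc m g = cong (g zero +_)
  (cong sumℚ (trans (Listₚ.map-tabulate suc g) (sym (Listₚ.map-tabulate id (g ∘ suc)))))

∑-permute : ∀ {n} (f : Fin n → ℚ) (π : Permutation′ n) → ∑ (allFin n) (λ i → f (π ⟨$⟩ʳ i)) ≡ ∑ (allFin n) f
∑-permute {n} f π = begin
  ∑ (allFin n) (λ i → f (π ⟨$⟩ʳ i))  ≡⟨ as-sum n (λ i → f (π ⟨$⟩ʳ i)) ⟩
  S.sum (λ i → f (π ⟨$⟩ʳ i))         ≡⟨ S.sum-permute f π ⟨
  S.sum f                            ≡⟨ as-sum n f ⟨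
  ∑ (allFin n) f                     ∎
  where
  open ≡-Reasoning
  import Algebra.Properties.CommutativeMonoid.Sum ℚₚ.+-0-commutativeMonoid as S
  as-sum : ∀ m (g : Fin m → ℚ) → ∑ (allFin m) g ≡ S.sum g
  as-sum zero    g = refl
  as-sum (suc m) g = trans (∑-allFin-suc m g) (cong (g zero +_) (as-sum m (g ∘ suc)))

∑-single : ∀ {n} (i : Fin n) (f : Fin n → ℚ) → (∀ j → j ≢ i → f j ≡ 0ℚ) → ∑ (allFin n) f ≡ f i
∑-single {suc n} zero f off = begin
  ∑ (allFin (suc n)) f             ≡⟨ ∑-allFin-suc n f ⟩
  f zero + ∑ (allFin n) (f ∘ suc)  ≡⟨ cong (f zero +_) (trans (∑-cong (allFin n) λ j → off (suc j) λ ()) (∑-0 (allFin n))) ⟩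
  f zero + 0ℚ                      ≡⟨ ℚₚ.+-identityʳ (f zero) ⟩
  f zero                           ∎
  where open ≡-Reasoning
∑-single {suc n} (suc i) f off = begin
  ∑ (allFin (suc n)) f             ≡⟨ ∑-allFin-suc n f ⟩
  f zero + ∑ (allFin n) (f ∘ suc)  ≡⟨ cong₂ _+_ (off zero λ ()) (∑-single i (f ∘ suc) λ j j≢i → off (suc j) (j≢i ∘ Finₚ.suc-injective)) ⟩
  0ℚ + f (suc i)                   ≡⟨ ℚₚ.+-identityˡ (f (suc i)) ⟩
  f (suc i)                        ∎
  where open ≡-Reasoning

∑-𝟙-≟ : ∀ {n} (i : Fin n) → ∑ (allFin n) (λ j → 𝟙 (i ≟ j)) ≡ 1ℚ
∑-𝟙-≟ i = trans (∑-single i _ λ j j≢i → 𝟙-no (i ≟ j) (j≢i ∘ sym)) (𝟙-yes (i ≟ i) refl)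

count-as-∑ : ∀ {A : Set} {P : A → Set} (P? : ∀ a → Dec (P a)) {m} (xs : Vec A m) →
             fromℕ (Vec.count P? xs) ≡ ∑ (Vec.toList xs) (λ x → 𝟙 (P? x))
count-as-∑ P? []       = fromℕ-0
count-as-∑ P? (x ∷ xs) with P? x
... | yes _ = trans (fromℕ-suc (Vec.count P? xs)) (cong (1ℚ +_) (count-as-∑ P? xs))
... | no _  = trans (count-as-∑ P? xs) (sym (ℚₚ.+-identityˡ _))

-- Words and relabelled graphs

inverse-involutive : ∀ {d} (ℓ : Letter d) → inverse (inverse ℓ) ≡ ℓ
inverse-involutive (s ⁺) = refl
inverse-involutive (s ⁻) = refl

_≟ᴸ_ : ∀ {d} (ℓ m : Letter d) → Dec (ℓ ≡ m)
(s ⁺) ≟ᴸ (t ⁺) with s ≟ t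
... | yes refl = yes refl
... | no s≢t   = no λ { refl → s≢t refl }
(s ⁻) ≟ᴸ (t ⁻) with s ≟ t
... | yes refl = yes refl
... | no s≢t   = no λ { refl → s≢t refl }
(s ⁺) ≟ᴸ (t ⁻) = no λ ()
(s ⁻) ≟ᴸ (t ⁺) = no λ ()

letters : ∀ d → List (Letter d)
letters d = List.map _⁺ (allFin d) ++ List.map _⁻ (allFin d)

∈-letters : ∀ {d} (ℓ : Letter d) → ℓ ∈ letters d
∈-letters (s ⁺) = ∈ₚ.∈-++⁺ˡ (∈ₚ.∈-map⁺ _⁺ (∈ₚ.∈-allFin s))
∈-letters {d} (s ⁻) = ∈ₚ.∈-++⁺ʳ (List.map _⁺ (allFin d)) (∈ₚ.∈-map⁺ _⁻ (∈ₚ.∈-allFin s))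

wordsUpTo : ∀ d → ℕ → List (Word d)
wordsUpTo d zero    = [] ∷ []
wordsUpTo d (suc r) = [] ∷ concatMap (λ w → List.map (_∷ w) (letters d)) (wordsUpTo d r)

∈-wordsUpTo : ∀ {d r} (w : Word d) → length w ℕ.≤ r → w ∈ wordsUpTo d r
∈-wordsUpTo {r = zero}  []      _            = here refl
∈-wordsUpTo {r = suc r} []      _            = here refl
∈-wordsUpTo {r = suc r} (ℓ ∷ w) (ℕ.s≤s |w|≤r) = there (∈ₚ.∈-concatMap⁺ _
  (lose (∈-wordsUpTo w |w|≤r) (∈ₚ.∈-map⁺ (_∷ w) (∈-letters ℓ))))

inverseWord : ∀ {d} → Word d → Word d
inverseWord []      = []
inverseWord (ℓ ∷ w) = inverseWord w ++ inverse ℓ ∷ []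

length-inverseWord : ∀ {d} (w : Word d) → length (inverseWord w) ≡ length w
length-inverseWord []      = refl
length-inverseWord (ℓ ∷ w) = trans (Listₚ.length-++ (inverseWord w))
  (trans (ℕₚ.+-comm (length (inverseWord w)) 1) (cong suc (length-inverseWord w)))

-- Reduction proceeds from the right end, so a new letter can cancel only against the head of a word
-- that is already reduced.
cancelCons : ∀ {d} → Letter d → Word d → Word d
cancelCons ℓ []      = ℓ ∷ []
cancelCons ℓ (m ∷ w) with ℓ ≟ᴸ inverse m
... | yes _ = w
... | no _  = ℓ ∷ m ∷ w

reduce : ∀ {d} → Word d → Word d
reduce []      = []
reduce (ℓ ∷ w) = cancelCons ℓ (reduce w)

cancelCons-reduced : ∀ {d} (ℓ : Letter d) {w} → Reduced w → Reduced (cancelCons ℓ w)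
cancelCons-reduced ℓ {[]}    red = [-]
cancelCons-reduced ℓ {m ∷ w} red with ℓ ≟ᴸ inverse m
... | yes _  = Linked.tail red
... | no ℓ≢m = ℓ≢m ∷ red

reduce-reduced : ∀ {d} (w : Word d) → Reduced (reduce w)
reduce-reduced []      = []
reduce-reduced (ℓ ∷ w) = cancelCons-reduced ℓ (reduce-reduced w)

-- Words become elements of the free group only after free reduction, and different words may reduce
-- to the same one, hence the deduplication.
ball : ∀ d → ℕ → FinSubset d
ball d r = record
  { words   = List.deduplicate (Listₚ.≡-dec _≟ᴸ_) reducedWords
  ; reduced = Allₚ.deduplicate⁺ (Listₚ.≡-dec _≟ᴸ_) (Allₚ.map⁺ (All.universal reduce-reduced (wordsUpTo d r)))
  ; unique  = deduplicate-! (Listₚ.≡-dec _≟ᴸ_) reducedWords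
  }
  where
  reducedWords : List (Word d)
  reducedWords = List.map reduce (wordsUpTo d r)

reduce-∈-ball : ∀ {d r} (w : Word d) → length w ℕ.≤ r → reduce w ∈ words (ball d r)
reduce-∈-ball w |w|≤r =
  ∈ₚ.∈-deduplicate⁺ (Listₚ.≡-dec _≟ᴸ_) (∈ₚ.∈-map⁺ reduce (∈-wordsUpTo w |w|≤r))

module _ {d n : ℕ} (G : SGraph d n) where

  step-inverseˡ : ∀ ℓ x → step G (inverse ℓ) (step G ℓ x) ≡ x
  step-inverseˡ (s ⁺) x = proj₂ (proj₂ (incoming G s _)) (proj₁ (proj₂ (outgoing G s x)))
  step-inverseˡ (s ⁻) x = proj₂ (proj₂ (outgoing G s _)) (proj₁ (proj₂ (incoming G s x)))

  step-inverseʳ : ∀ ℓ x → step G ℓ (step G (inverse ℓ) x) ≡ x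
  step-inverseʳ ℓ x = subst (λ m → step G m (step G (inverse ℓ) x) ≡ x)
    (inverse-involutive ℓ) (step-inverseˡ (inverse ℓ) x)

  act-++ : ∀ u w x → act G (u ++ w) x ≡ act G u (act G w x)
  act-++ []      w x = refl
  act-++ (ℓ ∷ u) w x = cong (step G ℓ) (act-++ u w x)

  act-inverseWordˡ : ∀ w x → act G (inverseWord w) (act G w x) ≡ x
  act-inverseWordˡ []      x = refl
  act-inverseWordˡ (ℓ ∷ w) x = begin
    act G (inverseWord w ++ inverse ℓ ∷ []) (step G ℓ (act G w x))
      ≡⟨ act-++ (inverseWord w) (inverse ℓ ∷ []) (step G ℓ (act G w x)) ⟩
    act G (inverseWord w) (step G (inverse ℓ) (step G ℓ (act G w x)))
      ≡⟨ cong (act G (inverseWord w)) (step-inverseˡ ℓ (act G w x)) ⟩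
    act G (inverseWord w) (act G w x)
      ≡⟨ act-inverseWordˡ w x ⟩
    x ∎
    where open ≡-Reasoning

  act-injective : ∀ w {x y} → act G w x ≡ act G w y → x ≡ y
  act-injective w {x} {y} eq = trans (sym (act-inverseWordˡ w x))
    (trans (cong (act G (inverseWord w)) eq) (act-inverseWordˡ w y))

  act-cancelCons : ∀ ℓ w x → act G (cancelCons ℓ w) x ≡ step G ℓ (act G w x)
  act-cancelCons ℓ []      x = refl
  act-cancelCons ℓ (m ∷ w) x with ℓ ≟ᴸ inverse m
  ... | yes refl = sym (step-inverseˡ m (act G w x))
  ... | no _     = refl

  act-reduce : ∀ w x → act G (reduce w) x ≡ act G w x
  act-reduce []      x = refl
  act-reduce (ℓ ∷ w) x = trans (act-cancelCons ℓ (reduce w) x) (cong (step G ℓ) (act-reduce w x))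

Stab∩-∈ : ∀ {d m n} (G : SGraph d m) (H : SGraph d n) {v v′} (P : FinSubset d) →
          Stab∩ G v P ≡ Stab∩ H v′ P → ∀ {w} → w ∈ words P → Stab G v w → Stab H v′ w
Stab∩-∈ G H {v} {v′} P eq = go (words P) eq
  where
  go : ∀ ws → Vec.map (λ w → does (Stab? G v w)) (Vec.fromList ws)
            ≡ Vec.map (λ w → does (Stab? H v′ w)) (Vec.fromList ws) →
       ∀ {w} → w ∈ ws → Stab G v w → Stab H v′ w
  go (w ∷ ws) eq (here refl) stab with Stab? G v w | Stab? H v′ w
  ... | _       | yes stab′ = stab′
  ... | no ¬st  | no _      = contradiction stab ¬st
  go (w ∷ ws) eq (there w∈) stab = go ws (Vecₚ.∷-injectiveʳ eq) w∈ stab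

-- Reduction preserves the action and lands in the ball, so agreement on reduced words extends to
-- the unreduced concatenations that occur later.
Stab∩-ball : ∀ {d m n} (G : SGraph d m) (H : SGraph d n) r {v v′} →
             Stab∩ G v (ball d r) ≡ Stab∩ H v′ (ball d r) →
             ∀ w → length w ℕ.≤ r → Stab G v w → Stab H v′ w
Stab∩-ball G H r {v} {v′} eq w |w|≤r stab = trans (sym (act-reduce H w v′))
  (Stab∩-∈ G H (ball _ r) eq (reduce-∈-ball w |w|≤r) (trans (act-reduce G w v) stab))

module _ {d n : ℕ} where

  -- The vertices of the new graph are labels: `π` sends a label to the vertex of `G` that it names,
  -- and is an isomorphism from the relabelled graph to `G`.
  relabel : SGraph d n → Permutation′ n → SGraph d n
  relabel G π = record
    { edge     = λ s x y → edge G s (π ⟨$⟩ʳ x) (π ⟨$⟩ʳ y)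
    ; outgoing = λ s x → let y , e , u = outgoing G s (π ⟨$⟩ʳ x) in
        π ⟨$⟩ˡ y , subst (λ v → T (edge G s _ v)) (sym (Perm.inverseʳ π)) e ,
        λ e′ → trans (cong (π ⟨$⟩ˡ_) (u e′)) (Perm.inverseˡ π)
    ; incoming = λ s y → let x , e , u = incoming G s (π ⟨$⟩ʳ y) in
        π ⟨$⟩ˡ x , subst (λ v → T (edge G s v _)) (sym (Perm.inverseʳ π)) e ,
        λ e′ → trans (cong (π ⟨$⟩ˡ_) (u e′)) (Perm.inverseˡ π)
    }

  step-relabel : ∀ G π ℓ x → step (relabel G π) ℓ x ≡ π ⟨$⟩ˡ (step G ℓ (π ⟨$⟩ʳ x))
  step-relabel G π (s ⁺) x = refl
  step-relabel G π (s ⁻) x = refl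

  act-relabel : ∀ G π w x → act (relabel G π) w x ≡ π ⟨$⟩ˡ (act G w (π ⟨$⟩ʳ x))
  act-relabel G π []      x = sym (Perm.inverseˡ π)
  act-relabel G π (ℓ ∷ w) x = begin
    step (relabel G π) ℓ (act (relabel G π) w x)
      ≡⟨ step-relabel G π ℓ (act (relabel G π) w x) ⟩
    π ⟨$⟩ˡ (step G ℓ (π ⟨$⟩ʳ act (relabel G π) w x))
      ≡⟨ cong (λ y → π ⟨$⟩ˡ (step G ℓ (π ⟨$⟩ʳ y))) (act-relabel G π w x) ⟩
    π ⟨$⟩ˡ (step G ℓ (π ⟨$⟩ʳ (π ⟨$⟩ˡ act G w (π ⟨$⟩ʳ x))))
      ≡⟨ cong (λ y → π ⟨$⟩ˡ (step G ℓ y)) (Perm.inverseʳ π) ⟩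
    π ⟨$⟩ˡ (step G ℓ (act G w (π ⟨$⟩ʳ x))) ∎
    where open ≡-Reasoning

  GSol-relabel : ∀ {E} G π → GSol E G → GSol E (relabel G π)
  GSol-relabel G π = All.map λ {(u , w)} sol x →
    trans (act-relabel G π u x) (trans (cong (π ⟨$⟩ˡ_) (sol (π ⟨$⟩ʳ x))) (sym (act-relabel G π w x)))

toList-tabulate : ∀ {A : Set} {n} (f : Fin n → A) → Vec.toList (Vec.tabulate f) ≡ List.map f (allFin n)
toList-tabulate {n = n} f = trans (go n f) (sym (Listₚ.map-tabulate id f))
  where
  go : ∀ {A : Set} n (f : Fin n → A) → Vec.toList (Vec.tabulate f) ≡ List.tabulate f
  go zero    f = refl
  go (suc n) f = cong (f zero ∷_) (go n (f ∘ suc))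

countFin-as-∑ : ∀ {n} {P : Fin n → Set} (P? : ∀ x → Dec (P x)) →
                fromℕ (Vec.count P? (Vec.allFin n)) ≡ ∑ (allFin n) (λ x → 𝟙 (P? x))
countFin-as-∑ {n} P? = trans (count-as-∑ P? (Vec.allFin n))
  (trans (cong (λ xs → ∑ xs (λ x → 𝟙 (P? x))) (toList-tabulate id)) (∑-map id (λ x → 𝟙 (P? x)) (allFin n)))

module _ {d n : ℕ} .{{_ : NonZero n}} where

  -- Reindexing the count by `π` turns a disagreement at a label into one at the vertex it names;
  -- the permutation thereby moves, inverted, to the other argument.
  dH-relabel : ∀ (H G : SGraph d n) π → dH (relabel H π) G ≡ dH H (relabel G (Perm.flip π))
  dH-relabel H G π = ∑-cong (allFin d) λ s → begin
    ℤ.+ Vec.count (differ₁ s) (Vec.allFin n) / n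
      ≡⟨ /-as-* (Vec.count (differ₁ s) (Vec.allFin n)) n ⟩
    fromℕ (Vec.count (differ₁ s) (Vec.allFin n)) * (ℤ.+ 1 / n)
      ≡⟨ cong (_* (ℤ.+ 1 / n)) (countFin-as-∑ (differ₁ s)) ⟩
    ∑ (allFin n) (λ x → 𝟙 (differ₁ s x)) * (ℤ.+ 1 / n)
      ≡⟨ cong (_* (ℤ.+ 1 / n)) (∑-cong (allFin n) λ x → 𝟙-⇔ (differ₁ s x) (differ₂ s (π ⟨$⟩ʳ x))
           (λ ne eq → ne (to s x eq)) (λ ne eq → ne (from s x eq))) ⟩
    ∑ (allFin n) (λ x → 𝟙 (differ₂ s (π ⟨$⟩ʳ x))) * (ℤ.+ 1 / n)
      ≡⟨ cong (_* (ℤ.+ 1 / n)) (∑-permute (λ x → 𝟙 (differ₂ s x)) π) ⟩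
    ∑ (allFin n) (λ x → 𝟙 (differ₂ s x)) * (ℤ.+ 1 / n)
      ≡⟨ cong (_* (ℤ.+ 1 / n)) (countFin-as-∑ (differ₂ s)) ⟨
    fromℕ (Vec.count (differ₂ s) (Vec.allFin n)) * (ℤ.+ 1 / n)
      ≡⟨ /-as-* (Vec.count (differ₂ s) (Vec.allFin n)) n ⟨
    ℤ.+ Vec.count (differ₂ s) (Vec.allFin n) / n ∎
    where
    open ≡-Reasoning
    differ₁ : ∀ s x → Dec (¬ step (relabel H π) (s ⁺) x ≡ step G (s ⁺) x)
    differ₁ s x = ¬? (step (relabel H π) (s ⁺) x ≟ step G (s ⁺) x)
    differ₂ : ∀ s x → Dec (¬ step H (s ⁺) x ≡ step (relabel G (Perm.flip π)) (s ⁺) x)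
    differ₂ s x = ¬? (step H (s ⁺) x ≟ step (relabel G (Perm.flip π)) (s ⁺) x)
    to : ∀ s x → step H (s ⁺) (π ⟨$⟩ʳ x) ≡ step (relabel G (Perm.flip π)) (s ⁺) (π ⟨$⟩ʳ x) →
         step (relabel H π) (s ⁺) x ≡ step G (s ⁺) x
    to s x eq = trans (cong (π ⟨$⟩ˡ_) eq) (trans (Perm.inverseˡ π) (cong (step G (s ⁺)) (Perm.inverseˡ π)))
    from : ∀ s x → step (relabel H π) (s ⁺) x ≡ step G (s ⁺) x →
           step H (s ⁺) (π ⟨$⟩ʳ x) ≡ step (relabel G (Perm.flip π)) (s ⁺) (π ⟨$⟩ʳ x)
    from s x eq = trans (sym (Perm.inverseʳ π)) (cong (π ⟨$⟩ʳ_) (trans eq (cong (step G (s ⁺)) (sym (Perm.inverseˡ π)))))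

  -- Solutions are closed under relabelling, so a solution near the relabelled graph would pull back
  -- to one equally near `H`.
  Far-relabel : ∀ {E ε} (H : SGraph d n) π → Far E ε H → Far E ε (relabel H π)
  Far-relabel {E} {ε} H π far G sol =
    subst (ε ℝ≤_) (sym (dH-relabel H G π)) (far (relabel G (Perm.flip π)) (GSol-relabel G (Perm.flip π) sol))

  dH-self : ∀ (G : SGraph d n) → dH G G ≡ 0ℚ
  dH-self G = trans (∑-cong (allFin d) λ s → begin
    ℤ.+ Vec.count (differ s) (Vec.allFin n) / n
      ≡⟨ /-as-* (Vec.count (differ s) (Vec.allFin n)) n ⟩
    fromℕ (Vec.count (differ s) (Vec.allFin n)) * (ℤ.+ 1 / n)
      ≡⟨ cong (_* (ℤ.+ 1 / n)) (countFin-as-∑ (differ s)) ⟩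
    ∑ (allFin n) (λ x → 𝟙 (differ s x)) * (ℤ.+ 1 / n)
      ≡⟨ cong (_* (ℤ.+ 1 / n)) (trans (∑-cong (allFin n) λ x → 𝟙-no (differ s x) λ ne → ne refl) (∑-0 (allFin n))) ⟩
    0ℚ * (ℤ.+ 1 / n)
      ≡⟨ ℚₚ.*-zeroˡ (ℤ.+ 1 / n) ⟩
    0ℚ ∎) (∑-0 (allFin d))
    where
    open ≡-Reasoning
    differ : ∀ s x → Dec (¬ step G (s ⁺) x ≡ step G (s ⁺) x)
    differ s x = ¬? (step G (s ⁺) x ≟ step G (s ⁺) x)

  -- A solution has distance zero to itself, while `ε` is at least some positive rational.
  Far⇒¬GSol : ∀ {E} (ε : ℝ>0) (H : SGraph d n) → Far E (value ε) H → ¬ GSol E H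
  Far⇒¬GSol (_ , q , 0<q , q≤ε) H far sol =
    ℚₚ.<-irrefl refl (ℚₚ.<-≤-trans 0<q (subst (q ≤_) (dH-self H) (far H sol q≤ε)))

-- Uniformly random permutations

allVec : ∀ n m → List (Vec (Fin n) m)
allVec n zero    = [] ∷ []
allVec n (suc m) = concatMap (λ v → List.map (v ∷_) (allVec n m)) (allFin n)

∑-allVec-suc : ∀ n m (f : Vec (Fin n) (suc m) → ℚ) →
               ∑ (allVec n (suc m)) f ≡ ∑ (allFin n) (λ v → ∑ (allVec n m) (λ vs → f (v ∷ vs)))
∑-allVec-suc n m f = trans (∑-concatMap (λ v → List.map (v ∷_) (allVec n m)) f (allFin n)) (∑-cong (allFin n) λ v → ∑-map (v ∷_) f (allVec n m))

∈-allVec : ∀ {n m} (vs : Vec (Fin n) m) → vs ∈ allVec n m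
∈-allVec []       = here refl
∈-allVec (v ∷ vs) = ∈ₚ.∈-concatMap⁺ (λ v → List.map (v ∷_) (allVec _ _)) (lose (∈ₚ.∈-allFin v) (∈ₚ.∈-map⁺ (v ∷_) (∈-allVec vs)))

∑-allVec-permute : ∀ {n} m (f : Vec (Fin n) m → ℚ) (ρ : Permutation′ n) →
                   ∑ (allVec n m) (λ vs → f (Vec.map (ρ ⟨$⟩ʳ_) vs)) ≡ ∑ (allVec n m) f
∑-allVec-permute zero f ρ = refl
∑-allVec-permute {n} (suc m) f ρ = begin
  ∑ (allVec n (suc m)) (λ vs → f (Vec.map (ρ ⟨$⟩ʳ_) vs))
    ≡⟨ ∑-allVec-suc n m (λ vs → f (Vec.map (ρ ⟨$⟩ʳ_) vs)) ⟩
  ∑ (allFin n) (λ v → ∑ (allVec n m) (λ vs → f ((ρ ⟨$⟩ʳ v) ∷ Vec.map (ρ ⟨$⟩ʳ_) vs)))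
    ≡⟨ ∑-cong (allFin n) (λ v → ∑-allVec-permute m (λ vs → f ((ρ ⟨$⟩ʳ v) ∷ vs)) ρ) ⟩
  ∑ (allFin n) (λ v → ∑ (allVec n m) (λ vs → f ((ρ ⟨$⟩ʳ v) ∷ vs)))
    ≡⟨ ∑-permute (λ v → ∑ (allVec n m) (λ vs → f (v ∷ vs))) ρ ⟩
  ∑ (allFin n) (λ v → ∑ (allVec n m) (λ vs → f (v ∷ vs)))
    ≡⟨ ∑-allVec-suc n m f ⟨
  ∑ (allVec n (suc m)) f ∎
  where open ≡-Reasoning

-- Surjectivity is recorded next to injectivity so that the inverse can be read off directly instead
-- of through the pigeonhole principle.
Bijective : ∀ {n} → Vec (Fin n) n → Set
Bijective vs = (∀ x y → Vec.lookup vs x ≡ Vec.lookup vs y → x ≡ y)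
             × (∀ v → ∃ λ x → Vec.lookup vs x ≡ v)

bijective? : ∀ {n} (vs : Vec (Fin n) n) → Dec (Bijective vs)
bijective? vs =
  (all? λ x → all? λ y → (Vec.lookup vs x ≟ Vec.lookup vs y) →-dec (x ≟ y)) ×-dec
  (all? λ v → any? λ x → Vec.lookup vs x ≟ v)

toPermutation : ∀ {n} (vs : Vec (Fin n) n) → Bijective vs → Permutation′ n
toPermutation vs (inj , sur) = Perm.permutation (Vec.lookup vs) (λ v → proj₁ (sur v))
  (λ v → proj₂ (sur v)) (λ x → inj _ _ (proj₂ (sur (Vec.lookup vs x))))

fromBijective : ∀ {n} (vs : Vec (Fin n) n) → Dec (Bijective vs) → List (Permutation′ n)
fromBijective vs (yes b) = toPermutation vs b ∷ []
fromBijective vs (no _)  = []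

asPermutation : ∀ {n} → Vec (Fin n) n → List (Permutation′ n)
asPermutation vs = fromBijective vs (bijective? vs)

permutations : ∀ n → List (Permutation′ n)
permutations n = concatMap asPermutation (allVec n n)

bijective-∘ : ∀ {n} (ρ : Permutation′ n) (vs : Vec (Fin n) n) → Bijective vs → Bijective (Vec.map (ρ ⟨$⟩ʳ_) vs)
bijective-∘ ρ vs (inj , sur) =
  (λ x y eq → inj x y (trans (sym (back x)) (trans (cong (ρ ⟨$⟩ˡ_) eq) (back y)))) ,
  (λ v → let x , eq = sur (ρ ⟨$⟩ˡ v) in
     x , trans (Vecₚ.lookup-map x (ρ ⟨$⟩ʳ_) vs) (trans (cong (ρ ⟨$⟩ʳ_) eq) (Perm.inverseʳ ρ)))
  where
  back : ∀ x → ρ ⟨$⟩ˡ Vec.lookup (Vec.map (ρ ⟨$⟩ʳ_) vs) x ≡ Vec.lookup vs x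
  back x = trans (cong (ρ ⟨$⟩ˡ_) (Vecₚ.lookup-map x (ρ ⟨$⟩ʳ_) vs)) (Perm.inverseˡ ρ)

bijective-∘⁻ : ∀ {n} (ρ : Permutation′ n) (vs : Vec (Fin n) n) → Bijective (Vec.map (ρ ⟨$⟩ʳ_) vs) → Bijective vs
bijective-∘⁻ ρ vs bij = subst Bijective eq (bijective-∘ (Perm.flip ρ) (Vec.map (ρ ⟨$⟩ʳ_) vs) bij)
  where
  eq : Vec.map (ρ ⟨$⟩ˡ_) (Vec.map (ρ ⟨$⟩ʳ_) vs) ≡ vs
  eq = trans (sym (Vecₚ.map-∘ (ρ ⟨$⟩ˡ_) (ρ ⟨$⟩ʳ_) vs))
    (trans (Vecₚ.map-cong (λ _ → Perm.inverseˡ ρ) vs) (Vecₚ.map-id vs))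

-- Composition with `ρ` permutes the bijective tables, so the uniform measure on the symmetric group
-- is invariant. Two permutations with the same table agree only pointwise, which is why `f` has to
-- respect `Perm.≈`.
∑-permutations-∘ : ∀ {n} (f : Permutation′ n → ℚ) (ρ : Permutation′ n) →
                   (∀ {π π′} → π Perm.≈ π′ → f π ≡ f π′) →
                   ∑ (permutations n) (λ π → f (π Perm.∘ₚ ρ)) ≡ ∑ (permutations n) f
∑-permutations-∘ {n} f ρ resp = begin
  ∑ (permutations n) (λ π → f (π Perm.∘ₚ ρ))
    ≡⟨ ∑-concatMap asPermutation (λ π → f (π Perm.∘ₚ ρ)) (allVec n n) ⟩
  ∑ (allVec n n) (λ vs → ∑ (asPermutation vs) (λ π → f (π Perm.∘ₚ ρ)))
    ≡⟨ ∑-cong (allVec n n) (λ vs → each vs (bijective? vs) (bijective? (Vec.map (ρ ⟨$⟩ʳ_) vs))) ⟩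
  ∑ (allVec n n) (λ vs → ∑ (asPermutation (Vec.map (ρ ⟨$⟩ʳ_) vs)) f)
    ≡⟨ ∑-allVec-permute n (λ vs → ∑ (asPermutation vs) f) ρ ⟩
  ∑ (allVec n n) (λ vs → ∑ (asPermutation vs) f)
    ≡⟨ ∑-concatMap asPermutation f (allVec n n) ⟨
  ∑ (permutations n) f ∎
  where
  open ≡-Reasoning
  each : ∀ vs (d : Dec (Bijective vs)) (e : Dec (Bijective (Vec.map (ρ ⟨$⟩ʳ_) vs))) →
         ∑ (fromBijective vs d) (λ π → f (π Perm.∘ₚ ρ)) ≡ ∑ (fromBijective (Vec.map (ρ ⟨$⟩ʳ_) vs) e) f
  each vs (yes b) (yes c) = cong (_+ 0ℚ) (resp {toPermutation vs b Perm.∘ₚ ρ} {toPermutation (Vec.map (ρ ⟨$⟩ʳ_) vs) c} λ x → sym (Vecₚ.lookup-map x (ρ ⟨$⟩ʳ_) vs))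
  each vs (yes b) (no ¬c) = contradiction (bijective-∘ ρ vs b) ¬c
  each vs (no ¬b) (yes c) = contradiction (bijective-∘⁻ ρ vs c) ¬b
  each vs (no _)  (no _)  = refl

permutations-inhabited : ∀ n → ∃ λ π → π ∈ permutations n
permutations-inhabited n = let π , π∈ = inhabited (bijective? (Vec.allFin n)) in
  π , ∈ₚ.∈-concatMap⁺ asPermutation (lose (∈-allVec (Vec.allFin n)) π∈)
  where
  identity-bijective : Bijective (Vec.allFin n)
  identity-bijective =
    (λ x y eq → trans (sym (Vecₚ.lookup-allFin x)) (trans eq (Vecₚ.lookup-allFin y))) ,
    (λ v → v , Vecₚ.lookup-allFin v)
  inhabited : (b? : Dec (Bijective (Vec.allFin n))) → ∃ λ π → π ∈ fromBijective (Vec.allFin n) b?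
  inhabited (yes b) = toPermutation (Vec.allFin n) b , here refl
  inhabited (no ¬b) = contradiction identity-bijective ¬b

-- Permutations extending a partial map

module _ {n : ℕ} where

  -- A substitute for the indicator of membership: at least one on members, and with total over all
  -- vertices exactly the length of the list, whatever repetitions it has.
  occurrences : List (Fin n) → Fin n → ℚ
  occurrences us v = ∑ us (λ u → 𝟙 (u ≟ v))

  0≤occurrences : ∀ us v → 0ℚ ≤ occurrences us v
  0≤occurrences us v = ∑-nonneg us λ u → 0≤𝟙 (u ≟ v)

  ∈⇒1≤occurrences : ∀ {us v} → v ∈ us → 1ℚ ≤ occurrences us v
  ∈⇒1≤occurrences {us} {v} v∈ = subst (_≤ occurrences us v) (𝟙-yes (v ≟ v) refl)
    (∑-member {f = λ u → 𝟙 (u ≟ v)} (λ u → 0≤𝟙 (u ≟ v)) v∈)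

  ∑-occurrences : ∀ us → ∑ (allFin n) (occurrences us) ≡ fromℕ (length us)
  ∑-occurrences us = begin
    ∑ (allFin n) (λ v → ∑ us (λ u → 𝟙 (u ≟ v)))    ≡⟨ ∑-swap (λ v u → 𝟙 (u ≟ v)) (allFin n) us ⟩
    ∑ us (λ u → ∑ (allFin n) (λ v → 𝟙 (u ≟ v)))    ≡⟨ ∑-cong us ∑-𝟙-≟ ⟩
    ∑ us (λ _ → 1ℚ)                                ≡⟨ ∑-const 1ℚ us ⟩
    fromℕ (length us) * 1ℚ                         ≡⟨ ℚₚ.*-identityʳ (fromℕ (length us)) ⟩
    fromℕ (length us)                              ∎
    where open ≡-Reasoning

  PartialMap : Set
  PartialMap = List (Fin n × Fin n)

  Extends : PartialMap → Permutation′ n → Set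
  Extends φ π = All (λ (x , v) → π ⟨$⟩ʳ x ≡ v) φ

  extends? : ∀ φ π → Dec (Extends φ π)
  extends? φ π = All.all? (λ (x , v) → π ⟨$⟩ʳ x ≟ v) φ

  -- Unnormalised expectation over the uniformly random permutations extending φ.
  𝔼 : PartialMap → (Permutation′ n → ℚ) → ℚ
  𝔼 φ f = ∑ (permutations n) (λ π → 𝟙 (extends? φ π) * f π)

  𝔼-cong : ∀ φ {f g : Permutation′ n → ℚ} → (∀ π → Extends φ π → f π ≡ g π) → 𝔼 φ f ≡ 𝔼 φ g
  𝔼-cong φ {f} {g} eq = ∑-cong (permutations n) pointwise
    where
    pointwise : ∀ π → 𝟙 (extends? φ π) * f π ≡ 𝟙 (extends? φ π) * g π
    pointwise π with extends? φ π
    ... | yes ext = cong (1ℚ *_) (eq π ext)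
    ... | no _    = trans (ℚₚ.*-zeroˡ (f π)) (sym (ℚₚ.*-zeroˡ (g π)))

  𝔼-mono : ∀ φ {f g : Permutation′ n → ℚ} → (∀ π → Extends φ π → f π ≤ g π) → 𝔼 φ f ≤ 𝔼 φ g
  𝔼-mono φ {f} {g} le = ∑-mono (permutations n) pointwise
    where
    pointwise : ∀ π → 𝟙 (extends? φ π) * f π ≤ 𝟙 (extends? φ π) * g π
    pointwise π with extends? φ π
    ... | yes ext = *-monoˡ 0≤1ℚ (le π ext)
    ... | no _    = ℚₚ.≤-reflexive (trans (ℚₚ.*-zeroˡ (f π)) (sym (ℚₚ.*-zeroˡ (g π))))

  𝔼-*ˡ : ∀ φ c (f : Permutation′ n → ℚ) → 𝔼 φ (λ π → c * f π) ≡ c * 𝔼 φ f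
  𝔼-*ˡ φ c f = trans (∑-cong (permutations n) λ π → lemma (𝟙 (extends? φ π)) c (f π))
                     (∑-*ˡ c (λ π → 𝟙 (extends? φ π) * f π) (permutations n))
    where
    lemma : ∀ a b c → a * (b * c) ≡ b * (a * c)
    lemma = solve-∀ ℚ-ring

  𝔼-∑ : ∀ {A : Set} φ (f : A → Permutation′ n → ℚ) xs → 𝔼 φ (λ π → ∑ xs (λ x → f x π)) ≡ ∑ xs (λ x → 𝔼 φ (f x))
  𝔼-∑ φ f xs = begin
    ∑ (permutations n) (λ π → 𝟙 (extends? φ π) * ∑ xs (λ x → f x π))
      ≡⟨ ∑-cong (permutations n) (λ π → ∑-*ˡ (𝟙 (extends? φ π)) (λ x → f x π) xs) ⟨
    ∑ (permutations n) (λ π → ∑ xs (λ x → 𝟙 (extends? φ π) * f x π))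
      ≡⟨ ∑-swap (λ π x → 𝟙 (extends? φ π) * f x π) (permutations n) xs ⟩
    ∑ xs (λ x → 𝔼 φ (f x)) ∎
    where open ≡-Reasoning

  𝔼-0 : ∀ φ → 𝔼 φ (λ _ → 0ℚ) ≡ 0ℚ
  𝔼-0 φ = trans (∑-cong (permutations n) λ π → ℚₚ.*-zeroʳ (𝟙 (extends? φ π))) (∑-0 (permutations n))

  0≤𝔼 : ∀ φ {f : Permutation′ n → ℚ} → (∀ π → Extends φ π → 0ℚ ≤ f π) → 0ℚ ≤ 𝔼 φ f
  0≤𝔼 φ {f} le = subst (_≤ 𝔼 φ f) (𝔼-0 φ) (𝔼-mono φ le)

  private
    -- Each `π` satisfies exactly one of the `n` candidate entries, the one with index `sel π`, so
    -- the extensions of `φ` are partitioned. Splitting by the vertex that a label names is lazy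
    -- sampling of a fresh label; splitting by the label of a vertex gives the answer to a query.
    𝔼-split : ∀ φ (f : Permutation′ n → ℚ) (entry : Fin n → Fin n × Fin n) (sel : Permutation′ n → Fin n) →
              (∀ π i → π ⟨$⟩ʳ proj₁ (entry i) ≡ proj₂ (entry i) → sel π ≡ i) →
              (∀ π → π ⟨$⟩ʳ proj₁ (entry (sel π)) ≡ proj₂ (entry (sel π))) →
              𝔼 φ f ≡ ∑ (allFin n) (λ i → 𝔼 (entry i ∷ φ) f)
    𝔼-split φ f entry sel only this = begin
      ∑ (permutations n) (λ π → 𝟙 (extends? φ π) * f π)
        ≡⟨ ∑-cong (permutations n) pointwise ⟩
      ∑ (permutations n) (λ π → ∑ (allFin n) (λ i → 𝟙 (extends? (entry i ∷ φ) π) * f π))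
        ≡⟨ ∑-swap (λ π i → 𝟙 (extends? (entry i ∷ φ) π) * f π) (permutations n) (allFin n) ⟩
      ∑ (allFin n) (λ i → 𝔼 (entry i ∷ φ) f) ∎
      where
      open ≡-Reasoning
      pointwise : ∀ π → 𝟙 (extends? φ π) * f π ≡ ∑ (allFin n) (λ i → 𝟙 (extends? (entry i ∷ φ) π) * f π)
      pointwise π = begin
        𝟙 (extends? φ π) * f π
          ≡⟨ cong (_* f π) (𝟙-⇔ (extends? φ π) (extends? (entry (sel π) ∷ φ) π) (this π ∷_) All.tail) ⟩
        𝟙 (extends? (entry (sel π) ∷ φ) π) * f π
          ≡⟨ ∑-single (sel π) (λ i → 𝟙 (extends? (entry i ∷ φ) π) * f π) (λ i i≢ →
               trans (cong (_* f π) (𝟙-no (extends? (entry i ∷ φ) π) λ ext → i≢ (sym (only π i (All.head ext)))))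
                     (ℚₚ.*-zeroˡ (f π))) ⟨
        ∑ (allFin n) (λ i → 𝟙 (extends? (entry i ∷ φ) π) * f π) ∎

  𝔼-split-vertex : ∀ φ (f : Permutation′ n → ℚ) x → 𝔼 φ f ≡ ∑ (allFin n) (λ v → 𝔼 ((x , v) ∷ φ) f)
  𝔼-split-vertex φ f x = 𝔼-split φ f (x ,_) (_⟨$⟩ʳ x) (λ _ _ eq → eq) (λ _ → refl)

  𝔼-split-label : ∀ φ (f : Permutation′ n → ℚ) v → 𝔼 φ f ≡ ∑ (allFin n) (λ y → 𝔼 ((y , v) ∷ φ) f)
  𝔼-split-label φ f v = 𝔼-split φ f (_, v) (_⟨$⟩ˡ v)
    (λ π y eq → trans (cong (π ⟨$⟩ˡ_) (sym eq)) (Perm.inverseˡ π)) (λ π → Perm.inverseʳ π)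

  -- The normalising constant of `𝔼 φ`. It vanishes when no permutation extends `φ`, which is why
  -- conditional probabilities are left unnormalised.
  extensions : PartialMap → ℚ
  extensions φ = 𝔼 φ (λ _ → 1ℚ)

  0≤extensions : ∀ φ → 0ℚ ≤ extensions φ
  0≤extensions φ = 0≤𝔼 φ λ _ _ → 0≤1ℚ

  0<extensions-[] : 0ℚ < extensions []
  0<extensions-[] = ℚₚ.<-≤-trans (ℚₚ.positive⁻¹ 1ℚ)
    (∑-member {f = λ π → 𝟙 (extends? [] π) * 1ℚ} (λ π → 0≤* (0≤𝟙 (extends? [] π)) 0≤1ℚ)
      (proj₂ (permutations-inhabited n)))

  -- An entry is a label with the vertices it names in `G` and in `H`; the shared label is what
  -- couples the two runs.
  PairedMap : Set
  PairedMap = List (Fin n × Fin n × Fin n)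

  left right : PairedMap → PartialMap
  left  = List.map λ (x , v , v′) → x , v
  right = List.map λ (x , v , v′) → x , v′

  SamePattern : PairedMap → Set
  SamePattern Ψ = ∀ {x y u u′ v v′} → (x , u , u′) ∈ Ψ → (y , v , v′) ∈ Ψ → (u ≡ v → u′ ≡ v′) × (u′ ≡ v′ → u ≡ v)

  transpose-i : ∀ (i j : Fin n) → PC.transpose i j i ≡ j
  transpose-i i j with i ≟ i
  ... | yes _   = refl
  ... | no i≢i  = contradiction refl i≢i

  transpose-other : ∀ {i j k : Fin n} → k ≢ i → k ≢ j → PC.transpose i j k ≡ k
  transpose-other {i} {j} {k} k≢i k≢j with k ≟ i
  ... | yes k≡i = contradiction k≡i k≢i
  ... | no _ with k ≟ j
  ...   | yes k≡j = contradiction k≡j k≢j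
  ...   | no _    = refl

  -- After the tail is handled, the transposition of `ρ v` and `v′` repairs the new entry. It spoils
  -- no other entry: by the common pattern `w ≢ v` gives both `ρ w ≢ ρ v` and `w′ ≢ v′`, while
  -- `w ≡ v` gives `w′ ≡ v′`.
  pattern-permutation : ∀ Ψ → SamePattern Ψ → ∃ λ (ρ : Permutation′ n) → ∀ {x v v′} → (x , v , v′) ∈ Ψ → ρ ⟨$⟩ʳ v ≡ v′
  pattern-permutation [] same = Perm.id , λ ()
  pattern-permutation ((x , v , v′) ∷ Ψ) same
    with pattern-permutation Ψ (λ a b → same (there a) (there b))
  ... | ρ , maps = ρ Perm.∘ₚ Perm.transpose (ρ ⟨$⟩ʳ v) v′ , maps′
    where
    maps′ : ∀ {y w w′} → (y , w , w′) ∈ ((x , v , v′) ∷ Ψ) → PC.transpose (ρ ⟨$⟩ʳ v) v′ (ρ ⟨$⟩ʳ w) ≡ w′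
    maps′ (here refl) = transpose-i (ρ ⟨$⟩ʳ v) v′
    maps′ {y} {w} {w′} (there e) with w ≟ v
    ... | yes refl = trans (transpose-i (ρ ⟨$⟩ʳ v) v′) (proj₁ (same (here refl) (there e)) refl)
    ... | no w≢v   = trans (transpose-other
      (λ eq → w≢v (trans (sym (Perm.inverseˡ ρ)) (trans (cong (ρ ⟨$⟩ˡ_) eq) (Perm.inverseˡ ρ))))
      (λ eq → w≢v (proj₂ (same (there e) (here refl)) (trans (sym (maps e)) eq)))) (maps e)

  -- If `ρ` carries the vertices on the left to those on the right, then following a permutation by
  -- `ρ` is a bijection between the two sets of extensions.
  extensions-left≡right : ∀ Ψ → SamePattern Ψ → extensions (left Ψ) ≡ extensions (right Ψ)
  extensions-left≡right Ψ same with pattern-permutation Ψ same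
  ... | ρ , maps = begin
    ∑ (permutations n) (λ π → 𝟙 (extends? (left Ψ) π) * 1ℚ)
      ≡⟨ ∑-cong (permutations n) (λ π → cong (_* 1ℚ) (𝟙-⇔ (extends? (left Ψ) π) (extends? (right Ψ) (π Perm.∘ₚ ρ)) (to π) (from π))) ⟩
    ∑ (permutations n) (λ π → 𝟙 (extends? (right Ψ) (π Perm.∘ₚ ρ)) * 1ℚ)
      ≡⟨ ∑-permutations-∘ (λ π → 𝟙 (extends? (right Ψ) π) * 1ℚ) ρ (λ {π} {π′} eq → cong (_* 1ℚ)
           (𝟙-⇔ (extends? (right Ψ) π) (extends? (right Ψ) π′)
             (All.map λ {(x , _)} e → trans (sym (eq x)) e) (All.map λ {(x , _)} e → trans (eq x) e))) ⟩
    ∑ (permutations n) (λ π → 𝟙 (extends? (right Ψ) π) * 1ℚ) ∎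
    where
    open ≡-Reasoning
    to : ∀ π → Extends (left Ψ) π → Extends (right Ψ) (π Perm.∘ₚ ρ)
    to π ext = Allₚ.map⁺ (All.tabulate λ e∈ → trans (cong (ρ ⟨$⟩ʳ_) (All.lookup (Allₚ.map⁻ ext) e∈)) (maps e∈))
    from : ∀ π → Extends (right Ψ) (π Perm.∘ₚ ρ) → Extends (left Ψ) π
    from π ext = Allₚ.map⁺ (All.tabulate λ e∈ → trans (sym (Perm.inverseˡ ρ))
      (trans (cong (ρ ⟨$⟩ˡ_) (trans (All.lookup (Allₚ.map⁻ ext) e∈) (sym (maps e∈)))) (Perm.inverseˡ ρ)))

  vertices : PartialMap → List (Fin n)
  vertices = List.map proj₂

  extensions-fraction : ∀ φ x v → x ∉ List.map proj₁ φ →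
                        (fromℕ n - fromℕ (length φ)) * extensions ((x , v) ∷ φ) ≤ extensions φ
  extensions-fraction φ x v x∉ with Any.any? (v ≟_) (vertices φ)
  -- Here `v` already carries a label other than `x`, so no permutation is counted on the left.
  ... | yes v∈ = begin
    (fromℕ n - fromℕ (length φ)) * extensions ((x , v) ∷ φ)
      ≡⟨ cong ((fromℕ n - fromℕ (length φ)) *_) (trans (𝔼-cong ((x , v) ∷ φ) λ π ext → ⊥-elim (conflict π ext)) (𝔼-0 ((x , v) ∷ φ))) ⟩
    (fromℕ n - fromℕ (length φ)) * 0ℚ
      ≡⟨ ℚₚ.*-zeroʳ (fromℕ n - fromℕ (length φ)) ⟩
    0ℚ
      ≤⟨ 0≤extensions φ ⟩
    extensions φ ∎
    where
    open ℚₚ.≤-Reasoning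
    conflict : ∀ π → ¬ Extends ((x , v) ∷ φ) π
    conflict π (πx≡v ∷ ext) with ∈ₚ.∈-map⁻ proj₂ v∈
    ... | (y , _) , e∈ , refl = x∉ (subst (_∈ List.map proj₁ φ)
      (trans (sym (Perm.inverseˡ π)) (trans (cong (π ⟨$⟩ˡ_) (trans (All.lookup ext e∈) (sym πx≡v))) (Perm.inverseˡ π)))
      (∈ₚ.∈-map⁺ proj₁ e∈))
  -- The weights `1 - occ u` sum to `n - length φ`. They are nonpositive at used vertices and at
  -- most one elsewhere, where the number of extensions equals `c` by symmetry.
  ... | no v∉ = begin
    (fromℕ n - fromℕ (length φ)) * c
      ≡⟨ cong (λ k → (fromℕ n - k) * c) (trans (cong fromℕ (sym (Listₚ.length-map proj₂ φ))) (sym (∑-occurrences (vertices φ)))) ⟩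
    (fromℕ n - ∑ (allFin n) occ) * c
      ≡⟨ cong (λ k → (k - ∑ (allFin n) occ) * c) n≡∑1 ⟩
    (∑ (allFin n) (λ _ → 1ℚ) - ∑ (allFin n) occ) * c
      ≡⟨ distribute (∑ (allFin n) (λ _ → 1ℚ)) (∑ (allFin n) occ) c ⟩
    (∑ (allFin n) (λ _ → 1ℚ) + (- 1ℚ) * ∑ (allFin n) occ) * c
      ≡⟨ cong (_* c) (trans (∑-+ (λ _ → 1ℚ) (λ u → (- 1ℚ) * occ u) (allFin n))
           (cong (∑ (allFin n) (λ _ → 1ℚ) +_) (∑-*ˡ (- 1ℚ) occ (allFin n)))) ⟨
    ∑ (allFin n) (λ u → 1ℚ + (- 1ℚ) * occ u) * c
      ≡⟨ ∑-*ʳ c (λ u → 1ℚ + (- 1ℚ) * occ u) (allFin n) ⟨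
    ∑ (allFin n) (λ u → (1ℚ + (- 1ℚ) * occ u) * c)
      ≤⟨ ∑-mono (allFin n) pointwise ⟩
    ∑ (allFin n) (λ u → extensions ((x , u) ∷ φ))
      ≡⟨ 𝔼-split-vertex φ (λ _ → 1ℚ) x ⟨
    extensions φ ∎
    where
    open ℚₚ.≤-Reasoning
    c : ℚ
    c = extensions ((x , v) ∷ φ)
    occ : Fin n → ℚ
    occ = occurrences (vertices φ)
    n≡∑1 : fromℕ n ≡ ∑ (allFin n) (λ _ → 1ℚ)
    n≡∑1 = trans (trans (sym (ℚₚ.*-identityʳ (fromℕ n))) (cong (λ k → fromℕ k * 1ℚ) (sym (Listₚ.length-tabulate {n = n} id)))) (sym (∑-const 1ℚ (allFin n)))
    distribute : ∀ a b c → (a - b) * c ≡ (a + (- 1ℚ) * b) * c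
    distribute = solve-∀ ℚ-ring
    scale : ∀ o c → (1ℚ + (- 1ℚ) * o) * c + o * c ≡ 0ℚ + 1ℚ * c
    scale = solve-∀ ℚ-ring
    scale′ : ∀ o c → (1ℚ + (- 1ℚ) * o) * c + o * c ≡ c + 0ℚ
    scale′ = solve-∀ ℚ-ring
    -- Pairing `φ` with itself lets the pattern lemma exchange `v` for `u` while all entries of `φ`
    -- stay fixed.
    diagonal : PairedMap
    diagonal = List.map (λ (y , w) → y , w , w) φ
    diagonal-∈ : ∀ {y w w′} → (y , w , w′) ∈ diagonal → w ≡ w′ × w ∈ vertices φ
    diagonal-∈ e∈ with ∈ₚ.∈-map⁻ (λ (y , w) → y , w , w) e∈
    ... | _ , e∈′ , refl = refl , ∈ₚ.∈-map⁺ proj₂ e∈′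
    same : ∀ {u} → u ∉ vertices φ → SamePattern ((x , v , u) ∷ diagonal)
    same u∉ (here refl) (here refl) = (λ _ → refl) , λ _ → refl
    same u∉ (here refl) (there f) with diagonal-∈ f
    ... | refl , w∈ = (λ { refl → contradiction w∈ v∉ }) , λ { refl → contradiction w∈ u∉ }
    same u∉ (there e) (here refl) with diagonal-∈ e
    ... | refl , w∈ = (λ { refl → contradiction w∈ v∉ }) , λ { refl → contradiction w∈ u∉ }
    same u∉ (there e) (there f) with diagonal-∈ e | diagonal-∈ f
    ... | refl , _ | refl , _ = id , id
    left-diagonal : left diagonal ≡ φ
    left-diagonal = trans (sym (Listₚ.map-∘ φ)) (Listₚ.map-id φ)
    right-diagonal : right diagonal ≡ φ
    right-diagonal = trans (sym (Listₚ.map-∘ φ)) (Listₚ.map-id φ)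
    c≡ : ∀ {u} → u ∉ vertices φ → c ≡ extensions ((x , u) ∷ φ)
    c≡ {u} u∉ = subst₂ (λ φ₁ φ₂ → extensions ((x , v) ∷ φ₁) ≡ extensions ((x , u) ∷ φ₂))
      left-diagonal right-diagonal (extensions-left≡right ((x , v , u) ∷ diagonal) (same u∉))
    pointwise : ∀ u → (1ℚ + (- 1ℚ) * occ u) * c ≤ extensions ((x , u) ∷ φ)
    pointwise u with Any.any? (u ≟_) (vertices φ)
    ... | yes u∈ = ℚₚ.≤-trans
      (≤-from (*-monoʳ (0≤extensions ((x , v) ∷ φ)) (∈⇒1≤occurrences u∈)) (scale (occ u) c))
      (0≤extensions ((x , u) ∷ φ))
    ... | no u∉  = ℚₚ.≤-trans
      (≤-from (0≤* (0≤occurrences (vertices φ) u) (0≤extensions ((x , v) ∷ φ))) (scale′ (occ u) c))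
      (ℚₚ.≤-reflexive (c≡ u∉))

-- Coupling the runs of a tester on two graphs

Pr-nonneg : ∀ {d n} (G : SGraph d n) b t → 0ℚ ≤ Pr G b t
Pr-nonneg G b (return a)    = 0≤𝟙 (a ≟ᵇ b)
Pr-nonneg G b (query ℓ x κ) = Pr-nonneg G b (κ (step G ℓ x))
Pr-nonneg G b (sample m κ)  = 0≤* (0≤1/n m) (∑-nonneg (allFin m) λ i → Pr-nonneg G b (κ i))

length-allFin : ∀ n → length (allFin n) ≡ n
length-allFin n = Listₚ.length-tabulate {n = n} id

average-const : ∀ m .{{_ : NonZero m}} c → (ℤ.+ 1 / m) * ∑ (allFin m) (λ _ → c) ≡ c
average-const m c = begin
  (ℤ.+ 1 / m) * ∑ (allFin m) (λ _ → c)            ≡⟨ cong ((ℤ.+ 1 / m) *_) (∑-const c (allFin m)) ⟩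
  (ℤ.+ 1 / m) * (fromℕ (length (allFin m)) * c)   ≡⟨ cong (λ k → (ℤ.+ 1 / m) * (fromℕ k * c)) (length-allFin m) ⟩
  (ℤ.+ 1 / m) * (fromℕ m * c)                     ≡⟨ lemma (ℤ.+ 1 / m) (fromℕ m) c ⟩
  (fromℕ m * (ℤ.+ 1 / m)) * c                     ≡⟨ cong (_* c) (n*1/n≡1 m) ⟩
  1ℚ * c                                          ≡⟨ ℚₚ.*-identityˡ c ⟩
  c                                               ∎
  where
  open ≡-Reasoning
  lemma : ∀ a b c → a * (b * c) ≡ b * a * c
  lemma = solve-∀ ℚ-ring

Pr-total : ∀ {d n} (G : SGraph d n) t → Pr G true t + Pr G false t ≡ 1ℚ
Pr-total G (return true)  = refl
Pr-total G (return false) = refl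
Pr-total G (query ℓ x κ)  = Pr-total G (κ (step G ℓ x))
Pr-total G (sample m κ)   = begin
  (ℤ.+ 1 / m) * ∑ (allFin m) (λ i → Pr G true (κ i)) + (ℤ.+ 1 / m) * ∑ (allFin m) (λ i → Pr G false (κ i))
    ≡⟨ ℚₚ.*-distribˡ-+ (ℤ.+ 1 / m) (∑ (allFin m) (λ i → Pr G true (κ i))) (∑ (allFin m) (λ i → Pr G false (κ i))) ⟨
  (ℤ.+ 1 / m) * (∑ (allFin m) (λ i → Pr G true (κ i)) + ∑ (allFin m) (λ i → Pr G false (κ i)))
    ≡⟨ cong ((ℤ.+ 1 / m) *_) (∑-+ (λ i → Pr G true (κ i)) (λ i → Pr G false (κ i)) (allFin m)) ⟨
  (ℤ.+ 1 / m) * ∑ (allFin m) (λ i → Pr G true (κ i) + Pr G false (κ i))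
    ≡⟨ cong ((ℤ.+ 1 / m) *_) (∑-cong (allFin m) λ i → Pr-total G (κ i)) ⟩
  (ℤ.+ 1 / m) * ∑ (allFin m) (λ _ → 1ℚ)
    ≡⟨ average-const m 1ℚ ⟩
  1ℚ ∎
  where open ≡-Reasoning

Pr≤1 : ∀ {d n} (G : SGraph d n) t → Pr G true t ≤ 1ℚ
Pr≤1 G t = subst (Pr G true t ≤_) (Pr-total G t) (p≤p+q (Pr-nonneg G false t))

acceptance : ∀ {d n} → SGraph d n → PartialMap → Algorithm d n Bool → ℚ
acceptance G φ t = 𝔼 φ (λ π → Pr (relabel G π) true t)

-- Restricted to relabellings compatible with what has been revealed, since the bound on the
-- remaining queries is known only along branches that actually occur.
QueryBound : ∀ {d n} → SGraph d n → PartialMap → ℕ → Algorithm d n Bool → Set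
QueryBound G φ q t = ∀ π → Extends φ π → AtMostQueries (relabel G π) q t

module _ {d n : ℕ} (G : SGraph d n) where

  0≤acceptance : ∀ φ t → 0ℚ ≤ acceptance G φ t
  0≤acceptance φ t = 0≤𝔼 φ λ π _ → Pr-nonneg (relabel G π) true t

  acceptance≤extensions : ∀ φ t → acceptance G φ t ≤ extensions φ
  acceptance≤extensions φ t = 𝔼-mono φ λ π _ → Pr≤1 (relabel G π) t

  acceptance-return : ∀ φ a → acceptance G φ (return a) ≡ 𝟙 (a ≟ᵇ true) * extensions φ
  acceptance-return φ a = trans (𝔼-cong φ λ _ _ → sym (ℚₚ.*-identityʳ (𝟙 (a ≟ᵇ true))))
    (𝔼-*ˡ φ (𝟙 (a ≟ᵇ true)) (λ _ → 1ℚ))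

  acceptance-sample : ∀ φ m .{{_ : NonZero m}} κ →
    acceptance G φ (sample m κ) ≡ (ℤ.+ 1 / m) * ∑ (allFin m) (λ i → acceptance G φ (κ i))
  acceptance-sample φ m κ = trans
    (𝔼-*ˡ φ (ℤ.+ 1 / m) (λ π → ∑ (allFin m) (λ i → Pr (relabel G π) true (κ i))))
    (cong ((ℤ.+ 1 / m) *_) (𝔼-∑ φ (λ i π → Pr (relabel G π) true (κ i)) (allFin m)))

  step-extension : ∀ {φ x y v} ℓ → (x , v) ∈ φ → ∀ π → Extends ((y , step G ℓ v) ∷ φ) π →
                   step (relabel G π) ℓ x ≡ y
  step-extension {x = x} {y} {v} ℓ x∈ π (πy≡ ∷ ext) = begin
    step (relabel G π) ℓ x             ≡⟨ step-relabel G π ℓ x ⟩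
    π ⟨$⟩ˡ (step G ℓ (π ⟨$⟩ʳ x))       ≡⟨ cong (λ u → π ⟨$⟩ˡ (step G ℓ u)) (All.lookup ext x∈) ⟩
    π ⟨$⟩ˡ (step G ℓ v)                ≡⟨ cong (π ⟨$⟩ˡ_) πy≡ ⟨
    π ⟨$⟩ˡ (π ⟨$⟩ʳ y)                  ≡⟨ Perm.inverseˡ π ⟩
    y                                  ∎
    where open ≡-Reasoning

  -- Once `x` names `v`, the answer is the label of `step G ℓ v`; splitting by that label makes the
  -- answer constant in each summand.
  acceptance-query : ∀ {φ x v} ℓ κ → (x , v) ∈ φ →
    acceptance G φ (query ℓ x κ) ≡ ∑ (allFin n) (λ y → acceptance G ((y , step G ℓ v) ∷ φ) (κ y))
  acceptance-query {φ} {x} {v} ℓ κ x∈ = trans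
    (𝔼-split-label φ (λ π → Pr (relabel G π) true (query ℓ x κ)) (step G ℓ v))
    (∑-cong (allFin n) λ y → 𝔼-cong ((y , step G ℓ v) ∷ φ) λ π ext →
      cong (λ z → Pr (relabel G π) true (κ z)) (step-extension ℓ x∈ π ext))

  QueryBound-query : ∀ {φ x y v q} ℓ κ → (x , v) ∈ φ → QueryBound G φ (suc q) (query ℓ x κ) →
                     QueryBound G ((y , step G ℓ v) ∷ φ) q (κ y)
  QueryBound-query {q = q} ℓ κ x∈ bound π ext = subst (λ z → AtMostQueries (relabel G π) q (κ z))
    (step-extension ℓ x∈ π ext) (bound π (All.tail ext))

-- The recursion by two successors mirrors the cost of one query: at most two revealed entries, and
-- two units of radius.
twice : ℕ → ℕ
twice zero    = zero
twice (suc q) = suc (suc (twice q))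

record Matching {d n} (G H : SGraph d n) (r : ℕ) : Set where
  field
    pairs       : List (Fin n × Fin n)
    leftoverˡ   : List (Fin n)
    leftoverʳ   : List (Fin n)
    coversˡ     : List.map proj₁ pairs ++ leftoverˡ ↭ allFin n
    coversʳ     : List.map proj₂ pairs ++ leftoverʳ ↭ allFin n
    sameType    : ∀ {v v′} → (v , v′) ∈ pairs → ∀ w → length w ℕ.≤ r →
                  (Stab G v w → Stab H v′ w) × (Stab H v′ w → Stab G v w)

  ∑-leftˡ : ∀ f → ∑ (allFin n) f ≡ ∑ pairs (λ (v , _) → f v) + ∑ leftoverˡ f
  ∑-leftˡ f = trans (sym (∑-↭ f coversˡ)) (trans (∑-++ f (List.map proj₁ pairs) leftoverˡ)
    (cong (_+ ∑ leftoverˡ f) (∑-map proj₁ f pairs)))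

  ∑-pairsˡ : ∀ f → (∀ v → 0ℚ ≤ f v) → ∑ pairs (λ (v , _) → f v) ≤ ∑ (allFin n) f
  ∑-pairsˡ f 0≤f = subst (∑ pairs (λ (v , _) → f v) ≤_) (sym (∑-leftˡ f)) (p≤p+q (∑-nonneg leftoverˡ 0≤f))

  ∑-pairsʳ : ∀ f → (∀ v → 0ℚ ≤ f v) → ∑ pairs (λ (_ , v′) → f v′) ≤ ∑ (allFin n) f
  ∑-pairsʳ f 0≤f = subst (∑ pairs (λ (_ , v′) → f v′) ≤_)
    (trans (cong (_+ ∑ leftoverʳ f) (sym (∑-map proj₂ f pairs)))
      (trans (sym (∑-++ f (List.map proj₂ pairs) leftoverʳ)) (∑-↭ f coversʳ)))
    (p≤p+q (∑-nonneg leftoverʳ 0≤f))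

-- The budget bounds by η the fraction of vertices lost when a fresh label is revealed: the unmatched
-- ones, and those within distance r of one of the at most k₀ revealed vertices, in G or in H.
module Coupling {d n : ℕ} (G H : SGraph d n) {r : ℕ} (matching : Matching G H r)
  (k₀ : ℕ) (k₀≤r : k₀ ℕ.≤ r) (k₀<n : k₀ ℕ.< n) (η : ℚ) (0≤η : 0ℚ ≤ η)
  (budget : ∀ k → k ℕ.≤ k₀ →
     fromℕ (length (Matching.leftoverˡ matching)) + (fromℕ (k ℕ.* length (wordsUpTo d r)) + fromℕ (k ℕ.* length (wordsUpTo d r)))
       ≤ η * (fromℕ n - fromℕ k))
  where

  open Matching matching

  -- The parts of G and H revealed so far look alike up to distance s; each query uses up 2 of the radius.
  Isomorphic : ℕ → PairedMap → Set
  Isomorphic s Ψ = ∀ {x y u u′ v v′} → (x , u , u′) ∈ Ψ → (y , v , v′) ∈ Ψ → ∀ w → length w ℕ.≤ s →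
                   (act G w u ≡ v → act H w u′ ≡ v′) × (act H w u′ ≡ v′ → act G w u ≡ v)

  -- The error is proportional to `extensions (left Ψ)`, so that it adds up correctly when the
  -- extensions are split. The condition on `length Ψ` reserves two entries for each query still to
  -- come.
  Claim : ℕ → Algorithm d n Bool → Set
  Claim q t = ∀ Ψ → Isomorphic (twice q) Ψ → length Ψ ℕ.+ twice q ℕ.≤ k₀ → QueryBound G (left Ψ) q t →
              acceptance G (left Ψ) t ≤ acceptance H (right Ψ) t + fromℕ q * η * extensions (left Ψ)

  isomorphic⇒samePattern : ∀ {s Ψ} → Isomorphic s Ψ → SamePattern Ψ
  isomorphic⇒samePattern iso e f = iso e f [] ℕ.z≤n

  0≤error : ∀ q (φ : PartialMap {n}) → 0ℚ ≤ fromℕ q * η * extensions φ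
  0≤error q φ = 0≤* (0≤* (0≤fromℕ q) 0≤η) (0≤extensions φ)

  -- A common pattern means equally many extensions, so a fixed verdict has the same weight on both
  -- sides.
  claim-return : ∀ q a → Claim q (return a)
  claim-return q a Ψ iso _ _ = begin
    acceptance G (left Ψ) (return a)        ≡⟨ acceptance-return G (left Ψ) a ⟩
    𝟙 (a ≟ᵇ true) * extensions (left Ψ)     ≡⟨ cong (𝟙 (a ≟ᵇ true) *_) (extensions-left≡right Ψ (isomorphic⇒samePattern iso)) ⟩
    𝟙 (a ≟ᵇ true) * extensions (right Ψ)    ≡⟨ acceptance-return H (right Ψ) a ⟨
    acceptance H (right Ψ) (return a)       ≤⟨ p≤p+q (0≤error q (left Ψ)) ⟩
    acceptance H (right Ψ) (return a) + fromℕ q * η * extensions (left Ψ) ∎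
    where open ℚₚ.≤-Reasoning

  claim-sample : ∀ q m .{{_ : NonZero m}} κ → (∀ i → Claim q (κ i)) → Claim q (sample m κ)
  claim-sample q m κ ih Ψ iso small bound = begin
    acceptance G (left Ψ) (sample m κ)
      ≡⟨ acceptance-sample G (left Ψ) m κ ⟩
    (ℤ.+ 1 / m) * ∑ (allFin m) (λ i → acceptance G (left Ψ) (κ i))
      ≤⟨ *-monoˡ (0≤1/n m) (∑-mono (allFin m) λ i → ih i Ψ iso small λ π ext → bound π ext i) ⟩
    (ℤ.+ 1 / m) * ∑ (allFin m) (λ i → acceptance H (right Ψ) (κ i) + e)
      ≡⟨ cong ((ℤ.+ 1 / m) *_) (∑-+ (λ i → acceptance H (right Ψ) (κ i)) (λ _ → e) (allFin m)) ⟩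
    (ℤ.+ 1 / m) * (∑ (allFin m) (λ i → acceptance H (right Ψ) (κ i)) + ∑ (allFin m) (λ _ → e))
      ≡⟨ ℚₚ.*-distribˡ-+ (ℤ.+ 1 / m) (∑ (allFin m) (λ i → acceptance H (right Ψ) (κ i))) (∑ (allFin m) (λ _ → e)) ⟩
    (ℤ.+ 1 / m) * ∑ (allFin m) (λ i → acceptance H (right Ψ) (κ i)) + (ℤ.+ 1 / m) * ∑ (allFin m) (λ _ → e)
      ≡⟨ cong₂ _+_ (sym (acceptance-sample H (right Ψ) m κ)) (average-const m e) ⟩
    acceptance H (right Ψ) (sample m κ) + e ∎
    where
    open ℚₚ.≤-Reasoning
    e : ℚ
    e = fromℕ q * η * extensions (left Ψ)

  -- A query with none left contradicts the bound for every extension, so all terms on the left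
  -- vanish.
  claim-no-query : ∀ ℓ x κ → Claim zero (query ℓ x κ)
  claim-no-query ℓ x κ Ψ iso small bound = begin
    acceptance G (left Ψ) (query ℓ x κ)
      ≡⟨ trans (𝔼-cong (left Ψ) λ π ext → ⊥-elim (bound π ext)) (𝔼-0 (left Ψ)) ⟩
    0ℚ
      ≤⟨ 0≤+ (0≤acceptance H (right Ψ) (query ℓ x κ)) (0≤error 0 (left Ψ)) ⟩
    acceptance H (right Ψ) (query ℓ x κ) + fromℕ 0 * η * extensions (left Ψ) ∎
    where open ℚₚ.≤-Reasoning

  -- A word from or to the new vertices becomes one from or to the old pair by appending `ℓ`,
  -- prepending its inverse, or both. The last case, a loop at the new vertex, adds two letters and
  -- so fixes the loss of radius.
  isomorphic-step : ∀ {s Ψ x y v v′} ℓ → (x , v , v′) ∈ Ψ → Isomorphic (suc (suc s)) Ψ →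
                    Isomorphic s ((y , step G ℓ v , step H ℓ v′) ∷ Ψ)
  isomorphic-step {s} {Ψ} {x} {y} {v} {v′} ℓ x∈ iso = iso′
    where
    Ψ′ : PairedMap
    Ψ′ = (y , step G ℓ v , step H ℓ v′) ∷ Ψ
    unstep : ∀ (F : SGraph d n) {a b} → a ≡ step F ℓ b → step F (inverse ℓ) a ≡ b
    unstep F eq = trans (cong (step F (inverse ℓ)) eq) (step-inverseˡ F ℓ _)
    restep : ∀ (F : SGraph d n) {a b} → step F (inverse ℓ) a ≡ b → a ≡ step F ℓ b
    restep F eq = trans (sym (step-inverseʳ F ℓ _)) (cong (step F ℓ) eq)
    length-∷ʳ : ∀ w → length w ℕ.≤ s → length (w ++ ℓ ∷ []) ℕ.≤ suc s
    length-∷ʳ w |w|≤s = subst (ℕ._≤ suc s) (sym (trans (Listₚ.length-++ w) (ℕₚ.+-comm (length w) 1))) (ℕ.s≤s |w|≤s)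
    iso′ : Isomorphic s Ψ′
    iso′ (here refl) (here refl) w |w|≤s =
      let to , from = iso x∈ x∈ (inverse ℓ ∷ w ++ ℓ ∷ []) (ℕ.s≤s (length-∷ʳ w |w|≤s)) in
      (λ eq → trans (sym (act-++ H w (ℓ ∷ []) v′)) (restep H (to (unstep G (trans (act-++ G w (ℓ ∷ []) v) eq))))) ,
      (λ eq → trans (sym (act-++ G w (ℓ ∷ []) v)) (restep G (from (unstep H (trans (act-++ H w (ℓ ∷ []) v′) eq)))))
    iso′ (here refl) (there f) w |w|≤s =
      let to , from = iso x∈ f (w ++ ℓ ∷ []) (ℕₚ.m≤n⇒m≤1+n (length-∷ʳ w |w|≤s)) in
      (λ eq → trans (sym (act-++ H w (ℓ ∷ []) v′)) (to (trans (act-++ G w (ℓ ∷ []) v) eq))) ,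
      (λ eq → trans (sym (act-++ G w (ℓ ∷ []) v)) (from (trans (act-++ H w (ℓ ∷ []) v′) eq)))
    iso′ (there e) (here refl) w |w|≤s =
      let to , from = iso e x∈ (inverse ℓ ∷ w) (ℕ.s≤s (ℕₚ.m≤n⇒m≤1+n |w|≤s)) in
      (λ eq → restep H (to (unstep G eq))) , (λ eq → restep G (from (unstep H eq)))
    iso′ (there e) (there f) w |w|≤s = iso e f w (ℕₚ.m≤n⇒m≤1+n (ℕₚ.m≤n⇒m≤1+n |w|≤s))

  -- No new error arises: the answer is the label of the corresponding neighbour in either graph,
  -- both runs are split by the same label `y`, and the inductive errors for the various `y`
  -- recombine into one. Hence the factor `fromℕ q`, not `fromℕ (suc q)`.
  claim-known : ∀ {q ℓ x κ Ψ v v′} → (∀ y → Claim q (κ y)) → (x , v , v′) ∈ Ψ → Isomorphic (suc (suc (twice q))) Ψ →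
                suc (length Ψ) ℕ.+ twice q ℕ.≤ k₀ → QueryBound G (left Ψ) (suc q) (query ℓ x κ) →
                acceptance G (left Ψ) (query ℓ x κ) ≤ acceptance H (right Ψ) (query ℓ x κ) + fromℕ q * η * extensions (left Ψ)
  claim-known {q} {ℓ} {x} {κ} {Ψ} {v} {v′} ih x∈ iso small bound = begin
    acceptance G (left Ψ) (query ℓ x κ)
      ≡⟨ acceptance-query G ℓ κ x∈ˡ ⟩
    ∑ (allFin n) (λ y → acceptance G ((y , step G ℓ v) ∷ left Ψ) (κ y))
      ≤⟨ ∑-mono (allFin n) (λ y → ih y ((y , step G ℓ v , step H ℓ v′) ∷ Ψ) (isomorphic-step ℓ x∈ iso) small
           (QueryBound-query G ℓ κ x∈ˡ bound)) ⟩
    ∑ (allFin n) (λ y → acceptance H ((y , step H ℓ v′) ∷ right Ψ) (κ y) + fromℕ q * η * extensions ((y , step G ℓ v) ∷ left Ψ))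
      ≡⟨ ∑-+ (λ y → acceptance H ((y , step H ℓ v′) ∷ right Ψ) (κ y)) (λ y → fromℕ q * η * extensions ((y , step G ℓ v) ∷ left Ψ)) (allFin n) ⟩
    ∑ (allFin n) (λ y → acceptance H ((y , step H ℓ v′) ∷ right Ψ) (κ y)) + ∑ (allFin n) (λ y → fromℕ q * η * extensions ((y , step G ℓ v) ∷ left Ψ))
      ≡⟨ cong₂ _+_ (sym (acceptance-query H ℓ κ x∈ʳ)) (trans
           (∑-*ˡ (fromℕ q * η) (λ y → extensions ((y , step G ℓ v) ∷ left Ψ)) (allFin n))
           (cong (fromℕ q * η *_) (sym (𝔼-split-label (left Ψ) (λ _ → 1ℚ) (step G ℓ v))))) ⟩
    acceptance H (right Ψ) (query ℓ x κ) + fromℕ q * η * extensions (left Ψ) ∎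
    where
    open ℚₚ.≤-Reasoning
    x∈ˡ : (x , v) ∈ left Ψ
    x∈ˡ = ∈ₚ.∈-map⁺ (λ (x , v , v′) → x , v) x∈
    x∈ʳ : (x , v′) ∈ right Ψ
    x∈ʳ = ∈ₚ.∈-map⁺ (λ (x , v , v′) → x , v′) x∈

  near : SGraph d n → List (Fin n) → List (Fin n)
  near F = concatMap λ u → List.map (λ w → act F w u) (wordsUpTo d r)

  length-near : ∀ F us → length (near F us) ≡ length us ℕ.* length (wordsUpTo d r)
  length-near F []       = refl
  length-near F (u ∷ us) = trans (Listₚ.length-++ (List.map (λ w → act F w u) (wordsUpTo d r)))
    (cong₂ ℕ._+_ (Listₚ.length-map (λ w → act F w u) (wordsUpTo d r)) (length-near F us))

  ∈-near : ∀ F {us u v} → u ∈ us → ∀ w → length w ℕ.≤ r → act F w u ≡ v → v ∈ near F us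
  ∈-near F {u = u} u∈ w |w|≤r refl = ∈ₚ.∈-concatMap⁺ (λ u → List.map (λ w → act F w u) (wordsUpTo d r))
    (lose u∈ (∈ₚ.∈-map⁺ (λ w → act F w u) (∈-wordsUpTo w |w|≤r)))

  ∈-near⁻¹ : ∀ F {us u v} → u ∈ us → ∀ w → length w ℕ.≤ r → act F w v ≡ u → v ∈ near F us
  ∈-near⁻¹ F u∈ w |w|≤r refl = ∈-near F u∈ (inverseWord w)
    (subst (ℕ._≤ r) (sym (length-inverseWord w)) |w|≤r) (act-inverseWordˡ F w _)

  nearˡ nearʳ : PairedMap → List (Fin n)
  nearˡ Ψ = near G (vertices (left Ψ))
  nearʳ Ψ = near H (vertices (right Ψ))

  -- No word of length at most `r` joins a new vertex to an old one in either graph, so the mixed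
  -- conditions are vacuous; loops at the new vertices are governed by `sameType`.
  isomorphic-far : ∀ {s Ψ x v v′} → s ℕ.≤ r → (v , v′) ∈ pairs → v ∉ nearˡ Ψ → v′ ∉ nearʳ Ψ →
                   Isomorphic s Ψ → Isomorphic s ((x , v , v′) ∷ Ψ)
  isomorphic-far {s} {Ψ} {x} {v} {v′} s≤r vv′∈ v∉ v′∉ iso = iso′
    where
    ∈ˡ : ∀ {y u u′} → (y , u , u′) ∈ Ψ → u ∈ vertices (left Ψ)
    ∈ˡ e = ∈ₚ.∈-map⁺ proj₂ (∈ₚ.∈-map⁺ (λ (x , v , v′) → x , v) e)
    ∈ʳ : ∀ {y u u′} → (y , u , u′) ∈ Ψ → u′ ∈ vertices (right Ψ)
    ∈ʳ e = ∈ₚ.∈-map⁺ proj₂ (∈ₚ.∈-map⁺ (λ (x , v , v′) → x , v′) e)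
    iso′ : Isomorphic s ((x , v , v′) ∷ Ψ)
    iso′ (here refl) (here refl) w |w|≤s = sameType vv′∈ w (ℕₚ.≤-trans |w|≤s s≤r)
    iso′ (here refl) (there f) w |w|≤s =
      (λ eq → contradiction (∈-near⁻¹ G (∈ˡ f) w (ℕₚ.≤-trans |w|≤s s≤r) eq) v∉) ,
      (λ eq → contradiction (∈-near⁻¹ H (∈ʳ f) w (ℕₚ.≤-trans |w|≤s s≤r) eq) v′∉)
    iso′ (there e) (here refl) w |w|≤s =
      (λ eq → contradiction (∈-near G (∈ˡ e) w (ℕₚ.≤-trans |w|≤s s≤r) eq) v∉) ,
      (λ eq → contradiction (∈-near H (∈ʳ e) w (ℕₚ.≤-trans |w|≤s s≤r) eq) v′∉)
    iso′ (there e) (there f) = iso e f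

  module _ (Ψ : PairedMap {n}) (x : Fin n) where

    private
      weight : Fin n → ℚ
      weight v = extensions ((x , v) ∷ left Ψ)

      0≤weight : ∀ v → 0ℚ ≤ weight v
      0≤weight v = 0≤extensions ((x , v) ∷ left Ψ)

      -- An upper bound for the indicator that `v` or `v′` is close to a revealed vertex, with
      -- multiplicities so that its sum over the pairs is controlled by lengths of lists.
      bad : Fin n × Fin n → ℚ
      bad (v , v′) = occurrences (nearˡ Ψ) v + occurrences (nearʳ Ψ) v′

      0≤bad : ∀ p → 0ℚ ≤ bad p
      0≤bad (v , v′) = 0≤+ (0≤occurrences (nearˡ Ψ) v) (0≤occurrences (nearʳ Ψ) v′)

      loss : ℚ
      loss = ∑ pairs (λ (v , v′) → bad (v , v′) * weight v) + ∑ leftoverˡ weight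

      length-nearˡ : length (nearˡ Ψ) ≡ length Ψ ℕ.* length (wordsUpTo d r)
      length-nearˡ = trans (length-near G (vertices (left Ψ)))
        (cong (ℕ._* length (wordsUpTo d r)) (trans (Listₚ.length-map proj₂ (left Ψ)) (Listₚ.length-map _ Ψ)))

      length-nearʳ : length (nearʳ Ψ) ≡ length Ψ ℕ.* length (wordsUpTo d r)
      length-nearʳ = trans (length-near H (vertices (right Ψ)))
        (cong (ℕ._* length (wordsUpTo d r)) (trans (Listₚ.length-map proj₂ (right Ψ)) (Listₚ.length-map _ Ψ)))

      ∑-bad : ∑ pairs bad ≤ fromℕ (length Ψ ℕ.* length (wordsUpTo d r)) + fromℕ (length Ψ ℕ.* length (wordsUpTo d r))
      ∑-bad = begin
        ∑ pairs bad
          ≡⟨ ∑-+ (λ (v , _) → occurrences (nearˡ Ψ) v) (λ (_ , v′) → occurrences (nearʳ Ψ) v′) pairs ⟩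
        ∑ pairs (λ (v , _) → occurrences (nearˡ Ψ) v) + ∑ pairs (λ (_ , v′) → occurrences (nearʳ Ψ) v′)
          ≤⟨ ℚₚ.+-mono-≤ (∑-pairsˡ (occurrences (nearˡ Ψ)) (0≤occurrences (nearˡ Ψ)))
                         (∑-pairsʳ (occurrences (nearʳ Ψ)) (0≤occurrences (nearʳ Ψ))) ⟩
        ∑ (allFin n) (occurrences (nearˡ Ψ)) + ∑ (allFin n) (occurrences (nearʳ Ψ))
          ≡⟨ cong₂ _+_ (trans (∑-occurrences (nearˡ Ψ)) (cong fromℕ length-nearˡ))
                       (trans (∑-occurrences (nearʳ Ψ)) (cong fromℕ length-nearʳ)) ⟩
        fromℕ (length Ψ ℕ.* length (wordsUpTo d r)) + fromℕ (length Ψ ℕ.* length (wordsUpTo d r)) ∎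
        where open ℚₚ.≤-Reasoning

      -- Each vertex carries at most a fraction `1 / a` of the extensions, where `a` is
      -- `n - length Ψ`, and `budget` bounds the number of lost vertices by `η * a`.
      loss-bound : length Ψ ℕ.≤ k₀ → x ∉ List.map proj₁ (left Ψ) → loss ≤ η * extensions (left Ψ)
      loss-bound |Ψ|≤k₀ x∉ = ℚₚ.*-cancelˡ-≤-pos a {{positive 0<a}} (begin
        a * loss
          ≡⟨ ℚₚ.*-distribˡ-+ a (∑ pairs (λ (v , v′) → bad (v , v′) * weight v)) (∑ leftoverˡ weight) ⟩
        a * ∑ pairs (λ (v , v′) → bad (v , v′) * weight v) + a * ∑ leftoverˡ weight
          ≡⟨ cong₂ _+_ (∑-*ˡ a (λ (v , v′) → bad (v , v′) * weight v) pairs) (∑-*ˡ a weight leftoverˡ) ⟨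
        ∑ pairs (λ (v , v′) → a * (bad (v , v′) * weight v)) + ∑ leftoverˡ (λ v → a * weight v)
          ≤⟨ ℚₚ.+-mono-≤
               (∑-mono pairs λ (v , v′) → subst (_≤ bad (v , v′) * C) (move (bad (v , v′)) a (weight v)) (*-monoˡ (0≤bad (v , v′)) (fraction v)))
               (∑-mono leftoverˡ fraction) ⟩
        ∑ pairs (λ p → bad p * C) + ∑ leftoverˡ (λ _ → C)
          ≡⟨ cong₂ _+_ (∑-*ʳ C bad pairs) (∑-const C leftoverˡ) ⟩
        ∑ pairs bad * C + fromℕ (length leftoverˡ) * C
          ≡⟨ collect (∑ pairs bad) (fromℕ (length leftoverˡ)) C ⟩
        (fromℕ (length leftoverˡ) + ∑ pairs bad) * C
          ≤⟨ *-monoʳ (0≤extensions (left Ψ)) (ℚₚ.≤-trans (ℚₚ.+-monoʳ-≤ (fromℕ (length leftoverˡ)) ∑-bad) (budget (length Ψ) |Ψ|≤k₀)) ⟩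
        η * (fromℕ n - fromℕ (length Ψ)) * C
          ≡⟨ rotate η (fromℕ n - fromℕ (length Ψ)) C ⟩
        a * (η * C) ∎)
        where
        open ℚₚ.≤-Reasoning
        a C : ℚ
        a = fromℕ n - fromℕ (length Ψ)
        C = extensions (left Ψ)
        fraction : ∀ v → a * weight v ≤ C
        fraction v = subst (λ k → (fromℕ n - fromℕ k) * weight v ≤ C) (Listₚ.length-map _ Ψ)
          (extensions-fraction (left Ψ) x v x∉)
        0<a : 0ℚ < a
        0<a = ℚₚ.<-≤-trans (ℚₚ.positive⁻¹ 1ℚ) (≤-from
          (subst (_≤ fromℕ n) (fromℕ-suc (length Ψ)) (fromℕ-mono-≤ (ℕₚ.≤-<-trans |Ψ|≤k₀ k₀<n)))
          (shift (fromℕ n) (fromℕ (length Ψ))))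
          where
          shift : ∀ p k → 1ℚ + p ≡ p - k + (1ℚ + k)
          shift = solve-∀ ℚ-ring
        move : ∀ b a c → b * (a * c) ≡ a * (b * c)
        move = solve-∀ ℚ-ring
        collect : ∀ b l c → b * c + l * c ≡ (l + b) * c
        collect = solve-∀ ℚ-ring
        rotate : ∀ e a c → e * a * c ≡ a * (e * c)
        rotate = solve-∀ ℚ-ring

    -- The vertex named by `x` is sampled now. For a good pair both runs give `x` to partners and
    -- continue as in the known case; for a bad pair or a leftover the trivial bound by all
    -- extensions is paid. These payments add up to `loss`, which is worth one more `η`.
    claim-fresh : ∀ {q ℓ κ} → (∀ y → Claim q (κ y)) → x ∉ List.map proj₁ (left Ψ) → Isomorphic (suc (suc (twice q))) Ψ →
                  length Ψ ℕ.+ suc (suc (twice q)) ℕ.≤ k₀ → QueryBound G (left Ψ) (suc q) (query ℓ x κ) →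
                  acceptance G (left Ψ) (query ℓ x κ) ≤ acceptance H (right Ψ) (query ℓ x κ) + fromℕ (suc q) * η * extensions (left Ψ)
    claim-fresh {q} {ℓ} {κ} ih x∉ iso small bound = begin
      acceptance G (left Ψ) t
        ≡⟨ 𝔼-split-vertex (left Ψ) (λ π → Pr (relabel G π) true t) x ⟩
      ∑ (allFin n) F
        ≡⟨ ∑-leftˡ F ⟩
      ∑ pairs (λ (v , _) → F v) + ∑ leftoverˡ F
        ≤⟨ ℚₚ.+-mono-≤ (∑-mono-∈ pairs λ {(v , v′)} → pairwise v v′)
             (∑-mono leftoverˡ λ v → acceptance≤extensions G ((x , v) ∷ left Ψ) t) ⟩
      ∑ pairs (λ (v , v′) → F′ v′ + e * weight v + bad (v , v′) * weight v) + ∑ leftoverˡ weight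
        ≡⟨ cong (_+ ∑ leftoverˡ weight) (trans
             (∑-+ (λ (v , v′) → F′ v′ + e * weight v) (λ (v , v′) → bad (v , v′) * weight v) pairs)
             (cong (_+ ∑ pairs (λ (v , v′) → bad (v , v′) * weight v)) (trans
               (∑-+ (λ (_ , v′) → F′ v′) (λ (v , _) → e * weight v) pairs)
               (cong (∑ pairs (λ (_ , v′) → F′ v′) +_) (∑-*ˡ e (λ (v , _) → weight v) pairs))))) ⟩
      ∑ pairs (λ (_ , v′) → F′ v′) + e * ∑ pairs (λ (v , _) → weight v) + ∑ pairs (λ (v , v′) → bad (v , v′) * weight v) + ∑ leftoverˡ weight
        ≡⟨ ℚₚ.+-assoc (∑ pairs (λ (_ , v′) → F′ v′) + e * ∑ pairs (λ (v , _) → weight v)) (∑ pairs (λ (v , v′) → bad (v , v′) * weight v)) (∑ leftoverˡ weight) ⟩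
      ∑ pairs (λ (_ , v′) → F′ v′) + e * ∑ pairs (λ (v , _) → weight v) + loss
        ≤⟨ ℚₚ.+-mono-≤ (ℚₚ.+-mono-≤
             (∑-pairsʳ F′ λ v′ → 0≤acceptance H ((x , v′) ∷ right Ψ) t)
             (*-monoˡ (0≤* (0≤fromℕ q) 0≤η) (∑-pairsˡ weight 0≤weight)))
             (loss-bound (ℕₚ.≤-trans (ℕₚ.m≤m+n (length Ψ) (suc (suc (twice q)))) small) x∉) ⟩
      ∑ (allFin n) F′ + e * ∑ (allFin n) weight + η * C
        ≡⟨ cong₂ (λ a b → a + e * b + η * C)
             (𝔼-split-vertex (right Ψ) (λ π → Pr (relabel H π) true t) x) (𝔼-split-vertex (left Ψ) (λ _ → 1ℚ) x) ⟨
      acceptance H (right Ψ) t + e * C + η * C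
        ≡⟨ collect (acceptance H (right Ψ) t) (fromℕ q) η C ⟩
      acceptance H (right Ψ) t + (1ℚ + fromℕ q) * η * C
        ≡⟨ cong (λ k → acceptance H (right Ψ) t + k * η * C) (fromℕ-suc q) ⟨
      acceptance H (right Ψ) t + fromℕ (suc q) * η * C ∎
      where
      open ℚₚ.≤-Reasoning
      t : Algorithm d n Bool
      t = query ℓ x κ
      e C : ℚ
      e = fromℕ q * η
      C = extensions (left Ψ)
      F F′ : Fin n → ℚ
      F  v  = acceptance G ((x , v) ∷ left Ψ) t
      F′ v′ = acceptance H ((x , v′) ∷ right Ψ) t
      collect : ∀ a q h c → a + q * h * c + h * c ≡ a + (1ℚ + q) * h * c
      collect = solve-∀ ℚ-ring
      radius : suc (suc (twice q)) ℕ.≤ r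
      radius = ℕₚ.≤-trans (ℕₚ.≤-trans (ℕₚ.m≤n+m (suc (suc (twice q))) (length Ψ)) small) k₀≤r
      small′ : suc (suc (length Ψ)) ℕ.+ twice q ℕ.≤ k₀
      small′ = subst (ℕ._≤ k₀) (trans (ℕₚ.+-suc (length Ψ) (suc (twice q))) (cong suc (ℕₚ.+-suc (length Ψ) (twice q)))) small
      lossy : ∀ v v′ → 1ℚ ≤ bad (v , v′) → F v ≤ F′ v′ + e * weight v + bad (v , v′) * weight v
      lossy v v′ 1≤bad = begin
        F v                                                   ≤⟨ acceptance≤extensions G ((x , v) ∷ left Ψ) t ⟩
        weight v                                              ≡⟨ ℚₚ.*-identityˡ (weight v) ⟨
        1ℚ * weight v                                         ≤⟨ *-monoʳ (0≤weight v) 1≤bad ⟩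
        bad (v , v′) * weight v                               ≡⟨ ℚₚ.+-identityˡ (bad (v , v′) * weight v) ⟨
        0ℚ + bad (v , v′) * weight v                          ≤⟨ ℚₚ.+-monoˡ-≤ (bad (v , v′) * weight v)
                                                                   (0≤+ (0≤acceptance H ((x , v′) ∷ right Ψ) t) (0≤error q ((x , v) ∷ left Ψ))) ⟩
        F′ v′ + e * weight v + bad (v , v′) * weight v        ∎
      pairwise : ∀ v v′ → (v , v′) ∈ pairs → F v ≤ F′ v′ + e * weight v + bad (v , v′) * weight v
      pairwise v v′ vv′∈ with Any.any? (v ≟_) (nearˡ Ψ) | Any.any? (v′ ≟_) (nearʳ Ψ)
      ... | yes v∈ | _ = lossy v v′ (ℚₚ.≤-trans (∈⇒1≤occurrences v∈) (p≤p+q (0≤occurrences (nearʳ Ψ) v′)))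
      ... | no _ | yes v′∈ = lossy v v′ (ℚₚ.≤-trans (∈⇒1≤occurrences v′∈)
        (subst (occurrences (nearʳ Ψ) v′ ≤_) (ℚₚ.+-comm (occurrences (nearʳ Ψ) v′) (occurrences (nearˡ Ψ) v))
          (p≤p+q (0≤occurrences (nearˡ Ψ) v))))
      -- Naming `x` and then the answer adds two entries to `Ψ`, the two that `small` holds in
      -- reserve.
      ... | no v∉ | no v′∉ = ℚₚ.≤-trans
        (claim-known {q} {ℓ} {x} {κ} {(x , v , v′) ∷ Ψ} ih (here refl) (isomorphic-far radius vv′∈ v∉ v′∉ iso) small′
          (λ π ext → bound π (All.tail ext)))
        (p≤p+q (0≤* (0≤bad (v , v′)) (0≤weight v)))

  claim-query : ∀ q ℓ x κ → (∀ y → Claim q (κ y)) → Claim (suc q) (query ℓ x κ)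
  claim-query q ℓ x κ ih Ψ iso small bound with Any.any? (x ≟_) (List.map proj₁ (left Ψ))
  ... | no x∉  = claim-fresh Ψ x {q} {ℓ} {κ} ih x∉ iso small bound
  ... | yes x∈ with ∈ₚ.∈-map⁻ proj₁ x∈
  ...   | _ , x∈′ , refl with ∈ₚ.∈-map⁻ (λ (x , v , v′) → x , v) x∈′
  ...     | (_ , v , v′) , x∈Ψ , refl = ℚₚ.≤-trans
    (claim-known {q} {ℓ} {x} {κ} {Ψ} ih x∈Ψ iso (ℕₚ.≤-trans (ℕₚ.n≤1+n (suc (length Ψ ℕ.+ twice q))) small′) bound)
    (ℚₚ.+-monoʳ-≤ (acceptance H (right Ψ) (query ℓ x κ))
      (*-monoʳ (0≤extensions (left Ψ)) (*-monoʳ 0≤η (fromℕ-mono-≤ (ℕₚ.n≤1+n q)))))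
    where
    small′ : suc (suc (length Ψ)) ℕ.+ twice q ℕ.≤ k₀
    small′ = subst (ℕ._≤ k₀) (trans (ℕₚ.+-suc (length Ψ) (suc (twice q))) (cong suc (ℕₚ.+-suc (length Ψ) (twice q)))) small

  claim : ∀ q t → Claim q t
  claim q       (return a)    = claim-return q a
  claim zero    (query ℓ x κ) = claim-no-query ℓ x κ
  claim (suc q) (query ℓ x κ) = claim-query q ℓ x κ λ y → claim q (κ y)
  claim q       (sample m κ)  = claim-sample q m κ λ i → claim q (κ i)

-- Matching vertices of equal type

record GreedyMatching {A B C : Set} (f : A → C) (g : B → C) (xs : List A) (ys : List B) : Set where
  field
    matched    : List (A × B)
    unmatchedˡ : List A
    unmatchedʳ : List B
    partitionˡ : List.map proj₁ matched ++ unmatchedˡ ↭ xs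
    partitionʳ : List.map proj₂ matched ++ unmatchedʳ ↭ ys
    agree      : ∀ {a b} → (a , b) ∈ matched → f a ≡ g b
    maximal    : ∀ {a b} → a ∈ unmatchedˡ → b ∈ unmatchedʳ → f a ≢ g b

greedyMatching : ∀ {A B C : Set} (_≟ᶜ_ : (c c′ : C) → Dec (c ≡ c′)) (f : A → C) (g : B → C) xs ys →
                 GreedyMatching f g xs ys
greedyMatching _≟ᶜ_ f g [] ys = record
  { matched = [] ; unmatchedˡ = [] ; unmatchedʳ = ys ; partitionˡ = ↭-refl ; partitionʳ = ↭-refl
  ; agree = λ () ; maximal = λ () }
greedyMatching _≟ᶜ_ f g (a ∷ xs) ys with greedyMatching _≟ᶜ_ f g xs ys
... | rec with Any.any? (λ b → f a ≟ᶜ g b) (GreedyMatching.unmatchedʳ rec)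
...   | no none = record
  { matched = matched ; unmatchedˡ = a ∷ unmatchedˡ ; unmatchedʳ = unmatchedʳ
  ; partitionˡ = ↭-trans (↭ₚ.shift a (List.map proj₁ matched) unmatchedˡ) (prep a partitionˡ)
  ; partitionʳ = partitionʳ
  ; agree = agree
  ; maximal = λ { (here refl) b∈ eq → none (lose b∈ eq) ; (there a∈) b∈ → maximal a∈ b∈ }
  }
  where open GreedyMatching rec
...   | yes some with ∈ₚ.∈-∃++ (proj₁ (proj₂ (find some)))
...     | before , after , split = record
  { matched = (a , b) ∷ matched ; unmatchedˡ = unmatchedˡ ; unmatchedʳ = before ++ after
  ; partitionˡ = prep a partitionˡ
  ; partitionʳ = ↭-trans (↭-sym (↭ₚ.shift b (List.map proj₂ matched) (before ++ after)))
      (↭-trans (↭ₚ.++⁺ˡ (List.map proj₂ matched) (↭-sym (subst (_↭ b ∷ before ++ after) (sym split) (↭ₚ.shift b before after)))) partitionʳ)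
  ; agree = λ { (here refl) → proj₂ (proj₂ (find some)) ; (there e) → agree e }
  ; maximal = λ a∈ b∈ → maximal a∈ (subst (_ ∈_) (sym split) (insert b∈))
  }
  where
  open GreedyMatching rec
  b : _
  b = proj₁ (find some)
  insert : ∀ {c} → c ∈ before ++ after → c ∈ before ++ b ∷ after
  insert c∈ with ∈ₚ.∈-++⁻ before c∈
  ... | inj₁ c∈ = ∈ₚ.∈-++⁺ˡ c∈
  ... | inj₂ c∈ = ∈ₚ.∈-++⁺ʳ before (there c∈)

_≟ˢ_ : ∀ {p} (ω ω′ : Subset p) → Dec (ω ≡ ω′)
_≟ˢ_ = Vecₚ.≡-dec _≟ᵇ_

∈-subsets : ∀ {p} (ω : Subset p) → ω ∈ subsets p
∈-subsets []            = here refl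
∈-subsets (inside ∷ ω)  = ∈ₚ.∈-++⁺ˡ (∈ₚ.∈-map⁺ (inside ∷_) (∈-subsets ω))
∈-subsets {suc p} (outside ∷ ω) = ∈ₚ.∈-++⁺ʳ (List.map (inside ∷_) (subsets p)) (∈ₚ.∈-map⁺ (outside ∷_) (∈-subsets ω))

frequency : ∀ {A : Set} {p} → (A → Subset p) → List A → Subset p → ℚ
frequency f xs ω = ∑ xs (λ a → 𝟙 (f a ≟ˢ ω))

-- Matched pairs cancel in the difference of frequencies, and maximality leaves no type unmatched on
-- both sides, so at each type of a left leftover the difference equals the number of left leftovers
-- of that type.
unmatched-bound : ∀ {A B : Set} {p} {f : A → Subset p} {g : B → Subset p} {xs ys} (m : GreedyMatching f g xs ys) →
  fromℕ (length (GreedyMatching.unmatchedˡ m)) ≤ ∑ (subsets p) (λ ω → ∣ frequency f xs ω - frequency g ys ω ∣)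
unmatched-bound {p = p} {f} {g} {xs} {ys} m = begin
  fromℕ (length unmatchedˡ)
    ≡⟨ trans (sym (ℚₚ.*-identityʳ (fromℕ (length unmatchedˡ)))) (sym (∑-const 1ℚ unmatchedˡ)) ⟩
  ∑ unmatchedˡ (λ _ → 1ℚ)
    ≤⟨ ∑-mono unmatchedˡ (λ a → subst (_≤ ∑ (subsets p) (λ ω → 𝟙 (f a ≟ˢ ω))) (𝟙-yes (f a ≟ˢ f a) refl)
         (∑-member {f = λ ω → 𝟙 (f a ≟ˢ ω)} (λ ω → 0≤𝟙 (f a ≟ˢ ω)) (∈-subsets (f a)))) ⟩
  ∑ unmatchedˡ (λ a → ∑ (subsets p) (λ ω → 𝟙 (f a ≟ˢ ω)))
    ≡⟨ ∑-swap (λ a ω → 𝟙 (f a ≟ˢ ω)) unmatchedˡ (subsets p) ⟩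
  ∑ (subsets p) (frequency f unmatchedˡ)
    ≤⟨ ∑-mono (subsets p) (λ ω → subst (frequency f unmatchedˡ ω ≤_) (cong ∣_∣ (sym (difference ω))) (dominated ω)) ⟩
  ∑ (subsets p) (λ ω → ∣ frequency f xs ω - frequency g ys ω ∣) ∎
  where
  open ℚₚ.≤-Reasoning
  open GreedyMatching m
  difference : ∀ ω → frequency f xs ω - frequency g ys ω ≡ frequency f unmatchedˡ ω - frequency g unmatchedʳ ω
  difference ω = trans (cong₂ _-_ splitˡ splitʳ)
    (trans (cong (λ c → c + frequency f unmatchedˡ ω - (∑ matched (λ (_ , b) → 𝟙 (g b ≟ˢ ω)) + frequency g unmatchedʳ ω))
      (∑-cong-∈ matched λ {(a , b)} e → 𝟙-⇔ (f a ≟ˢ ω) (g b ≟ˢ ω) (trans (sym (agree e))) (trans (agree e))))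
      (cancel (∑ matched (λ (_ , b) → 𝟙 (g b ≟ˢ ω))) (frequency f unmatchedˡ ω) (frequency g unmatchedʳ ω)))
    where
    splitˡ : frequency f xs ω ≡ ∑ matched (λ (a , _) → 𝟙 (f a ≟ˢ ω)) + frequency f unmatchedˡ ω
    splitˡ = trans (sym (∑-↭ (λ a → 𝟙 (f a ≟ˢ ω)) partitionˡ))
      (trans (∑-++ (λ a → 𝟙 (f a ≟ˢ ω)) (List.map proj₁ matched) unmatchedˡ)
        (cong (_+ frequency f unmatchedˡ ω) (∑-map proj₁ (λ a → 𝟙 (f a ≟ˢ ω)) matched)))
    splitʳ : frequency g ys ω ≡ ∑ matched (λ (_ , b) → 𝟙 (g b ≟ˢ ω)) + frequency g unmatchedʳ ω
    splitʳ = trans (sym (∑-↭ (λ b → 𝟙 (g b ≟ˢ ω)) partitionʳ))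
      (trans (∑-++ (λ b → 𝟙 (g b ≟ˢ ω)) (List.map proj₂ matched) unmatchedʳ)
        (cong (_+ frequency g unmatchedʳ ω) (∑-map proj₂ (λ b → 𝟙 (g b ≟ˢ ω)) matched)))
    cancel : ∀ a b c → a + b - (a + c) ≡ b - c
    cancel = solve-∀ ℚ-ring
  dominated : ∀ ω → frequency f unmatchedˡ ω ≤ ∣ frequency f unmatchedˡ ω - frequency g unmatchedʳ ω ∣
  dominated ω with Any.any? (λ a → f a ≟ˢ ω) unmatchedˡ
  ... | no none = ℚₚ.≤-trans
    (ℚₚ.≤-reflexive (trans (∑-cong-∈ unmatchedˡ λ {a} a∈ → 𝟙-no (f a ≟ˢ ω) λ eq → none (lose a∈ eq)) (∑-0 unmatchedˡ)))
    (ℚₚ.0≤∣p∣ (frequency f unmatchedˡ ω - frequency g unmatchedʳ ω))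
  ... | yes some with find some
  ...   | a , a∈ , refl = ℚₚ.≤-reflexive (sym (trans
    (cong (λ c → ∣ frequency f unmatchedˡ ω - c ∣)
      (trans (∑-cong-∈ unmatchedʳ λ {b} b∈ → 𝟙-no (g b ≟ˢ ω) λ eq → maximal a∈ b∈ (sym eq)) (∑-0 unmatchedʳ)))
    (trans (cong ∣_∣ (ℚₚ.+-identityʳ (frequency f unmatchedˡ ω)))
      (ℚₚ.0≤p⇒∣p∣≡p (∑-nonneg unmatchedˡ λ a → 0≤𝟙 (f a ≟ˢ ω))))))

N-as-frequency : ∀ {d n} .{{_ : NonZero n}} (G : SGraph d n) P ω →
                 N G P ω ≡ frequency (λ x → Stab∩ G x P) (allFin n) ω * (ℤ.+ 1 / n)
N-as-frequency {n = n} G P ω = trans (/-as-* (Vec.count (_≟ˢ ω) types) n) (cong (_* (ℤ.+ 1 / n))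
  (trans (count-as-∑ (_≟ˢ ω) types) (trans
    (cong (λ ωs → ∑ ωs (λ ω′ → 𝟙 (ω′ ≟ˢ ω))) (toList-tabulate (λ x → Stab∩ G x P)))
    (∑-map (λ x → Stab∩ G x P) (λ ω′ → 𝟙 (ω′ ≟ˢ ω)) (allFin n)))))
  where
  types : Vec (Subset (size P)) n
  types = Vec.tabulate λ x → Stab∩ G x P

module _ {d n : ℕ} .{{_ : NonZero n}} (G H : SGraph d n) (r : ℕ) where

  private
    greedy : GreedyMatching (λ x → Stab∩ G x (ball d r)) (λ x → Stab∩ H x (ball d r)) (allFin n) (allFin n)
    greedy = greedyMatching _≟ˢ_ (λ x → Stab∩ G x (ball d r)) (λ x → Stab∩ H x (ball d r)) (allFin n) (allFin n)

  matching : Matching G H r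
  matching = record
    { pairs = matched ; leftoverˡ = unmatchedˡ ; leftoverʳ = unmatchedʳ ; coversˡ = partitionˡ ; coversʳ = partitionʳ
    ; sameType = λ e w |w|≤r → Stab∩-ball G H r (agree e) w |w|≤r , Stab∩-ball H G r (sym (agree e)) w |w|≤r
    }
    where open GreedyMatching greedy

  leftover-bound : fromℕ (length (Matching.leftoverˡ matching)) ≤
                   fromℕ n * (dTV (N G (ball d r)) (N H (ball d r)) + dTV (N G (ball d r)) (N H (ball d r)))
  leftover-bound = begin
    fromℕ (length (Matching.leftoverˡ matching))
      ≤⟨ unmatched-bound greedy ⟩
    ∑ (subsets p) (λ ω → ∣ a ω - b ω ∣)
      ≡⟨ ∑-cong (subsets p) (λ ω → trans (trans (sym (ℚₚ.*-identityˡ ∣ a ω - b ω ∣))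
           (cong (_* ∣ a ω - b ω ∣) (sym (n*1/n≡1 n)))) (rescale ω)) ⟩
    ∑ (subsets p) (λ ω → fromℕ n * ∣ N G P ω - N H P ω ∣)
      ≡⟨ ∑-*ˡ (fromℕ n) (λ ω → ∣ N G P ω - N H P ω ∣) (subsets p) ⟩
    fromℕ n * ∑ (subsets p) (λ ω → ∣ N G P ω - N H P ω ∣)
      ≡⟨ cong (fromℕ n *_) (halves (∑ (subsets p) (λ ω → ∣ N G P ω - N H P ω ∣))) ⟩
    fromℕ n * (dTV (N G P) (N H P) + dTV (N G P) (N H P)) ∎
    where
    open ℚₚ.≤-Reasoning
    P : FinSubset d
    P = ball d r
    p : ℕ
    p = size P
    a b : Subset p → ℚ
    a = frequency (λ x → Stab∩ G x P) (allFin n)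
    b = frequency (λ x → Stab∩ H x P) (allFin n)
    halves : ∀ s → s ≡ ½ * s + ½ * s
    halves s = trans (sym (ℚₚ.*-identityˡ s)) (ℚₚ.*-distribʳ-+ s ½ ½)
    rescale : ∀ ω → fromℕ n * (ℤ.+ 1 / n) * ∣ a ω - b ω ∣ ≡ fromℕ n * ∣ N G P ω - N H P ω ∣
    rescale ω = sym (begin-equality
      fromℕ n * ∣ N G P ω - N H P ω ∣
        ≡⟨ cong₂ (λ s t → fromℕ n * ∣ s - t ∣) (N-as-frequency G P ω) (N-as-frequency H P ω) ⟩
      fromℕ n * ∣ a ω * (ℤ.+ 1 / n) - b ω * (ℤ.+ 1 / n) ∣
        ≡⟨ cong (λ s → fromℕ n * ∣ s ∣) (factor (a ω) (b ω) (ℤ.+ 1 / n)) ⟩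
      fromℕ n * ∣ (a ω - b ω) * (ℤ.+ 1 / n) ∣
        ≡⟨ cong (fromℕ n *_) (trans (ℚₚ.∣p*q∣≡∣p∣*∣q∣ (a ω - b ω) (ℤ.+ 1 / n))
             (cong (∣ a ω - b ω ∣ *_) (ℚₚ.0≤p⇒∣p∣≡p (0≤1/n n)))) ⟩
      fromℕ n * (∣ a ω - b ω ∣ * (ℤ.+ 1 / n))
        ≡⟨ swap-last (fromℕ n) ∣ a ω - b ω ∣ (ℤ.+ 1 / n) ⟩
      fromℕ n * (ℤ.+ 1 / n) * ∣ a ω - b ω ∣ ∎)
      where
      factor : ∀ a b c → a * c - b * c ≡ (a - b) * c
      factor = solve-∀ ℚ-ring
      swap-last : ∀ a b c → a * (b * c) ≡ a * c * b
      swap-last = solve-∀ ℚ-ring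

-- Relators and complete matchings

relatorBound : ∀ {d} → System d → ℕ
relatorBound []            = 0
relatorBound ((u , w) ∷ E) = (length w ℕ.+ length u) ℕ.+ relatorBound E

relator-length : ∀ {d} {E : System d} {u w} → (u , w) ∈ E → length (inverseWord w ++ u) ℕ.≤ relatorBound E
relator-length {E = (u , w) ∷ E} (here refl) = subst (ℕ._≤ relatorBound ((u , w) ∷ E))
  (sym (trans (Listₚ.length-++ (inverseWord w)) (cong (ℕ._+ length u) (length-inverseWord w))))
  (ℕₚ.m≤m+n (length w ℕ.+ length u) (relatorBound E))
relator-length {E = (u , w) ∷ E} (there e) = ℕₚ.≤-trans (relator-length e) (ℕₚ.m≤n+m (relatorBound E) (length w ℕ.+ length u))

-- A relation `u = w` holds at `v′` exactly when `inverseWord w ++ u` fixes `v′`. That word is short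
-- enough to be seen by the type, so it transfers from the partner of `v′` in `G`.
complete-matching-GSol : ∀ {d n E} {G H : SGraph d n} {r} (m : Matching G H r) → Matching.leftoverˡ m ≡ [] →
                         relatorBound E ℕ.≤ r → GSol E G → GSol E H
complete-matching-GSol {d} {n} {E} {G} {H} m empty bound sol = All.tabulate λ {(u , w)} e v′ → relation e v′
  where
  open Matching m
  -- Both covers exhaust the `n` vertices, so an empty left leftover forces an empty right one and
  -- every vertex of `H` has a partner.
  same-length : length pairs ℕ.+ 0 ≡ length pairs ℕ.+ length leftoverʳ
  same-length = begin
    length pairs ℕ.+ 0                                 ≡⟨ cong (λ xs → length pairs ℕ.+ length xs) empty ⟨
    length pairs ℕ.+ length leftoverˡ                  ≡⟨ cong (ℕ._+ length leftoverˡ) (Listₚ.length-map proj₁ pairs) ⟨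
    length (List.map proj₁ pairs) ℕ.+ length leftoverˡ ≡⟨ Listₚ.length-++ (List.map proj₁ pairs) ⟨
    length (List.map proj₁ pairs ++ leftoverˡ)         ≡⟨ trans (↭ₚ.↭-length coversˡ) (sym (↭ₚ.↭-length coversʳ)) ⟩
    length (List.map proj₂ pairs ++ leftoverʳ)         ≡⟨ Listₚ.length-++ (List.map proj₂ pairs) ⟩
    length (List.map proj₂ pairs) ℕ.+ length leftoverʳ ≡⟨ cong (ℕ._+ length leftoverʳ) (Listₚ.length-map proj₂ pairs) ⟩
    length pairs ℕ.+ length leftoverʳ                  ∎
    where open ≡-Reasoning
  no-leftoverʳ : ∀ {v′} → v′ ∉ leftoverʳ
  no-leftoverʳ v′∈ with leftoverʳ | ℕₚ.+-cancelˡ-≡ (length pairs) 0 (length leftoverʳ) same-length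
  no-leftoverʳ () | [] | _
  no-leftoverʳ v′∈ | _ ∷ _ | ()
  partner : ∀ v′ → ∃ λ v → (v , v′) ∈ pairs
  partner v′ with ∈ₚ.∈-++⁻ (List.map proj₂ pairs) (↭ₚ.∈-resp-↭ (↭-sym coversʳ) (∈ₚ.∈-allFin v′))
  ... | inj₂ v′∈ = contradiction v′∈ no-leftoverʳ
  ... | inj₁ v′∈ with ∈ₚ.∈-map⁻ proj₂ v′∈
  ...   | (v , _) , e , refl = v , e
  relation : ∀ {u w} → (u , w) ∈ E → ∀ v′ → act H u v′ ≡ act H w v′
  relation {u} {w} e v′ with partner v′
  ... | v , vv′∈ = act-injective H (inverseWord w) (trans (trans (sym (act-++ H (inverseWord w) u v′))
      (proj₁ (sameType vv′∈ (inverseWord w ++ u) (ℕₚ.≤-trans (relator-length e) bound)) stabG))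
      (sym (act-inverseWordˡ H w v′)))
    where
    stabG : Stab G v (inverseWord w ++ u)
    stabG = trans (act-++ G (inverseWord w) u v)
      (trans (cong (act G (inverseWord w)) (All.lookup sol e v)) (act-inverseWordˡ G w v))

-- Testers separate local statistics

T-does⁻ : ∀ {P : Set} (d : Dec P) → T (does d) → P
T-does⁻ (yes p) _ = p

T-does⁺ : ∀ {P : Set} (d : Dec P) → P → T (does d)
T-does⁺ (yes _) _ = tt
T-does⁺ (no ¬p) p = ¬p p

-- Closedness of the cut rests on density: if `p` exceeded `q`, a rational strictly between them
-- would have to lie in the cut.
fromℚ>0 : ∀ q → 0ℚ < q → ℝ>0
fromℚ>0 q 0<q = record
  { below     = λ p → does (p ℚₚ.≤? q)
  ; inhabited = q , T-does⁺ (q ℚₚ.≤? q) ℚₚ.≤-refl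
  ; bounded   = q + 1ℚ , λ t → ℚₚ.<-irrefl refl (ℚₚ.<-≤-trans q<q+1 (T-does⁻ (q + 1ℚ ℚₚ.≤? q) t))
  ; downward  = λ {p} {p′} p≤p′ t → T-does⁺ (p ℚₚ.≤? q) (ℚₚ.≤-trans p≤p′ (T-does⁻ (p′ ℚₚ.≤? q) t))
  ; closed    = λ {p} below → T-does⁺ (p ℚₚ.≤? q) (closed′ p below)
  } , q , 0<q , T-does⁺ (q ℚₚ.≤? q) ℚₚ.≤-refl
  where
  q<q+1 : q < q + 1ℚ
  q<q+1 = subst (_< q + 1ℚ) (ℚₚ.+-identityʳ q) (ℚₚ.+-monoʳ-< q (ℚₚ.positive⁻¹ 1ℚ))
  closed′ : ∀ p → (∀ {m} → m < p → T (does (m ℚₚ.≤? q))) → p ≤ q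
  closed′ p below with p ℚₚ.≤? q
  ... | yes p≤q = p≤q
  ... | no p≰q with ℚₚ.<-dense (ℚₚ.≰⇒> p≰q)
  ...   | m , q<m , m<p = ⊥-elim (ℚₚ.<-irrefl refl (ℚₚ.<-≤-trans q<m (T-does⁻ (m ℚₚ.≤? q) (below m<p))))

≤ℝ⇒≤ : ∀ {q 0<q p} → p ≤ℝ value (fromℚ>0 q 0<q) → p ≤ q
≤ℝ⇒≤ {q} {p = p} = T-does⁻ (p ℚₚ.≤? q)

≤⇒≤ℝ : ∀ {q 0<q p} → p ≤ q → p ≤ℝ value (fromℚ>0 q 0<q)
≤⇒≤ℝ {q} {p = p} = T-does⁺ (p ℚₚ.≤? q)

sum-of-halves : ∀ a b {n} → a ℕ.+ a ℕ.≤ n → b ℕ.+ b ℕ.≤ n → a ℕ.+ b ℕ.≤ n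
sum-of-halves a b a+a≤n b+b≤n with ℕₚ.≤-total a b
... | inj₁ a≤b = ℕₚ.≤-trans (ℕₚ.+-monoˡ-≤ b a≤b) b+b≤n
... | inj₂ b≤a = ℕₚ.≤-trans (ℕₚ.+-monoʳ-≤ a b≤a) a+a≤n

-- The number of vertices from which fresh labels are cheap

module _ (k₀ K R : ℕ) .{{_ : NonZero K}} where

  -- Chosen for `K ℓ + 2 K k R + k ≤ n`, the budget cleared of denominators. The summand `2 K` keeps
  -- the leftovers within half of `n`, the other one does so for neighbourhoods and revealed
  -- vertices. The successor gives `k₀ < threshold` and a value that is visibly nonzero.
  threshold : ℕ
  threshold = suc (2 ℕ.* K ℕ.+ 2 ℕ.* (K ℕ.* (k₀ ℕ.* R ℕ.+ k₀ ℕ.* R) ℕ.+ k₀))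

  private
    double : ∀ a → 2 ℕ.* a ≡ a ℕ.+ a
    double a = cong (a ℕ.+_) (ℕₚ.+-identityʳ a)

  k₀<threshold : k₀ ℕ.< threshold
  k₀<threshold = ℕ.s≤s (ℕₚ.≤-trans (ℕₚ.m≤n+m k₀ (K ℕ.* (k₀ ℕ.* R ℕ.+ k₀ ℕ.* R)))
    (ℕₚ.≤-trans (ℕₚ.m≤n*m (K ℕ.* (k₀ ℕ.* R ℕ.+ k₀ ℕ.* R) ℕ.+ k₀) 2) (ℕₚ.m≤n+m _ (2 ℕ.* K))))

  integer-budget : ∀ {ℓ n k} → ℓ ℕ.* threshold ℕ.< n → threshold ℕ.≤ n → k ℕ.≤ k₀ →
                   K ℕ.* ℓ ℕ.+ (K ℕ.* (k ℕ.* R ℕ.+ k ℕ.* R) ℕ.+ k) ℕ.≤ n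
  integer-budget {ℓ} {n} {k} ℓt<n t≤n k≤k₀ = sum-of-halves (K ℕ.* ℓ) (K ℕ.* (k ℕ.* R ℕ.+ k ℕ.* R) ℕ.+ k)
    (begin
      K ℕ.* ℓ ℕ.+ K ℕ.* ℓ       ≡⟨ double (K ℕ.* ℓ) ⟨
      2 ℕ.* (K ℕ.* ℓ)           ≡⟨ ℕₚ.*-assoc 2 K ℓ ⟨
      2 ℕ.* K ℕ.* ℓ             ≡⟨ ℕₚ.*-comm (2 ℕ.* K) ℓ ⟩
      ℓ ℕ.* (2 ℕ.* K)           ≤⟨ ℕₚ.*-monoʳ-≤ ℓ (ℕₚ.≤-trans (ℕₚ.m≤m+n (2 ℕ.* K) _) (ℕₚ.n≤1+n _)) ⟩
      ℓ ℕ.* threshold           ≤⟨ ℕₚ.<⇒≤ ℓt<n ⟩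
      n                         ∎)
    (begin
      B k ℕ.+ B k               ≤⟨ ℕₚ.+-mono-≤ B-mono B-mono ⟩
      B k₀ ℕ.+ B k₀             ≡⟨ double (B k₀) ⟨
      2 ℕ.* B k₀                ≤⟨ ℕₚ.m≤n+m (2 ℕ.* B k₀) (2 ℕ.* K) ⟩
      2 ℕ.* K ℕ.+ 2 ℕ.* B k₀    ≤⟨ ℕₚ.n≤1+n _ ⟩
      threshold                 ≤⟨ t≤n ⟩
      n                         ∎)
    where
    open ℕₚ.≤-Reasoning
    B : ℕ → ℕ
    B k = K ℕ.* (k ℕ.* R ℕ.+ k ℕ.* R) ℕ.+ k
    B-mono : B k ℕ.≤ B k₀
    B-mono = ℕₚ.+-mono-≤ (ℕₚ.*-monoʳ-≤ K (ℕₚ.+-mono-≤ (ℕₚ.*-monoˡ-≤ R k≤k₀) (ℕₚ.*-monoˡ-≤ R k≤k₀))) k≤k₀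

  rational-budget : ∀ {ℓ n k} → ℓ ℕ.* threshold ℕ.< n → threshold ℕ.≤ n → k ℕ.≤ k₀ →
                    fromℕ ℓ + (fromℕ (k ℕ.* R) + fromℕ (k ℕ.* R)) ≤ (ℤ.+ 1 / K) * (fromℕ n - fromℕ k)
  rational-budget {ℓ} {n} {k} ℓt<n t≤n k≤k₀ = begin
    x                                             ≡⟨ ℚₚ.*-identityˡ x ⟨
    1ℚ * x                                        ≡⟨ cong (_* x) (n*1/n≡1 K) ⟨
    fromℕ K * (ℤ.+ 1 / K) * x                     ≡⟨ rotate (fromℕ K) (ℤ.+ 1 / K) x ⟩
    (ℤ.+ 1 / K) * (fromℕ K * x)                   ≤⟨ *-monoˡ (0≤1/n K) (≤-from (fromℕ-mono-≤ (integer-budget {ℓ} {n} {k} ℓt<n t≤n k≤k₀))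
                                                       (trans (cancel (fromℕ K * x) (fromℕ n) (fromℕ k)) (cong (fromℕ n - fromℕ k +_) (sym expand)))) ⟩
    (ℤ.+ 1 / K) * (fromℕ n - fromℕ k)             ∎
    where
    open ℚₚ.≤-Reasoning
    x : ℚ
    x = fromℕ ℓ + (fromℕ (k ℕ.* R) + fromℕ (k ℕ.* R))
    rotate : ∀ a b c → a * b * c ≡ b * (a * c)
    rotate = solve-∀ ℚ-ring
    cancel : ∀ a n k → a + n ≡ n - k + (a + k)
    cancel = solve-∀ ℚ-ring
    regroup : ∀ a l b k → a * l + (a * b + k) ≡ a * (l + b) + k
    regroup = solve-∀ ℚ-ring
    expand : fromℕ (K ℕ.* ℓ ℕ.+ (K ℕ.* (k ℕ.* R ℕ.+ k ℕ.* R) ℕ.+ k)) ≡ fromℕ K * x + fromℕ k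
    expand = begin-equality
      fromℕ (K ℕ.* ℓ ℕ.+ (K ℕ.* (k ℕ.* R ℕ.+ k ℕ.* R) ℕ.+ k))
        ≡⟨ fromℕ-+ (K ℕ.* ℓ) (K ℕ.* (k ℕ.* R ℕ.+ k ℕ.* R) ℕ.+ k) ⟩
      fromℕ (K ℕ.* ℓ) + fromℕ (K ℕ.* (k ℕ.* R ℕ.+ k ℕ.* R) ℕ.+ k)
        ≡⟨ cong (fromℕ (K ℕ.* ℓ) +_) (fromℕ-+ (K ℕ.* (k ℕ.* R ℕ.+ k ℕ.* R)) k) ⟩
      fromℕ (K ℕ.* ℓ) + (fromℕ (K ℕ.* (k ℕ.* R ℕ.+ k ℕ.* R)) + fromℕ k)
        ≡⟨ cong₂ (λ a b → a + (b + fromℕ k)) (fromℕ-* K ℓ) (fromℕ-* K (k ℕ.* R ℕ.+ k ℕ.* R)) ⟩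
      fromℕ K * fromℕ ℓ + (fromℕ K * fromℕ (k ℕ.* R ℕ.+ k ℕ.* R) + fromℕ k)
        ≡⟨ regroup (fromℕ K) (fromℕ ℓ) (fromℕ (k ℕ.* R ℕ.+ k ℕ.* R)) (fromℕ k) ⟩
      fromℕ K * (fromℕ ℓ + fromℕ (k ℕ.* R ℕ.+ k ℕ.* R)) + fromℕ k
        ≡⟨ cong (λ a → fromℕ K * (fromℕ ℓ + a) + fromℕ k) (fromℕ-+ (k ℕ.* R) (k ℕ.* R)) ⟩
      fromℕ K * x + fromℕ k ∎

twice-+ : ∀ q → twice q ≡ q ℕ.+ q
twice-+ zero    = refl
twice-+ (suc q) = cong suc (trans (cong suc (twice-+ q)) (sym (ℕₚ.+-suc q q)))

-- Doubling and cancelling `T` leaves `1.98 ≤ 0.02 + 1`, a closed inequality that evaluation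
-- refutes.
separate : ∀ {T h : ℚ} → 0ℚ < T → h + h ≤ 1ℚ →
           ¬ (ℤ.+ 99 / 100) * T ≤ (1ℚ - (ℤ.+ 99 / 100)) * T + h * T
separate {T} {h} 0<T h+h≤1 le = from-no (a + a ℚₚ.≤? b + b + 1ℚ) (ℚₚ.*-cancelʳ-≤-pos T {{positive 0<T}} (begin
  (a + a) * T                          ≡⟨ ℚₚ.*-distribʳ-+ T a a ⟩
  a * T + a * T                        ≤⟨ ℚₚ.+-mono-≤ le le ⟩
  b * T + h * T + (b * T + h * T)      ≡⟨ collect b h T ⟩
  (b + b) * T + (h + h) * T            ≤⟨ ℚₚ.+-monoʳ-≤ ((b + b) * T) (*-monoʳ (ℚₚ.<⇒≤ 0<T) h+h≤1) ⟩
  (b + b) * T + 1ℚ * T                 ≡⟨ ℚₚ.*-distribʳ-+ T (b + b) 1ℚ ⟨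
  (b + b + 1ℚ) * T                     ∎))
  where
  open ℚₚ.≤-Reasoning
  a b : ℚ
  a = ℤ.+ 99 / 100
  b = 1ℚ - a
  collect : ∀ b h t → b * t + h * t + (b * t + h * t) ≡ (b + b) * t + (h + h) * t
  collect = solve-∀ ℚ-ring

module _ {d : ℕ} (E : System d) (ε : ℝ>0) (q : ℕ) (M : Procedure d) (tester : IsTester E (value ε) q M) where

  private
    radius K n₀ : ℕ
    -- The first summand serves the coupling of `q` queries, the second makes the relators visible
    -- to the type of a vertex.
    radius = twice q ℕ.+ relatorBound E
    -- With `η = 1 / K` this gives `2 q η ≤ 1`; the successor keeps `K` nonzero when `q` is zero.
    K = suc (twice q)
    n₀ = threshold (twice q) K (length (wordsUpTo d radius))

  -- With few leftovers the coupling bounds the excess of acceptance of `G` over `H`, averaged over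
  -- relabellings, by one half; the tester makes the former at least 0.99 and the latter at most
  -- 0.01.
  large-graphs : ∀ {n} .{{_ : NonZero n}} {G H : SGraph d n} (m : Matching G H radius) → GSol E G → Far E (value ε) H →
                 n₀ ℕ.≤ n → ¬ length (Matching.leftoverˡ m) ℕ.* n₀ ℕ.< n
  large-graphs {n} {G} {H} m sol far n₀≤n ℓn₀<n = separate {T = extensions ∅} {h = fromℕ q * η} (0<extensions-[] {n}) 2qη≤1 (begin
    (ℤ.+ 99 / 100) * extensions ∅
      ≡⟨ 𝔼-*ˡ ∅ (ℤ.+ 99 / 100) (λ _ → 1ℚ) ⟨
    𝔼 ∅ (λ _ → (ℤ.+ 99 / 100) * 1ℚ)
      ≤⟨ 𝔼-mono ∅ (λ π _ → ℚₚ.≤-trans (ℚₚ.≤-reflexive (ℚₚ.*-identityʳ (ℤ.+ 99 / 100)))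
           (proj₁ (tester n (relabel G π)) (GSol-relabel G π sol))) ⟩
    acceptance G ∅ (M n)
      -- Nothing is revealed at the start, so the isomorphism condition is vacuous and all `twice q`
      -- entries are still available.
      ≤⟨ claim q (M n) [] (λ ()) ℕₚ.≤-refl (λ π _ → proj₂ (proj₂ (tester n (relabel G π)))) ⟩
    acceptance H ∅ (M n) + fromℕ q * η * extensions ∅
      ≤⟨ ℚₚ.+-monoˡ-≤ (fromℕ q * η * extensions ∅) (𝔼-mono ∅ λ π _ → rejecting π) ⟩
    𝔼 ∅ (λ _ → (1ℚ - (ℤ.+ 99 / 100)) * 1ℚ) + fromℕ q * η * extensions ∅
      ≡⟨ cong (_+ fromℕ q * η * extensions ∅) (𝔼-*ˡ ∅ (1ℚ - (ℤ.+ 99 / 100)) (λ _ → 1ℚ)) ⟩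
    (1ℚ - (ℤ.+ 99 / 100)) * extensions ∅ + fromℕ q * η * extensions ∅ ∎)
    where
    open ℚₚ.≤-Reasoning
    ∅ : PartialMap {n}
    ∅ = []
    η : ℚ
    η = ℤ.+ 1 / K
    open Coupling G H m (twice q) (ℕₚ.m≤m+n (twice q) (relatorBound E))
      (ℕₚ.<-≤-trans (k₀<threshold (twice q) K (length (wordsUpTo d radius))) n₀≤n) η (0≤1/n K)
      (λ k k≤ → rational-budget (twice q) K (length (wordsUpTo d radius)) {n = n} {k} ℓn₀<n n₀≤n k≤)
    2qη≤1 : fromℕ q * η + fromℕ q * η ≤ 1ℚ
    2qη≤1 = begin
      fromℕ q * η + fromℕ q * η    ≡⟨ ℚₚ.*-distribʳ-+ η (fromℕ q) (fromℕ q) ⟨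
      (fromℕ q + fromℕ q) * η      ≡⟨ cong (_* η) (trans (sym (fromℕ-+ q q)) (cong fromℕ (sym (twice-+ q)))) ⟩
      fromℕ (twice q) * η          ≤⟨ *-monoʳ (0≤1/n K) (fromℕ-mono-≤ (ℕₚ.n≤1+n (twice q))) ⟩
      fromℕ K * η                  ≡⟨ n*1/n≡1 K ⟩
      1ℚ                           ∎
    rejecting : ∀ π → Pr (relabel H π) true (M n) ≤ (1ℚ - (ℤ.+ 99 / 100)) * 1ℚ
    rejecting π = ≤-from (proj₁ (proj₂ (tester n (relabel H π))) (Far-relabel {E = E} {value ε} H π far))
      (trans (Pr-total (relabel H π) (M n)) (complement (ℤ.+ 99 / 100)))
      where
      complement : ∀ c → 1ℚ ≡ (1ℚ - c) * 1ℚ + c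
      complement = solve-∀ ℚ-ring

  -- For `n` at least `n₀`, fewer leftovers are refuted by the coupling. For smaller `n`, a single
  -- leftover already gives the bound, and none at all would make `H` a solution.
  tester-bound : ∀ {n} .{{_ : NonZero n}} {G H : SGraph d n} (m : Matching G H radius) → GSol E G → Far E (value ε) H →
                 n ℕ.≤ length (Matching.leftoverˡ m) ℕ.* n₀
  tester-bound {n} {G} {H} m sol far with n ℕ.≤? length (Matching.leftoverˡ m) ℕ.* n₀ | n₀ ℕ.≤? n
  ... | yes n≤ℓn₀ | _ = n≤ℓn₀
  ... | no n≰ℓn₀ | yes n₀≤n = contradiction (ℕₚ.≰⇒> n≰ℓn₀) (large-graphs m sol far n₀≤n)
  ... | no n≰ℓn₀ | no n₀≰n with Matching.leftoverˡ m in eq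
  ...   | []     = contradiction
    (complete-matching-GSol m eq (ℕₚ.m≤n+m (relatorBound E) (twice q)) sol)
    (Far⇒¬GSol ε H far)
  ...   | _ ∷ xs = contradiction
    (ℕₚ.≤-trans (ℕₚ.≰⇒≥ n₀≰n) (ℕₚ.m≤m+n n₀ (length xs ℕ.* n₀))) n≰ℓn₀

  tester-separates : ∃ λ (P : FinSubset d) → ∃ λ (δ : ℝ>0) → ∀ n .{{_ : NonZero n}} (G H : SGraph d n) →
                     GSol E G → Far E (value ε) H → value δ ℝ≤ dTV (N G P) (N H P)
  tester-separates = ball d radius , fromℚ>0 δ (0<1/n (2 ℕ.* n₀)) , λ n G H sol far p≤δ →
    ℚₚ.≤-trans (≤ℝ⇒≤ {δ} {0<1/n (2 ℕ.* n₀)} p≤δ) (bound n G H sol far)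
    where
    δ : ℚ
    -- Comes from `n ≤ ℓ n₀` and `ℓ ≤ 2 n t`, where `t` is the distance; the 2 undoes the one half
    -- in `dTV`.
    δ = ℤ.+ 1 / (2 ℕ.* n₀)
    bound : ∀ n .{{_ : NonZero n}} (G H : SGraph d n) → GSol E G → Far E (value ε) H →
            δ ≤ dTV (N G (ball d radius)) (N H (ball d radius))
    bound n G H sol far = ℚₚ.*-cancelˡ-≤-pos (fromℕ n * fromℕ (2 ℕ.* n₀)) {{positive 0<c}} (begin
      fromℕ n * fromℕ (2 ℕ.* n₀) * δ       ≡⟨ ℚₚ.*-assoc (fromℕ n) (fromℕ (2 ℕ.* n₀)) δ ⟩
      fromℕ n * (fromℕ (2 ℕ.* n₀) * δ)     ≡⟨ cong (fromℕ n *_) (n*1/n≡1 (2 ℕ.* n₀)) ⟩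
      fromℕ n * 1ℚ                         ≡⟨ ℚₚ.*-identityʳ (fromℕ n) ⟩
      fromℕ n                              ≤⟨ fromℕ-mono-≤ (tester-bound (matching G H radius) sol far) ⟩
      fromℕ (ℓ ℕ.* n₀)                     ≡⟨ fromℕ-* ℓ n₀ ⟩
      fromℕ ℓ * fromℕ n₀                   ≤⟨ *-monoʳ (0≤fromℕ n₀) (leftover-bound G H radius) ⟩
      fromℕ n * (t + t) * fromℕ n₀         ≡⟨ regroup (fromℕ n) t (fromℕ n₀) ⟩
      fromℕ n * (fromℕ n₀ + fromℕ n₀) * t  ≡⟨ cong (λ k → fromℕ n * k * t) (trans (sym (fromℕ-+ n₀ n₀))
                                                (cong (λ k → fromℕ (n₀ ℕ.+ k)) (sym (ℕₚ.+-identityʳ n₀)))) ⟩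
      fromℕ n * fromℕ (2 ℕ.* n₀) * t       ∎)
      where
      open ℚₚ.≤-Reasoning
      ℓ : ℕ
      ℓ = length (Matching.leftoverˡ (matching G H radius))
      t : ℚ
      t = dTV (N G (ball d radius)) (N H (ball d radius))
      0<c : 0ℚ < fromℕ n * fromℕ (2 ℕ.* n₀)
      0<c = subst (_< fromℕ n * fromℕ (2 ℕ.* n₀)) (ℚₚ.*-zeroʳ (fromℕ n))
        (ℚₚ.*-monoʳ-<-pos (fromℕ n) {{positive (0<fromℕ n)}} (0<fromℕ (2 ℕ.* n₀)))
      regroup : ∀ n t m → n * (t + t) * m ≡ n * (m + m) * t
      regroup = solve-∀ ℚ-ring

testable⇒distinguishable : ∀ {d} {E : System d} → Testable E → StatisticallyDistinguishable E
testable⇒distinguishable {E = E} (M , q , tester) ε = tester-separates E ε (q ε) (M ε) (tester ε)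

-- Sampling and the second moment

-- The expectation of a statistic of the output. Unlike `Pr`, it applies to outputs of any type and
-- so composes along `>>=`.
outcome : ∀ {d n A} → SGraph d n → Algorithm d n A → (A → ℚ) → ℚ
outcome G (return a)    h = h a
outcome G (query ℓ x κ) h = outcome G (κ (step G ℓ x)) h
outcome G (sample m κ)  h = (ℤ.+ 1 / m) * ∑ (allFin m) (λ i → outcome G (κ i) h)

Pr-as-outcome : ∀ {d n} (G : SGraph d n) b t → Pr G b t ≡ outcome G t (λ a → 𝟙 (a ≟ᵇ b))
Pr-as-outcome G b (return a)    = refl
Pr-as-outcome G b (query ℓ x κ) = Pr-as-outcome G b (κ (step G ℓ x))
Pr-as-outcome G b (sample m κ)  = cong ((ℤ.+ 1 / m) *_) (∑-cong (allFin m) λ i → Pr-as-outcome G b (κ i))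

outcome->>= : ∀ {d n A B} (G : SGraph d n) (t : Algorithm d n A) (f : A → Algorithm d n B) h →
              outcome G (t >>= f) h ≡ outcome G t (λ a → outcome G (f a) h)
outcome->>= G (return a)    f h = refl
outcome->>= G (query ℓ x κ) f h = outcome->>= G (κ (step G ℓ x)) f h
outcome->>= G (sample m κ)  f h = cong ((ℤ.+ 1 / m) *_) (∑-cong (allFin m) λ i → outcome->>= G (κ i) f h)

outcome-walk : ∀ {d n} (G : SGraph d n) w x h → outcome G (walk w x) h ≡ h (act G w x)
outcome-walk G []      x h = refl
outcome-walk G (ℓ ∷ w) x h = trans (outcome->>= G (walk w x) (λ y → query ℓ y return) h)
  (outcome-walk G w x (λ y → h (step G ℓ y)))

-- The hypothesis on `f` expresses determinism without inspecting decision trees: every expectation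
-- is an evaluation at `g a`.
outcome-mapA : ∀ {d n k} {A B : Set} (G : SGraph d n) (f : A → Algorithm d n B) (g : A → B) →
               (∀ a h → outcome G (f a) h ≡ h (g a)) →
               ∀ (as : Vec A k) h → outcome G (mapA f as) h ≡ h (Vec.map g as)
outcome-mapA G f g det []       h = refl
outcome-mapA G f g det (a ∷ as) h = begin
  outcome G (f a >>= λ b → mapA f as >>= λ bs → return (b ∷ bs)) h
    ≡⟨ outcome->>= G (f a) (λ b → mapA f as >>= λ bs → return (b ∷ bs)) h ⟩
  outcome G (f a) (λ b → outcome G (mapA f as >>= λ bs → return (b ∷ bs)) h)
    ≡⟨ det a (λ b → outcome G (mapA f as >>= λ bs → return (b ∷ bs)) h) ⟩
  outcome G (mapA f as >>= λ bs → return (g a ∷ bs)) h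
    ≡⟨ outcome->>= G (mapA f as) (λ bs → return (g a ∷ bs)) h ⟩
  outcome G (mapA f as) (λ bs → h (g a ∷ bs))
    ≡⟨ outcome-mapA G f g det as (λ bs → h (g a ∷ bs)) ⟩
  h (Vec.map g (a ∷ as)) ∎
  where open ≡-Reasoning

outcome-computeStab∩ : ∀ {d n} (G : SGraph d n) P x h → outcome G (computeStab∩ P x) h ≡ h (Stab∩ G x P)
outcome-computeStab∩ G P x = outcome-mapA G (λ w → walk w x >>= λ y → return (does (y ≟ x))) (λ w → does (Stab? G x w))
  (λ w h → trans (outcome->>= G (walk w x) (λ y → return (does (y ≟ x))) h) (outcome-walk G w x (λ y → h (does (y ≟ x)))))
  (Vec.fromList (words P))

module _ {n : ℕ} .{{_ : NonZero n}} where

  mean : (Fin n → ℚ) → ℚ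
  mean f = (ℤ.+ 1 / n) * ∑ (allFin n) f

  mean-+ : ∀ f g → mean (λ x → f x + g x) ≡ mean f + mean g
  mean-+ f g = trans (cong ((ℤ.+ 1 / n) *_) (∑-+ f g (allFin n)))
    (ℚₚ.*-distribˡ-+ (ℤ.+ 1 / n) (∑ (allFin n) f) (∑ (allFin n) g))

  mean-*ˡ : ∀ c f → mean (λ x → c * f x) ≡ c * mean f
  mean-*ˡ c f = trans (cong ((ℤ.+ 1 / n) *_) (∑-*ˡ c f (allFin n))) (lemma (ℤ.+ 1 / n) c (∑ (allFin n) f))
    where
    lemma : ∀ a b c → a * (b * c) ≡ b * (a * c)
    lemma = solve-∀ ℚ-ring

  mean-cong : ∀ {f g} → f ≗ g → mean f ≡ mean g
  mean-cong eq = cong ((ℤ.+ 1 / n) *_) (∑-cong (allFin n) eq)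

  mean-mono : ∀ {f g} → (∀ x → f x ≤ g x) → mean f ≤ mean g
  mean-mono le = *-monoˡ (0≤1/n n) (∑-mono (allFin n) le)

  -- The expectation over `k` independent draws, in the form of an iterated mean so that moments can
  -- be computed by induction on `k`.
  samples : ∀ k → (Vec (Fin n) k → ℚ) → ℚ
  samples zero    f = f []
  samples (suc k) f = mean λ x → samples k λ xs → f (x ∷ xs)

  samples-+ : ∀ k f g → samples k (λ xs → f xs + g xs) ≡ samples k f + samples k g
  samples-+ zero    f g = refl
  samples-+ (suc k) f g = trans (mean-cong λ x → samples-+ k (λ xs → f (x ∷ xs)) (λ xs → g (x ∷ xs)))
    (mean-+ (λ x → samples k λ xs → f (x ∷ xs)) (λ x → samples k λ xs → g (x ∷ xs)))

  samples-*ˡ : ∀ k c f → samples k (λ xs → c * f xs) ≡ c * samples k f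
  samples-*ˡ zero    c f = refl
  samples-*ˡ (suc k) c f = trans (mean-cong λ x → samples-*ˡ k c (λ xs → f (x ∷ xs)))
    (mean-*ˡ c (λ x → samples k λ xs → f (x ∷ xs)))

  samples-cong : ∀ k {f g} → f ≗ g → samples k f ≡ samples k g
  samples-cong zero    eq = eq []
  samples-cong (suc k) eq = mean-cong λ x → samples-cong k λ xs → eq (x ∷ xs)

  samples-mono : ∀ k {f g} → (∀ xs → f xs ≤ g xs) → samples k f ≤ samples k g
  samples-mono zero    le = le []
  samples-mono (suc k) le = mean-mono λ x → samples-mono k λ xs → le (x ∷ xs)

  samples-const : ∀ k c → samples k (λ _ → c) ≡ c
  samples-const zero    c = refl
  samples-const (suc k) c = trans (mean-cong λ _ → samples-const k c) (average-const n c)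

  samples-∑ : ∀ {A : Set} k (f : A → Vec (Fin n) k → ℚ) as →
              samples k (λ xs → ∑ as (λ a → f a xs)) ≡ ∑ as (λ a → samples k (f a))
  samples-∑ k f []       = samples-const k 0ℚ
  samples-∑ k f (a ∷ as) = trans (samples-+ k (f a) (λ xs → ∑ as (λ a → f a xs))) (cong (samples k (f a) +_) (samples-∑ k f as))

  outcome-sampleVertices : ∀ {d} (G : SGraph d n) k h → outcome G (sampleVertices k) h ≡ samples k h
  outcome-sampleVertices G zero    h = refl
  outcome-sampleVertices G (suc k) h = mean-cong λ x → trans
    (outcome->>= G (sampleVertices k) (λ xs → return (x ∷ xs)) h)
    (outcome-sampleVertices G k (λ xs → h (x ∷ xs)))

  total : ∀ {k} → (Fin n → ℚ) → Vec (Fin n) k → ℚ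
  total y []       = 0ℚ
  total y (x ∷ xs) = y x + total y xs

  module _ (y : Fin n → ℚ) (centred : mean y ≡ 0ℚ) where

    samples-total : ∀ k → samples k (total y) ≡ 0ℚ
    samples-total zero    = refl
    samples-total (suc k) = begin
      mean (λ x → samples k λ xs → y x + total y xs)
        ≡⟨ mean-cong (λ x → trans (samples-+ k (λ _ → y x) (total y))
             (trans (cong₂ _+_ (samples-const k (y x)) (samples-total k)) (ℚₚ.+-identityʳ (y x)))) ⟩
      mean y
        ≡⟨ centred ⟩
      0ℚ ∎
      where open ≡-Reasoning

    -- Variances of independent centred variables add: in the expanded square the cross term carries
    -- the mean of `total y`, which is zero.
    samples-total² : ∀ k → samples k (λ xs → total y xs * total y xs) ≡ fromℕ k * mean (λ x → y x * y x)
    samples-total² zero    = sym (trans (cong (_* mean (λ x → y x * y x)) fromℕ-0) (ℚₚ.*-zeroˡ (mean (λ x → y x * y x))))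
    samples-total² (suc k) = begin
      mean (λ x → samples k λ xs → (y x + total y xs) * (y x + total y xs))
        ≡⟨ mean-cong (λ x → expand x) ⟩
      mean (λ x → y x * y x + fromℕ k * v)
        ≡⟨ mean-+ (λ x → y x * y x) (λ _ → fromℕ k * v) ⟩
      v + mean (λ _ → fromℕ k * v)
        ≡⟨ cong (v +_) (average-const n (fromℕ k * v)) ⟩
      v + fromℕ k * v
        ≡⟨ collect v (fromℕ k) ⟩
      (1ℚ + fromℕ k) * v
        ≡⟨ cong (_* v) (fromℕ-suc k) ⟨
      fromℕ (suc k) * v ∎
      where
      open ≡-Reasoning
      v : ℚ
      v = mean (λ x → y x * y x)
      collect : ∀ v k → v + k * v ≡ (1ℚ + k) * v
      collect = solve-∀ ℚ-ring
      square : ∀ a s → (a + s) * (a + s) ≡ (a * a + (a + a) * s) + s * s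
      square = solve-∀ ℚ-ring
      drop-cross : ∀ a b → a * a + (a + a) * 0ℚ + b ≡ a * a + b
      drop-cross = solve-∀ ℚ-ring
      expand : ∀ x → samples k (λ xs → (y x + total y xs) * (y x + total y xs)) ≡ y x * y x + fromℕ k * v
      expand x = begin
        samples k (λ xs → (y x + total y xs) * (y x + total y xs))
          ≡⟨ samples-cong k (λ xs → square (y x) (total y xs)) ⟩
        samples k (λ xs → (y x * y x + (y x + y x) * total y xs) + total y xs * total y xs)
          ≡⟨ samples-+ k (λ xs → y x * y x + (y x + y x) * total y xs) (λ xs → total y xs * total y xs) ⟩
        samples k (λ xs → y x * y x + (y x + y x) * total y xs) + samples k (λ xs → total y xs * total y xs)
          ≡⟨ cong₂ _+_ (trans (samples-+ k (λ _ → y x * y x) (λ xs → (y x + y x) * total y xs))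
               (cong₂ _+_ (samples-const k (y x * y x)) (trans (samples-*ˡ k (y x + y x) (total y)) (cong ((y x + y x) *_) (samples-total k)))))
               (samples-total² k) ⟩
        y x * y x + (y x + y x) * 0ℚ + fromℕ k * v
          ≡⟨ drop-cross (y x) (fromℕ k * v) ⟩
        y x * y x + fromℕ k * v ∎

-- Concentration of the empirical distribution

p²≤1 : ∀ {p} → 0ℚ ≤ p → p ≤ 1ℚ → p * p ≤ 1ℚ
p²≤1 {p} 0≤p p≤1 = ℚₚ.≤-trans (*-monoˡ 0≤p p≤1) (subst (_≤ 1ℚ) (sym (ℚₚ.*-identityʳ p)) p≤1)

dTV-triangle : ∀ {p} (θ μ ν : Distribution p) → dTV μ ν ≤ dTV θ μ + dTV θ ν
dTV-triangle {p} θ μ ν = begin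
  ½ * ∑ (subsets p) (λ ω → ∣ μ ω - ν ω ∣)
    ≤⟨ *-monoˡ (ℚₚ.nonNegative⁻¹ ½) (∑-mono (subsets p) pointwise) ⟩
  ½ * ∑ (subsets p) (λ ω → ∣ θ ω - μ ω ∣ + ∣ θ ω - ν ω ∣)
    ≡⟨ cong (½ *_) (∑-+ (λ ω → ∣ θ ω - μ ω ∣) (λ ω → ∣ θ ω - ν ω ∣) (subsets p)) ⟩
  ½ * (∑ (subsets p) (λ ω → ∣ θ ω - μ ω ∣) + ∑ (subsets p) (λ ω → ∣ θ ω - ν ω ∣))
    ≡⟨ ℚₚ.*-distribˡ-+ ½ (∑ (subsets p) (λ ω → ∣ θ ω - μ ω ∣)) (∑ (subsets p) (λ ω → ∣ θ ω - ν ω ∣)) ⟩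
  dTV θ μ + dTV θ ν ∎
  where
  open ℚₚ.≤-Reasoning
  through : ∀ t a b → a - b ≡ - (t - a) + (t - b)
  through = solve-∀ ℚ-ring
  pointwise : ∀ ω → ∣ μ ω - ν ω ∣ ≤ ∣ θ ω - μ ω ∣ + ∣ θ ω - ν ω ∣
  pointwise ω = begin
    ∣ μ ω - ν ω ∣                            ≡⟨ cong ∣_∣ (through (θ ω) (μ ω) (ν ω)) ⟩
    ∣ - (θ ω - μ ω) + (θ ω - ν ω) ∣          ≤⟨ ℚₚ.∣p+q∣≤∣p∣+∣q∣ (- (θ ω - μ ω)) (θ ω - ν ω) ⟩
    ∣ - (θ ω - μ ω) ∣ + ∣ θ ω - ν ω ∣        ≡⟨ cong (_+ ∣ θ ω - ν ω ∣) (ℚₚ.∣-p∣≡∣p∣ (θ ω - μ ω)) ⟩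
    ∣ θ ω - μ ω ∣ + ∣ θ ω - ν ω ∣            ∎

-- The square of `∣ a ∣ - c` is nonnegative. This trades absolute errors for squared ones without
-- square roots.
am-gm : ∀ c a → (c + c) * ∣ a ∣ ≤ a * a + c * c
am-gm c a = ≤-from (0≤p² (∣ a ∣ - c)) (trans (square ∣ a ∣ c) (cong (λ s → s + c * c + 0ℚ) abs²))
  where
  square : ∀ a c → (c + c) * a + (a - c) * (a - c) ≡ a * a + c * c + 0ℚ
  square = solve-∀ ℚ-ring
  neg² : ∀ a → - a * - a ≡ a * a
  neg² = solve-∀ ℚ-ring
  abs² : ∣ a ∣ * ∣ a ∣ ≡ a * a
  abs² with ℚₚ.∣p∣≡p∨∣p∣≡-p a
  ... | inj₁ eq = cong₂ _*_ eq eq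
  ... | inj₂ eq = trans (cong₂ _*_ eq eq) (neg² a)

module _ {d n : ℕ} .{{_ : NonZero n}} (G : SGraph d n) (P : FinSubset d) where

  private
    type : Fin n → Subset (size P)
    type x = Stab∩ G x P

    deviation : Subset (size P) → Fin n → ℚ
    deviation ω x = 𝟙 (type x ≟ˢ ω) - N G P ω

    N-as-mean : ∀ ω → N G P ω ≡ mean (λ x → 𝟙 (type x ≟ˢ ω))
    N-as-mean ω = trans (N-as-frequency G P ω) (ℚₚ.*-comm (frequency type (allFin n) ω) (ℤ.+ 1 / n))

    0≤N : ∀ ω → 0ℚ ≤ N G P ω
    0≤N ω = subst (0ℚ ≤_) (sym (N-as-mean ω)) (0≤* (0≤1/n n) (∑-nonneg (allFin n) λ x → 0≤𝟙 (type x ≟ˢ ω)))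

    N≤1 : ∀ ω → N G P ω ≤ 1ℚ
    N≤1 ω = subst₂ _≤_ (sym (N-as-mean ω)) (average-const n 1ℚ) (mean-mono λ x → 𝟙≤1 (type x ≟ˢ ω))

    centred : ∀ ω → mean (deviation ω) ≡ 0ℚ
    centred ω = begin
      mean (deviation ω)                                          ≡⟨ mean-+ (λ x → 𝟙 (type x ≟ˢ ω)) (λ _ → - N G P ω) ⟩
      mean (λ x → 𝟙 (type x ≟ˢ ω)) + mean (λ _ → - N G P ω)       ≡⟨ cong₂ _+_ (sym (N-as-mean ω)) (average-const n (- N G P ω)) ⟩
      N G P ω - N G P ω                                           ≡⟨ ℚₚ.+-inverseʳ (N G P ω) ⟩
      0ℚ                                                          ∎
      where open ≡-Reasoning

    deviation²≤1 : ∀ ω x → deviation ω x * deviation ω x ≤ 1ℚ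
    deviation²≤1 ω x = bounded (type x ≟ˢ ω)
      where
      shift : ∀ a b → 0ℚ + a ≡ a - b + b
      shift = solve-∀ ℚ-ring
      shift′ : ∀ a b → a - b + b ≡ a + 0ℚ
      shift′ = solve-∀ ℚ-ring
      square : ∀ a → a * a ≡ (0ℚ - a) * (0ℚ - a)
      square = solve-∀ ℚ-ring
      bounded : (e : Dec (type x ≡ ω)) → (𝟙 e - N G P ω) * (𝟙 e - N G P ω) ≤ 1ℚ
      bounded (yes _) = p²≤1 {1ℚ - N G P ω} (≤-from (N≤1 ω) (shift 1ℚ (N G P ω))) (≤-from (0≤N ω) (shift′ 1ℚ (N G P ω)))
      bounded (no _)  = subst (_≤ 1ℚ) (square (N G P ω)) (p²≤1 {N G P ω} (0≤N ω) (N≤1 ω))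

    variance≤1 : ∀ ω → mean (λ x → deviation ω x * deviation ω x) ≤ 1ℚ
    variance≤1 ω = subst (mean (λ x → deviation ω x * deviation ω x) ≤_) (average-const n 1ℚ) (mean-mono (deviation²≤1 ω))

  empirical : ∀ {k} .{{_ : NonZero k}} → Vec (Fin n) k → Distribution (size P)
  empirical xs = uniformEntry (Vec.map (λ x → Stab∩ G x P) xs)

  private
    count-total : ∀ {k} ω (xs : Vec (Fin n) k) →
                  fromℕ (Vec.count (_≟ˢ ω) (Vec.map type xs)) ≡ total (deviation ω) xs + fromℕ k * N G P ω
    count-total ω [] = trans fromℕ-0 (sym (trans (ℚₚ.+-identityˡ (fromℕ 0 * N G P ω))
      (trans (cong (_* N G P ω) fromℕ-0) (ℚₚ.*-zeroˡ (N G P ω)))))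
    count-total {suc k} ω (x ∷ xs) = trans (count-∷ (type x ≟ˢ ω)) (trans
      (cong (𝟙 (type x ≟ˢ ω) +_) (count-total ω xs))
      (trans (regroup (𝟙 (type x ≟ˢ ω)) (total (deviation ω) xs) (fromℕ k) (N G P ω))
        (cong (λ m → deviation ω x + total (deviation ω) xs + m * N G P ω) (sym (fromℕ-suc k)))))
      where
      count-∷ : (e : Dec (type x ≡ ω)) → fromℕ ((if does e then suc else id) (Vec.count (_≟ˢ ω) (Vec.map type xs))) ≡
                                         𝟙 e + fromℕ (Vec.count (_≟ˢ ω) (Vec.map type xs))
      count-∷ (yes _) = fromℕ-suc (Vec.count (_≟ˢ ω) (Vec.map type xs))
      count-∷ (no _)  = sym (ℚₚ.+-identityˡ (fromℕ (Vec.count (_≟ˢ ω) (Vec.map type xs))))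
      regroup : ∀ i s k m → i + (s + k * m) ≡ i - m + s + (1ℚ + k) * m
      regroup = solve-∀ ℚ-ring

  module _ (k : ℕ) .{{_ : NonZero k}} where

    error : Subset (size P) → Vec (Fin n) k → ℚ
    error ω xs = empirical xs ω - N G P ω

    error-total : ∀ ω xs → error ω xs ≡ (ℤ.+ 1 / k) * total (deviation ω) xs
    error-total ω xs = begin
      empirical xs ω - N G P ω
        ≡⟨ cong (_- N G P ω) (trans (/-as-* (Vec.count (_≟ˢ ω) (Vec.map type xs)) k) (cong (_* (ℤ.+ 1 / k)) (count-total ω xs))) ⟩
      (total (deviation ω) xs + fromℕ k * N G P ω) * (ℤ.+ 1 / k) - N G P ω
        ≡⟨ regroup (total (deviation ω) xs) (fromℕ k) (N G P ω) (ℤ.+ 1 / k) ⟩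
      (ℤ.+ 1 / k) * total (deviation ω) xs + (fromℕ k * (ℤ.+ 1 / k) * N G P ω - N G P ω)
        ≡⟨ cong (λ c → (ℤ.+ 1 / k) * total (deviation ω) xs + (c * N G P ω - N G P ω)) (n*1/n≡1 k) ⟩
      (ℤ.+ 1 / k) * total (deviation ω) xs + (1ℚ * N G P ω - N G P ω)
        ≡⟨ cancel ((ℤ.+ 1 / k) * total (deviation ω) xs) (N G P ω) ⟩
      (ℤ.+ 1 / k) * total (deviation ω) xs ∎
      where
      open ≡-Reasoning
      regroup : ∀ t k m i → (t + k * m) * i - m ≡ i * t + (k * i * m - m)
      regroup = solve-∀ ℚ-ring
      cancel : ∀ a m → a + (1ℚ * m - m) ≡ a
      cancel = solve-∀ ℚ-ring

    squaredError : Vec (Fin n) k → ℚ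
    squaredError xs = ∑ (subsets (size P)) (λ ω → error ω xs * error ω xs)

    samples-error² : ∀ ω → fromℕ k * samples k (λ xs → error ω xs * error ω xs) ≤ 1ℚ
    samples-error² ω = begin
      fromℕ k * samples k (λ xs → error ω xs * error ω xs)
        ≡⟨ cong (fromℕ k *_) (trans (samples-cong k λ xs → trans (cong₂ _*_ (error-total ω xs) (error-total ω xs)) (square i (Y xs)))
             (trans (samples-*ˡ k (i * i) (λ xs → Y xs * Y xs)) (cong (i * i *_) (samples-total² (deviation ω) (centred ω) k)))) ⟩
      fromℕ k * (i * i * (fromℕ k * v))
        ≡⟨ regroup (fromℕ k) i v ⟩
      fromℕ k * i * (fromℕ k * i) * v
        ≡⟨ cong (λ c → c * c * v) (n*1/n≡1 k) ⟩
      1ℚ * 1ℚ * v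
        ≡⟨ ℚₚ.*-identityˡ v ⟩
      v
        ≤⟨ variance≤1 ω ⟩
      1ℚ ∎
      where
      open ℚₚ.≤-Reasoning
      i v : ℚ
      i = ℤ.+ 1 / k
      v = mean (λ x → deviation ω x * deviation ω x)
      Y : Vec (Fin n) k → ℚ
      Y = total (deviation ω)
      square : ∀ i t → i * t * (i * t) ≡ i * i * (t * t)
      square = solve-∀ ℚ-ring
      regroup : ∀ k i v → k * (i * i * (k * v)) ≡ k * i * (k * i) * v
      regroup = solve-∀ ℚ-ring

    samples-squaredError : fromℕ k * samples k squaredError ≤ fromℕ (length (subsets (size P)))
    samples-squaredError = begin
      fromℕ k * samples k squaredError
        ≡⟨ cong (fromℕ k *_) (samples-∑ k (λ ω xs → error ω xs * error ω xs) (subsets (size P))) ⟩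
      fromℕ k * ∑ (subsets (size P)) (λ ω → samples k (λ xs → error ω xs * error ω xs))
        ≡⟨ ∑-*ˡ (fromℕ k) (λ ω → samples k (λ xs → error ω xs * error ω xs)) (subsets (size P)) ⟨
      ∑ (subsets (size P)) (λ ω → fromℕ k * samples k (λ xs → error ω xs * error ω xs))
        ≤⟨ ∑-mono (subsets (size P)) samples-error² ⟩
      ∑ (subsets (size P)) (λ _ → 1ℚ)
        ≡⟨ trans (∑-const 1ℚ (subsets (size P))) (ℚₚ.*-identityʳ (fromℕ (length (subsets (size P))))) ⟩
      fromℕ (length (subsets (size P))) ∎
      where open ℚₚ.≤-Reasoning

    -- If the distance exceeds `τ`, the absolute errors sum to more than `2 τ`. Then `am-gm`, summed
    -- over the `L` subsets, bounds `4 c τ` by `squaredError + L c²`, hence by `squaredError + c τ`.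
    -- Being linear in the indicator, the inequality can be averaged over samples.
    chebyshev : ∀ {τ c} → 0ℚ ≤ τ → 0ℚ ≤ c → fromℕ (length (subsets (size P))) * c ≤ τ → ∀ xs →
                c * τ ≤ c * τ * 𝟙 (dTV (empirical xs) (N G P) ℚₚ.≤? τ) + squaredError xs
    chebyshev {τ} {c} 0≤τ 0≤c Lc≤τ xs = split (dTV (empirical xs) (N G P) ℚₚ.≤? τ)
      where
      split : (e : Dec (dTV (empirical xs) (N G P) ≤ τ)) → c * τ ≤ c * τ * 𝟙 e + squaredError xs
      split (yes _) = subst (_≤ c * τ * 1ℚ + squaredError xs) (ℚₚ.*-identityʳ (c * τ))
        (p≤p+q (∑-nonneg (subsets (size P)) λ ω → 0≤p² (error ω xs)))
      split (no large) = ≤-from (ℚₚ.+-mono-≤ (ℚₚ.+-mono-≤ far near-bound) (0≤+ 0≤cτ 0≤cτ))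
        (linear c τ (squaredError xs) ((c + c) * A))
        where
        open ℚₚ.≤-Reasoning
        L : ℕ
        L = length (subsets (size P))
        A : ℚ
        A = ∑ (subsets (size P)) (λ ω → ∣ error ω xs ∣)
        0≤cτ : 0ℚ ≤ c * τ
        0≤cτ = 0≤* 0≤c 0≤τ
        halves : ∀ s → s ≡ ½ * s + ½ * s
        halves s = trans (sym (ℚₚ.*-identityˡ s)) (ℚₚ.*-distribʳ-+ s ½ ½)
        far : (c + c) * (τ + τ) ≤ (c + c) * A
        far = *-monoˡ (0≤+ 0≤c 0≤c) (subst (τ + τ ≤_) (sym (halves A))
          (ℚₚ.+-mono-≤ (ℚₚ.<⇒≤ (ℚₚ.≰⇒> large)) (ℚₚ.<⇒≤ (ℚₚ.≰⇒> large))))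
        near-bound : (c + c) * A ≤ squaredError xs + c * τ
        near-bound = begin
          (c + c) * A
            ≡⟨ ∑-*ˡ (c + c) (λ ω → ∣ error ω xs ∣) (subsets (size P)) ⟨
          ∑ (subsets (size P)) (λ ω → (c + c) * ∣ error ω xs ∣)
            ≤⟨ ∑-mono (subsets (size P)) (λ ω → am-gm c (error ω xs)) ⟩
          ∑ (subsets (size P)) (λ ω → error ω xs * error ω xs + c * c)
            ≡⟨ trans (∑-+ (λ ω → error ω xs * error ω xs) (λ _ → c * c) (subsets (size P)))
                 (cong (squaredError xs +_) (∑-const (c * c) (subsets (size P)))) ⟩
          squaredError xs + fromℕ L * (c * c)
            ≡⟨ cong (squaredError xs +_) (rotate (fromℕ L) c) ⟩
          squaredError xs + c * (fromℕ L * c)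
            ≤⟨ ℚₚ.+-monoʳ-≤ (squaredError xs) (*-monoˡ 0≤c Lc≤τ) ⟩
          squaredError xs + c * τ ∎
          where
          rotate : ∀ l c → l * (c * c) ≡ c * (l * c)
          rotate = solve-∀ ℚ-ring
        linear : ∀ c t s a → c * t + (a + (s + c * t) + (c * t + c * t)) ≡ c * t * 0ℚ + s + ((c + c) * (t + t) + a + 0ℚ)
        linear = solve-∀ ℚ-ring

-- The local statistics matcher

-- The denominator of `q` itself serves, since the numerator of a positive fraction is at least one.
archimedean : ∀ {q} → 0ℚ < q → ∃ λ m → ℤ.+ 1 / suc m ≤ q
archimedean {q@(mkℚ (ℤ.+ suc i) m _)} 0<q = m , ℚₚ.toℚᵘ-cancel-≤ (ℚᵘₚ.≤-respˡ-≃ (ℚᵘₚ.≃-sym (toℚᵘ-/ (ℤ.+ 1) (suc m)))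
  (*≤* (ℤₚ.*-monoʳ-≤-nonNeg (ℤ.+ suc m) (ℤ.+≤+ {1} {suc i} (ℕ.s≤s ℕ.z≤n)))))
archimedean {q@(mkℚ (ℤ.+ zero) m _)} 0<q = ⊥-elim (ℚₚ.<-irrefl (sym (ℚₚ.↥p≡0⇒p≡0 q refl)) 0<q)
archimedean {q@(mkℚ ℤ.-[1+ i ] m _)} 0<q = ⊥-elim (ℚₚ.<-asym 0<q (ℚₚ.negative⁻¹ q))

AtMostQueries-mono : ∀ {d n A} (G : SGraph d n) {q q′} (t : Algorithm d n A) → q ℕ.≤ q′ → AtMostQueries G q t → AtMostQueries G q′ t
AtMostQueries-mono G (return _)    _           _     = tt
AtMostQueries-mono G (query ℓ x κ) (ℕ.s≤s q≤q′) bound = AtMostQueries-mono G (κ (step G ℓ x)) q≤q′ bound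
AtMostQueries-mono G (sample m κ)  q≤q′        bound = λ i → AtMostQueries-mono G (κ i) q≤q′ (bound i)

AtMostQueries->>= : ∀ {d n A B} (G : SGraph d n) {q q′} (t : Algorithm d n A) {f : A → Algorithm d n B} →
                    AtMostQueries G q t → (∀ a → AtMostQueries G q′ (f a)) → AtMostQueries G (q ℕ.+ q′) (t >>= f)
AtMostQueries->>= G {q} {q′} (return a) {f} _ bounds = AtMostQueries-mono G (f a) (ℕₚ.m≤n+m q′ q) (bounds a)
AtMostQueries->>= G {suc q} (query ℓ x κ) bound bounds = AtMostQueries->>= G {q} (κ (step G ℓ x)) bound bounds
AtMostQueries->>= G {q} (sample m κ) bound bounds = λ i → AtMostQueries->>= G {q} (κ i) (bound i) bounds

queries-walk : ∀ {d n} (G : SGraph d n) w x → AtMostQueries G (length w) (walk w x)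
queries-walk G []      x = tt
queries-walk G (ℓ ∷ w) x = subst (λ q → AtMostQueries G q (walk (ℓ ∷ w) x)) (ℕₚ.+-comm (length w) 1)
  (AtMostQueries->>= G (walk w x) (queries-walk G w x) λ _ → tt)

queries-mapA : ∀ {d n k} {A B : Set} (G : SGraph d n) {f : A → Algorithm d n B} (cost : A → ℕ) →
               (∀ a → AtMostQueries G (cost a) (f a)) → (as : Vec A k) →
               AtMostQueries G (Vec.sum (Vec.map cost as)) (mapA f as)
queries-mapA G cost bound [] = tt
queries-mapA G {f} cost bound (a ∷ as) = AtMostQueries->>= G {cost a} (f a) (bound a) λ b →
  subst (λ q → AtMostQueries G q (mapA f as >>= λ bs → return (b ∷ bs))) (ℕₚ.+-identityʳ (Vec.sum (Vec.map cost as)))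
    (AtMostQueries->>= G {Vec.sum (Vec.map cost as)} (mapA f as) (queries-mapA G cost bound as) λ _ → tt)

queries-sampleVertices : ∀ {d n} .{{_ : NonZero n}} (G : SGraph d n) k → AtMostQueries G 0 (sampleVertices k)
queries-sampleVertices G zero    = tt
queries-sampleVertices G (suc k) = λ x →
  AtMostQueries->>= G {0} {0} (sampleVertices k) (queries-sampleVertices G k) λ _ → tt

totalLength : ∀ {d} → FinSubset d → ℕ
totalLength P = Vec.sum (Vec.map length (Vec.fromList (words P)))

queries-computeStab∩ : ∀ {d n} (G : SGraph d n) P x → AtMostQueries G (totalLength P) (computeStab∩ P x)
queries-computeStab∩ G P x = queries-mapA G length (λ w →
  subst (λ q → AtMostQueries G q (walk w x >>= λ y → return (does (y ≟ x)))) (ℕₚ.+-identityʳ (length w))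
    (AtMostQueries->>= G (walk w x) (queries-walk G w x) λ _ → tt)) (Vec.fromList (words P))

sum-const : ∀ {A : Set} {k} c (as : Vec A k) → Vec.sum (Vec.map (λ _ → c) as) ≡ k ℕ.* c
sum-const c []       = refl
sum-const c (_ ∷ as) = cong (c ℕ.+_) (sum-const c as)

queries-LSM : ∀ {d n} .{{_ : NonZero n}} (G : SGraph d n) E k .{{_ : NonZero k}} P δ →
              AtMostQueries G (k ℕ.* totalLength P) (LSM E k P δ n)
queries-LSM {n = n} G E k P δ = AtMostQueries->>= G {0} (sampleVertices k) (queries-sampleVertices G k) λ xs →
  subst (λ q → AtMostQueries G q (decide xs)) (trans (ℕₚ.+-identityʳ _) (sum-const (totalLength P) xs))
    (AtMostQueries->>= G (mapA (computeStab∩ P) xs) (queries-mapA G (λ _ → totalLength P) (queries-computeStab∩ G P) xs) λ _ → tt)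
  where
  decide : Vec (Fin n) k → Algorithm _ n Bool
  decide xs = mapA (computeStab∩ P) xs >>= λ ωs → return (does (matches? E n P δ (uniformEntry ωs)))

-- Isolates the only randomness, the sampled vertices, from the deterministic queries and the final
-- decision.
Pr-LSM : ∀ {d n} .{{_ : NonZero n}} (G : SGraph d n) E k .{{_ : NonZero k}} P δ b →
         Pr G b (LSM E k P δ n) ≡ samples k (λ xs → 𝟙 (does (matches? E n P δ (empirical G P xs)) ≟ᵇ b))
Pr-LSM {n = n} G E k P δ b = begin
  Pr G b (LSM E k P δ n)
    ≡⟨ Pr-as-outcome G b (LSM E k P δ n) ⟩
  outcome G (LSM E k P δ n) h
    ≡⟨ outcome->>= G (sampleVertices k) decide h ⟩
  outcome G (sampleVertices k) (λ xs → outcome G (decide xs) h)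
    ≡⟨ outcome-sampleVertices G k (λ xs → outcome G (decide xs) h) ⟩
  samples k (λ xs → outcome G (decide xs) h)
    ≡⟨ samples-cong k (λ xs → trans (outcome->>= G (mapA (computeStab∩ P) xs) answer h)
         (outcome-mapA G (computeStab∩ P) (λ x → Stab∩ G x P) (outcome-computeStab∩ G P) xs (λ ωs → outcome G (answer ωs) h))) ⟩
  samples k (λ xs → 𝟙 (does (matches? E n P δ (empirical G P xs)) ≟ᵇ b)) ∎
  where
  open ≡-Reasoning
  h : Bool → ℚ
  h a = 𝟙 (a ≟ᵇ b)
  answer : Vec (Subset (size P)) k → Algorithm _ n Bool
  answer ωs = return (does (matches? E n P δ (uniformEntry ωs)))
  decide : Vec (Fin n) k → Algorithm _ n Bool
  decide xs = mapA (computeStab∩ P) xs >>= answer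

module _ {d : ℕ} (P : FinSubset d) (m : ℕ) where

  private
    L : ℕ
    -- The successor makes `L` nonzero by its form, so that `c = τ / L` can be written down.
    L = suc (length (subsets (size P)))
    τ : ℚ
    τ = ℤ.+ 1 / suc m

  opaque

    -- The expected squared error is at most `L` over the sample size, and Markov's inequality
    -- divides it by `c τ = τ² / L`. The failure probability is thus at most `L² / τ²` over the
    -- sample size, and the factor 100 makes it one percent.
    sampleSize : ℕ
    sampleSize = 100 ℕ.* (suc m ℕ.* L ℕ.* (suc m ℕ.* L))

    sampleSize-nonZero : NonZero sampleSize
    sampleSize-nonZero = ℕₚ.m*n≢0 100 (suc m ℕ.* L ℕ.* (suc m ℕ.* L))

    fromℕ-sampleSize : fromℕ sampleSize ≡ fromℕ 100 * (fromℕ (suc m) * fromℕ L * (fromℕ (suc m) * fromℕ L))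
    fromℕ-sampleSize = trans (fromℕ-* 100 (suc m ℕ.* L ℕ.* (suc m ℕ.* L)))
      (cong (fromℕ 100 *_) (trans (fromℕ-* (suc m ℕ.* L) (suc m ℕ.* L)) (cong₂ _*_ (fromℕ-* (suc m) L) (fromℕ-* (suc m) L))))

  concentration : ∀ {n} .{{_ : NonZero n}} (G : SGraph d n) →
    ℤ.+ 99 / 100 ≤ samples sampleSize (λ xs → 𝟙 (dTV (empirical G P {{sampleSize-nonZero}} xs) (N G P) ℚₚ.≤? τ))
  concentration {n} G = ℚₚ.*-cancelˡ-≤-pos h {{positive (0<fromℕ 100)}} (begin
    h * (ℤ.+ 99 / 100)     ≡⟨ ℚₚ.*-comm h (ℤ.+ 99 / 100) ⟩
    (ℤ.+ 99 / 100) * h     ≡⟨ /-*-cancel 99 100 ⟩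
    fromℕ 99               ≤⟨ ≤-from h≤hA+1 (trans (swap-summands (fromℕ 99) (h * A)) (cong (h * A +_) (sym (fromℕ-suc 99)))) ⟩
    h * A                  ∎)
    where
    open ℚₚ.≤-Reasoning
    instance
      nonZero : NonZero sampleSize
      nonZero = sampleSize-nonZero
    h l c A : ℚ
    h = fromℕ 100
    l = fromℕ L
    c = τ * (ℤ.+ 1 / L)
    A = samples sampleSize (λ xs → 𝟙 (dTV (empirical G P xs) (N G P) ℚₚ.≤? τ))
    D : Vec (Fin n) sampleSize → ℚ
    D = squaredError G P sampleSize
    0≤c : 0ℚ ≤ c
    0≤c = 0≤* (0≤1/n (suc m)) (0≤1/n L)
    swap-summands : ∀ a b → a + (b + 1ℚ) ≡ b + (1ℚ + a)
    swap-summands = solve-∀ ℚ-ring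
    lc≡τ : l * c ≡ τ
    lc≡τ = trans (rotate l τ (ℤ.+ 1 / L)) (trans (cong (τ *_) (n*1/n≡1 L)) (ℚₚ.*-identityʳ τ))
      where
      rotate : ∀ a b c → a * (b * c) ≡ b * (a * c)
      rotate = solve-∀ ℚ-ring
    Lc≤τ : fromℕ (length (subsets (size P))) * c ≤ τ
    Lc≤τ = subst (fromℕ (length (subsets (size P))) * c ≤_) lc≡τ (*-monoʳ 0≤c (fromℕ-mono-≤ (ℕₚ.n≤1+n (length (subsets (size P))))))
    averaged : c * τ ≤ c * τ * A + samples sampleSize D
    averaged = begin
      c * τ
        ≡⟨ samples-const sampleSize (c * τ) ⟨
      samples sampleSize (λ _ → c * τ)
        ≤⟨ samples-mono sampleSize (chebyshev G P sampleSize (0≤1/n (suc m)) 0≤c Lc≤τ) ⟩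
      samples sampleSize (λ xs → c * τ * 𝟙 (dTV (empirical G P xs) (N G P) ℚₚ.≤? τ) + D xs)
        ≡⟨ trans (samples-+ sampleSize (λ xs → c * τ * 𝟙 (dTV (empirical G P xs) (N G P) ℚₚ.≤? τ)) D)
             (cong (_+ samples sampleSize D) (samples-*ˡ sampleSize (c * τ) (λ xs → 𝟙 (dTV (empirical G P xs) (N G P) ℚₚ.≤? τ)))) ⟩
      c * τ * A + samples sampleSize D ∎
    scaled : fromℕ sampleSize * (c * τ) ≡ l * h
    scaled = begin-equality
      fromℕ sampleSize * (c * τ)
        ≡⟨ cong (_* (c * τ)) fromℕ-sampleSize ⟩
      h * (fromℕ (suc m) * l * (fromℕ (suc m) * l)) * (τ * (ℤ.+ 1 / L) * τ)
        ≡⟨ regroup h (fromℕ (suc m)) l τ (ℤ.+ 1 / L) ⟩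
      l * h * (fromℕ (suc m) * τ) * (fromℕ (suc m) * τ) * (l * (ℤ.+ 1 / L))
        ≡⟨ cong₂ (λ a b → l * h * a * a * b) (n*1/n≡1 (suc m)) (n*1/n≡1 L) ⟩
      l * h * 1ℚ * 1ℚ * 1ℚ
        ≡⟨ trans (ℚₚ.*-identityʳ (l * h * 1ℚ * 1ℚ)) (trans (ℚₚ.*-identityʳ (l * h * 1ℚ)) (ℚₚ.*-identityʳ (l * h))) ⟩
      l * h ∎
      where
      regroup : ∀ h m l t i → h * (m * l * (m * l)) * (t * i * t) ≡ l * h * (m * t) * (m * t) * (l * i)
      regroup = solve-∀ ℚ-ring
    h≤hA+1 : h ≤ h * A + 1ℚ
    h≤hA+1 = ℚₚ.*-cancelˡ-≤-pos l {{positive (0<fromℕ L)}} (begin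
      l * h
        ≡⟨ scaled ⟨
      fromℕ sampleSize * (c * τ)
        ≤⟨ *-monoˡ (0≤fromℕ sampleSize) averaged ⟩
      fromℕ sampleSize * (c * τ * A + samples sampleSize D)
        ≡⟨ distribute (fromℕ sampleSize) (c * τ) A (samples sampleSize D) ⟩
      fromℕ sampleSize * (c * τ) * A + fromℕ sampleSize * samples sampleSize D
        ≤⟨ ℚₚ.+-mono-≤ (ℚₚ.≤-reflexive (cong (_* A) scaled)) (ℚₚ.≤-trans (samples-squaredError G P sampleSize)
             (fromℕ-mono-≤ (ℕₚ.n≤1+n (length (subsets (size P)))))) ⟩
      l * h * A + l
        ≡⟨ factor l h A ⟩
      l * (h * A + 1ℚ) ∎)
      where
      distribute : ∀ k c a s → k * (c * a + s) ≡ k * c * a + k * s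
      distribute = solve-∀ ℚ-ring
      factor : ∀ l h a → l * h * a + l ≡ l * (h * a + 1ℚ)
      factor = solve-∀ ℚ-ring

  -- Samples within `τ` of the true statistics lead to the right verdict: a solution matches itself,
  -- and a match for a far graph would put its statistics within `2 τ` of those of a solution.
  LSM-tester : ∀ (E : System d) (ε : ℝ) {q} → τ + τ < q →
    (∀ n .{{_ : NonZero n}} (G H : SGraph d n) → GSol E G → Far E ε H → q ≤ dTV (N G P) (N H P)) →
    IsTester E ε (sampleSize ℕ.* totalLength P)
      (LSM E sampleSize {{sampleSize-nonZero}} P (value (fromℚ>0 τ (0<1/n (suc m)))))
  LSM-tester E ε {q} 2τ<q separated n G =
    (λ sol → accurate true λ xs close → accept xs (G , sol , ≤⇒≤ℝ {τ} {0<1/n (suc m)} {dTV (empirical G P xs) (N G P)} close)) ,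
    (λ far → accurate false λ xs close → reject xs (λ (H , sol , match) → ℚₚ.<-irrefl refl (begin-strict
      dTV (N H P) (N G P)                                ≤⟨ dTV-triangle (empirical G P xs) (N H P) (N G P) ⟩
      dTV (empirical G P xs) (N H P) + dTV (empirical G P xs) (N G P)
                                                         ≤⟨ ℚₚ.+-mono-≤ (≤ℝ⇒≤ {τ} {0<1/n (suc m)} {dTV (empirical G P xs) (N H P)} match) close ⟩
      τ + τ                                              <⟨ 2τ<q ⟩
      q                                                  ≤⟨ separated n H G sol far ⟩
      dTV (N H P) (N G P)                                ∎))) ,
    queries-LSM G E sampleSize P δ
    where
    open ℚₚ.≤-Reasoning
    instance
      nonZero : NonZero sampleSize
      nonZero = sampleSize-nonZero
    δ : ℝ
    δ = value (fromℚ>0 τ (0<1/n (suc m)))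
    answer : Vec (Fin n) sampleSize → Bool
    answer xs = does (matches? E n P δ (empirical G P xs))
    accept : ∀ (xs : Vec (Fin n) sampleSize) → Matches E n P δ (empirical G P xs) → answer xs ≡ true
    accept xs = dec-true (matches? E n P δ (empirical G P xs))
    reject : ∀ (xs : Vec (Fin n) sampleSize) → ¬ Matches E n P δ (empirical G P xs) → answer xs ≡ false
    reject xs = dec-false (matches? E n P δ (empirical G P xs))
    accurate : ∀ b → (∀ (xs : Vec (Fin n) sampleSize) → dTV (empirical G P xs) (N G P) ≤ τ → answer xs ≡ b) →
               ℤ.+ 99 / 100 ≤ Pr G b (LSM E sampleSize P δ n)
    accurate b correct = begin
      ℤ.+ 99 / 100
        ≤⟨ concentration G ⟩
      samples sampleSize (λ xs → 𝟙 (dTV (empirical G P xs) (N G P) ℚₚ.≤? τ))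
        ≤⟨ samples-mono sampleSize (λ xs → 𝟙-mono (dTV (empirical G P xs) (N G P) ℚₚ.≤? τ) (answer xs ≟ᵇ b) (correct xs)) ⟩
      samples sampleSize (λ xs → 𝟙 (answer xs ≟ᵇ b))
        ≡⟨ Pr-LSM G E sampleSize P δ b ⟨
      Pr G b (LSM E sampleSize P δ n) ∎

-- The sample size is paired with a proof that it is nonzero, because the empirical distribution
-- divides by it.
MatcherTestable : ∀ {d} → System d → Set
MatcherTestable {d} E =
  ∃ λ (k : ℝ>0 → ∃ NonZero) → ∃ λ (P : ℝ>0 → FinSubset d) → ∃ λ (δ : ℝ>0 → ℝ>0) →
    IsFamilyOfTesters E λ ε → LSM E (proj₁ (k ε)) {{proj₂ (k ε)}} (P ε) (value (δ ε))

distinguishable⇒matcherTestable : ∀ {d} {E : System d} → StatisticallyDistinguishable E → MatcherTestable E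
distinguishable⇒matcherTestable {d} {E} distinguishable =
  (λ ε → sampleSize (P ε) (m ε) , sampleSize-nonZero (P ε) (m ε)) , P ,
  (λ ε → fromℚ>0 (ℤ.+ 1 / suc (m ε)) (0<1/n (suc (m ε)))) ,
  (λ ε → sampleSize (P ε) (m ε) ℕ.* totalLength (P ε)) ,
  λ ε → LSM-tester (P ε) (m ε) E (value ε) (2τ<q ε) λ n G H sol far → separated ε n G H sol far (q≤δ ε)
  where
  P : ℝ>0 → FinSubset d
  P ε = proj₁ (distinguishable ε)
  separated : ∀ ε n .{{_ : NonZero n}} (G H : SGraph d n) → GSol E G → Far E (value ε) H →
              value (proj₁ (proj₂ (distinguishable ε))) ℝ≤ dTV (N G (P ε)) (N H (P ε))
  separated ε = proj₂ (proj₂ (distinguishable ε))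
  -- The rational witness that the separation constant is positive stands in for that real number in
  -- all further arithmetic.
  q : ℝ>0 → ℚ
  q ε = proj₁ (proj₂ (proj₁ (proj₂ (distinguishable ε))))
  0<q : ∀ ε → 0ℚ < q ε
  0<q ε = proj₁ (proj₂ (proj₂ (proj₁ (proj₂ (distinguishable ε)))))
  q≤δ : ∀ ε → q ε ≤ℝ value (proj₁ (proj₂ (distinguishable ε)))
  q≤δ ε = proj₂ (proj₂ (proj₂ (proj₁ (proj₂ (distinguishable ε)))))
  quarter : ∀ {p} → 0ℚ < p → 0ℚ < ½ * (½ * p)
  quarter {p} 0<p = half (half 0<p)
    where
    half : ∀ {p} → 0ℚ < p → 0ℚ < ½ * p
    half {p} 0<p = subst (_< ½ * p) (ℚₚ.*-zeroʳ ½) (ℚₚ.*-monoʳ-<-pos ½ 0<p)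
  m : ℝ>0 → ℕ
  -- A quarter of `q ε` rather than a half, because `τ + τ < q ε` has to be strict.
  m ε = proj₁ (archimedean (quarter (0<q ε)))
  halves : ∀ s → ½ * s + ½ * s ≡ s
  halves s = trans (sym (ℚₚ.*-distribʳ-+ s ½ ½)) (ℚₚ.*-identityˡ s)
  2τ<q : ∀ ε → ℤ.+ 1 / suc (m ε) + ℤ.+ 1 / suc (m ε) < q ε
  2τ<q ε = begin-strict
    ℤ.+ 1 / suc (m ε) + ℤ.+ 1 / suc (m ε)          ≤⟨ ℚₚ.+-mono-≤ (proj₂ (archimedean (quarter (0<q ε)))) (proj₂ (archimedean (quarter (0<q ε)))) ⟩
    ½ * (½ * q ε) + ½ * (½ * q ε)                  ≡⟨ halves (½ * q ε) ⟩
    ½ * q ε                                        ≡⟨ ℚₚ.+-identityʳ (½ * q ε) ⟨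
    ½ * q ε + 0ℚ                                   <⟨ ℚₚ.+-monoʳ-< (½ * q ε) (subst (_< ½ * q ε) (ℚₚ.*-zeroʳ ½) (ℚₚ.*-monoʳ-<-pos ½ (0<q ε))) ⟩
    ½ * q ε + ½ * q ε                              ≡⟨ halves (q ε) ⟩
    q ε                                            ∎
    where open ℚₚ.≤-Reasoning

theorem3 : ∀ (d : ℕ) (E : System d) →
    (Testable E ⇔
    (∃ λ (k : ℝ>0 → ∃ NonZero) → ∃ λ (P : ℝ>0 → FinSubset d) → ∃ λ (δ : ℝ>0 → ℝ>0) →
    IsFamilyOfTesters E λ ε →
    LSM E (proj₁ (k ε)) {{proj₂ (k ε)}} (P ε) (value (δ ε))))
    × (Testable E ⇔ StatisticallyDistinguishable E)
theorem3 d E =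
  mk⇔ (distinguishable⇒matcherTestable ∘ testable⇒distinguishable) matcherTestable⇒testable ,
  mk⇔ testable⇒distinguishable (matcherTestable⇒testable ∘ distinguishable⇒matcherTestable)
  where
  matcherTestable⇒testable : MatcherTestable E → Testable E
  matcherTestable⇒testable (k , P , δ , testers) =
    (λ ε → LSM E (proj₁ (k ε)) {{proj₂ (k ε)}} (P ε) (value (δ ε))) , testers
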